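{- Let $h=(1,h_1,h_2,h_3)\in\mathbb{Z}^4$. Then $h$ is the $h$-vector of a $2$-dimensional Buchsbaum simplicial complex if and only if there exist a vector $h'=(1,h_1',h_2',h_3')\in\mathbb{Z}^4$ satisfying $0\le h_1'$, $0\le h_2'\le\binom{h_1'+1}{2}$ and $-\frac13 h_2'\le h_3'\le (h_2')^{\langle 2\rangle}$, and an integer $k\ge 0$ such that $h=h'+(0,3k,-3k,k)$.
   Context: A simplicial complex $\Delta$ on $[n]=\{1,\dots,n\}$ is a collection of subsets of $[n]$ with $\{i\}\in\Delta$ for all $i\in[n]$ and closed under taking subsets. $f_k(\Delta)$ is the number of faces of cardinality $k+1$ ($f_{ -1}=1$), $d=\dim\Delta+1$. The $h$-vector $(h_0,\dots,h_d)$ is defined by $\sum_{i=0}^d f_{i-1}(\Delta)(x-1)^{d-i}=\sum_{i=0}^d h_i(\Delta)x^{d-i}$. The link of a face $F$ is $\mathrm{lk}_\Delta(F)=\{G\subset[n]\setminus F: G\cup F\in\Delta\}$. Fix a field $K$ and let $\beta_i(\Delta)=\dim_K\tilde H_i(\Delta;K)$. A $(d-1)$-dimensional complex is Cohen–Macaulay if for every face $F$ (including $\emptyset$), $\beta_i(\mathrm{lk}_\Delta(F))=0$ for $i\neq d-1-|F|$. $\Delta$ is Buchsbaum if it is pure and $\mathrm{lk}_\Delta(v)$ is Cohen–Macaulay for every vertex $v$. For positive integers $a,d$, write the unique $d$-th Macaulay representation $a=\binom{a(d)+d}{d}+\cdots+\binom{a(k)+k}{k}$ with $k\ge1$, $a(d)\ge\cdots\ge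 a(k)\ge0$, and set $a^{\langle d\rangle}=\binom{a(d)+d+1}{d+1}+\cdots+\binom{a(k)+k+1}{k+1}$; $0^{\langle d\rangle}=0$. -}

module Defs where

open import Level using (Level) renaming (suc to lsuc)
open import Data.Bool using (Bool; true; false; _∧_; _∨_; not; if_then_else_)
open import Data.Nat using (ℕ; zero; suc; _+_; _∸_; _≤ᵇ_; _≡ᵇ_; _⊔_)
  renaming (_*_ to _*ℕ_)
open import Data.Nat.Combinatorics using (_C_)
open import Data.Integer using (ℤ; +_) renaming (_+_ to _+ℤ_; _*_ to _*ℤ_; -_ to -ℤ_)
open import Data.Fin using (Fin; zero; suc; punchIn; toℕ)
open import Data.Vec using (Vec; []; _∷_)
open import Data.List using (List; []; _∷_; _++_; map; filterᵇ; length; foldr; lookup; upTo)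
open import Data.Fin.Subset using (Subset; ∣_∣; _⊆_; _∩_; _∪_; ⁅_⁆)
open import Data.Product using (Σ; ∃; ∃-syntax; _×_; _,_)
open import Relation.Nullary using (¬_)
open import Relation.Binary.PropositionalEquality using (_≡_; _≢_)
open import Algebra.Bundles using (CommutativeRing)

record Field (c ℓ : Level) : Set (lsuc (c Level.⊔ ℓ)) where
  field
    commutativeRing : CommutativeRing c ℓ
  open CommutativeRing commutativeRing public
  field
    0≉1     : ¬ (0# ≈ 1#)
    inverse : ∀ x → ¬ (x ≈ 0#) → ∃[ y ] (x * y ≈ 1#)

FaceFamily : ℕ → Set
FaceFamily n = Subset n → Bool

IsSimplicialComplex : ∀ {n} → FaceFamily n → Set
IsSimplicialComplex {n} Δ =
  (∀ (i : Fin n) → Δ ⁅ i ⁆ ≡ true) ×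
  (∀ (F G : Subset n) → G ⊆ F → Δ F ≡ true → Δ G ≡ true)

allSubsets : ∀ n → List (Subset n)
allSubsets zero    = [] ∷ []
allSubsets (suc n) = map (false ∷_) (allSubsets n) ++ map (true ∷_) (allSubsets n)

faces : ∀ {n} → FaceFamily n → ℕ → List (Subset n)
faces {n} Δ s = filterᵇ (λ F → Δ F ∧ (∣ F ∣ ≡ᵇ s)) (allSubsets n)

-- number of faces of cardinality s, i.e. f_{s-1}
fcount : ∀ {n} → FaceFamily n → ℕ → ℕ
fcount Δ s = length (faces Δ s)

-- d = dim Δ + 1 = largest cardinality of a face (0 if there are no faces)
dimPlusOne : ∀ {n} → FaceFamily n → ℕ
dimPlusOne {n} Δ = foldr _⊔_ 0 (map ∣_∣ (filterᵇ Δ (allSubsets n)))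

IsPure : ∀ {n} → FaceFamily n → Set
IsPure {n} Δ = ∀ (F : Subset n) → Δ F ≡ true →
  (∀ (G : Subset n) → F ⊆ G → Δ G ≡ true → G ⊆ F) →
  ∣ F ∣ ≡ dimPlusOne Δ

disjointᵇ : ∀ {n} → Subset n → Subset n → Bool
disjointᵇ [] [] = true
disjointᵇ (a ∷ F) (b ∷ G) = not (a ∧ b) ∧ disjointᵇ F G

link : ∀ {n} → FaceFamily n → Subset n → FaceFamily n
link Δ F G = disjointᵇ G F ∧ Δ (G ∪ F)

_==ᵛ_ : ∀ {n} → Subset n → Subset n → Bool
[] ==ᵛ [] = true
(false ∷ F) ==ᵛ (false ∷ G) = F ==ᵛ G
(true ∷ F) ==ᵛ (true ∷ G) = F ==ᵛ G
(_ ∷ _) ==ᵛ (_ ∷ _) = false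

module LinAlg {c ℓ} (K : Field c ℓ) where
  open Field K using (Carrier; 0#; 1#; _≈_)
    renaming (_+_ to _+ᴷ_; _*_ to _*ᴷ_; -_ to -ᴷ_)

  sumFin : ∀ {k} → (Fin k → Carrier) → Carrier
  sumFin {zero}  f = 0#
  sumFin {suc k} f = f zero +ᴷ sumFin (λ i → f (suc i))

  signed : ℕ → Carrier → Carrier
  signed zero x = x
  signed (suc zero) x = -ᴷ x
  signed (suc (suc m)) x = signed m x

  det : ∀ {k} → (Fin k → Fin k → Carrier) → Carrier
  det {zero}  M = 1#
  det {suc k} M = sumFin (λ j →
    signed (toℕ j) (M zero j *ᴷ det (λ r c' → M (suc r) (punchIn j c'))))

  IsRank : ∀ {m p} → (Fin m → Fin p → Carrier) → ℕ → Set ℓ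
  IsRank {m} {p} M r =
    (Σ (Fin r → Fin m) λ rows → Σ (Fin r → Fin p) λ cols → ¬ (det {r} (λ i j → M (rows i) (cols j)) ≈ 0#)) ×
    (∀ (rows : Fin (suc r) → Fin m) (cols : Fin (suc r) → Fin p) →
       det (λ i j → M (rows i) (cols j)) ≈ 0#)

  -- incidence coefficient [σ : τ] of oriented simplices (vertices in
  -- increasing order): (-1)^j if σ = τ minus its j-th vertex, 0 otherwise
  incidence : ∀ {n} → Subset n → Subset n → Carrier
  incidence [] [] = 0#
  incidence (true  ∷ σ) (true  ∷ τ) = -ᴷ incidence σ τ
  incidence (false ∷ σ) (false ∷ τ) = incidence σ τ
  incidence (false ∷ σ) (true  ∷ τ) = if σ ==ᵛ τ then 1# else 0#
  incidence (true  ∷ σ) (false ∷ τ) = 0#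

  -- boundary map ∂ : C̃ (faces of size s+1) → C̃ (faces of size s)
  -- of the augmented (reduced) chain complex, as a matrix
  boundary : ∀ {n} (Δ : FaceFamily n) (s : ℕ) →
    Fin (fcount Δ s) → Fin (fcount Δ (suc s)) → Carrier
  boundary Δ s i j = incidence (lookup (faces Δ s) i) (lookup (faces Δ (suc s)) j)

  -- rank of the boundary map out of the chains of faces of size s
  -- (for s = 0, i.e. the empty face in degree -1, this map is zero)
  IsRankOut : ∀ {n} → FaceFamily n → ℕ → ℕ → Set ℓ
  IsRankOut Δ zero    r = Level.Lift _ (r ≡ 0)
  IsRankOut Δ (suc s) r = IsRank (boundary Δ s) r

  -- IsBetti Δ s b : b = β_{s-1}(Δ) = dim_K H̃_{s-1}(Δ ; K)
  --   = dim C_{s-1} - rank ∂_{s-1} - rank ∂_s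
  IsBetti : ∀ {n} → FaceFamily n → ℕ → ℕ → Set ℓ
  IsBetti Δ s b = ∃[ r₁ ] ∃[ r₂ ]
    (IsRankOut Δ s r₁ × IsRank (boundary Δ s) r₂ × fcount Δ s ≡ r₁ + r₂ + b)

  -- Cohen–Macaulay over K (d = dim + 1): for all faces F (including ∅),
  -- β_i(lk F) = 0 for i ≠ d - 1 - |F|.  Here i = s - 1 with s : ℕ
  -- (degrees i < -1 have zero reduced homology trivially).
  IsCohenMacaulay : ∀ {n} → FaceFamily n → Set ℓ
  IsCohenMacaulay {n} Δ = ∀ (F : Subset n) → Δ F ≡ true →
    ∀ (s : ℕ) → s + ∣ F ∣ ≢ dimPlusOne Δ → IsBetti (link Δ F) s 0

  IsBuchsbaum : ∀ {n} → FaceFamily n → Set ℓ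
  IsBuchsbaum {n} Δ = IsPure Δ × (∀ (v : Fin n) → IsCohenMacaulay (link Δ ⁅ v ⁆))

signℤ : ℕ → ℤ → ℤ
signℤ zero x = x
signℤ (suc zero) x = -ℤ x
signℤ (suc (suc m)) x = signℤ m x

hvec : ∀ {n} → FaceFamily n → ℕ → ℤ
hvec Δ k = foldr _+ℤ_ (+ 0)
  (map (λ i → signℤ (k ∸ i) (+ (((dimPlusOne Δ ∸ i) C (k ∸ i)) *ℕ fcount Δ i)))
       (upTo (suc k)))

-- Macaulay pseudopower a^⟨d⟩ via the (greedy) d-th Macaulay representation

largestM : ℕ → ℕ → ℕ
largestM a d = foldr (λ m acc → if (m C d) ≤ᵇ a then m ⊔ acc else acc) 0
                     (upTo (suc (a + d)))

-- a = C(m_d, d) + C(m_{d-1}, d-1) + ... ,  a^⟨d⟩ = C(m_d + 1, d + 1) + ...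
_^⟨_⟩ : ℕ → ℕ → ℕ
a ^⟨ zero ⟩ = 0
a ^⟨ suc d ⟩ with a ≡ᵇ 0
... | true  = 0
... | false = let m = largestM a (suc d) in
              (suc m C suc (suc d)) + ((a ∸ (m C suc d)) ^⟨ d ⟩)

{-# OPTIONS --safe #-}
module Submission where

-- A pure 2-dimensional complex is Buchsbaum if and only if the links of its vertices are
-- connected graphs, whatever the field: the boundary matrix of a graph has linearly
-- dependent rows on every union of components, and a spanning tree gives a triangular
-- minor with diagonal ±1.
--
-- Necessity.  Since links are connected, each component grows from a triangle by adding
-- vertices joined to at least two earlier ones.  A vertex with x + 2 earlier neighbours adds
-- x to h₂ and at most min (C(x+1,2), h₂ + x) to h₃: the triangles at it lie over edges
-- among its neighbours, and no vertex set U spans more than 2|U| − 3 + h₂ edges.  Such a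
-- gain is compatible with h₃ ≤ h₂^⟨2⟩.  Every component but one shifts the vector by
-- (3, −3, 1).  Finally 3h₃ + h₂ ≥ 0 is the sum over all links of (edges − vertices + 1) ≥ 0.
--
-- Sufficiency.  All complexes have a hub adjacent to every vertex, so any missing edge can be
-- added together with its triangle at the hub, raising h₂ by 1 and keeping h₃.  For h₃ ≥ 0
-- start from the 2-skeleton of a simplex with one vertex attached along a suitable graph.
-- For h₃ < 0 glue Möbius-like strips of two triangles, each raising h₂ by 3 and lowering
-- h₃ by 1; on N vertices besides the hub there is room for ⌊C(N−1,2)/3⌋ of them, found by
-- adding three vertices at a time.  Disjoint triangles account for k.

open import Defs
open import Algebra.Bundles using (CommutativeRing)
open import Data.Bool using (Bool; true; false; _∧_; _∨_; not; if_then_else_)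
import Data.Bool.Properties as Bool
open import Data.Empty using (⊥; ⊥-elim)
open import Data.Fin using (Fin; zero; suc; punchIn; toℕ)
import Data.Fin.Properties as Fin
open import Data.Fin.Subset using (Subset; ∣_∣; _⊆_; _∪_; ⁅_⁆; _∈_; _∉_; ⊤) renaming (⊥ to ∅)
import Data.Fin.Subset.Properties as Sub
open import Data.Integer using (ℤ; +_; -[1+_]; -_) renaming (_≤_ to _≤ℤ_; _+_ to _+ℤ_; _-_ to _-ℤ_; _*_ to _*ℤ_)
import Data.Integer.Properties as ℤ
import Data.Integer.Tactic.RingSolver as ℤ-Solver
open import Data.List using (List; []; _∷_; _++_; map; filterᵇ; length; foldr; lookup; upTo; take)
open import Data.List.Membership.Propositional using () renaming (_∈_ to _∈ₗ_)
open import Data.List.Membership.Propositional.Properties using (∈-upTo⁺; ∈-lookup; ∈-++⁺ˡ; ∈-++⁺ʳ; ∈-map⁺; ∈-filter⁺; ∈-filter⁻)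
open import Data.List.Properties using (length-map; length-take)
open import Data.List.Relation.Unary.Any using (here; there; index)
open import Data.Nat using (ℕ; zero; suc; _+_; _*_; _∸_; _≤_; _<_; _≤ᵇ_; _≡ᵇ_; _⊔_; z≤n; s≤s; _<ᵇ_; _⊓_; _<?_)
open import Data.Nat.Combinatorics using (_C_; nCk+nC[k+1]≡[n+1]C[k+1]; nC1≡n)
import Data.Nat.Properties as ℕ
open import Data.Nat.Tactic.RingSolver using (solve-∀)
open import Data.Product using (Σ; ∃; ∃₂; ∃-syntax; _×_; _,_; proj₁; proj₂)
open import Data.Sum using (_⊎_; inj₁; inj₂)
open import Data.Vec using (Vec; []; _∷_)
import Data.Vec as Vec
import Data.Vec.Properties as Vec
open import Function using (_∘_; id; case_of_)
open import Function.Bundles using (_⇔_; mk⇔; module Equivalence)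
open import Level using (Level)
open import Relation.Binary.Construct.Closure.ReflexiveTransitive using (Star; ε; _◅_; _◅◅_)
import Relation.Binary.Construct.Closure.ReflexiveTransitive as Star
open import Relation.Binary.PropositionalEquality using (_≡_; _≢_; refl; sym; trans; cong; cong₂; subst; subst₂; module ≡-Reasoning)
open import Relation.Binary.Definitions using (tri<; tri≈; tri>)
open import Relation.Nullary using (¬_; Dec; does; yes; no; contradiction)
open import Relation.Nullary.Decidable using (¬?; _×-dec_; _⊎-dec_; _→-dec_; decidable-stable; from-yes)

private variable
  n k : ℕ
  x y z w : Fin n
  F G : Subset n

-- Macaulay's pseudopower a^⟨2⟩

≤-by : ∀ {a b} k → a + k ≡ b → a ≤ b
≤-by {a} k refl = ℕ.m≤m+n a k

≤-diff : ∀ {a b} → a ≤ b → ∃[ k ] a + k ≡ b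
≤-diff le = ℕ.m≤n⇒∃[o]m+o≡n le

tri : ℕ → ℕ
tri zero    = 0
tri (suc n) = suc n + tri n

tet : ℕ → ℕ
tet zero    = 0
tet (suc n) = tri (suc n) + tet n

[1+n]C2≡tri : ∀ n → suc n C 2 ≡ tri n
[1+n]C2≡tri zero    = refl
[1+n]C2≡tri (suc n) = begin
  suc (suc n) C 2         ≡⟨ nCk+nC[k+1]≡[n+1]C[k+1] (suc n) 1 ⟨
  suc n C 1 + suc n C 2   ≡⟨ cong₂ _+_ (nC1≡n (suc n)) ([1+n]C2≡tri n) ⟩
  suc n + tri n           ∎
  where open ≡-Reasoning

[2+n]C3≡tet : ∀ n → suc (suc n) C 3 ≡ tet n
[2+n]C3≡tet zero    = refl
[2+n]C3≡tet (suc n) = begin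
  suc (suc (suc n)) C 3                 ≡⟨ nCk+nC[k+1]≡[n+1]C[k+1] (suc (suc n)) 2 ⟨
  suc (suc n) C 2 + suc (suc n) C 3     ≡⟨ cong₂ _+_ ([1+n]C2≡tri (suc n)) ([2+n]C3≡tet n) ⟩
  tri (suc n) + tet n                   ∎
  where open ≡-Reasoning

private
  tri-+-arith : ∀ (a b x y : ℕ) → 1 + (a + b + (x + y + a * b)) ≡ 1 + (a + x + y + (b + a * b))
  tri-+-arith = solve-∀

tri-+ : ∀ a b → tri (a + b) ≡ tri a + tri b + a * b
tri-+ zero    b = sym (ℕ.+-identityʳ (tri b))
tri-+ (suc a) b rewrite tri-+ a b = tri-+-arith a b (tri a) (tri b)

tri-mono : ∀ {a b} → a ≤ b → tri a ≤ tri b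
tri-mono {a} a≤b with ≤-diff a≤b
... | k , refl = ≤-by (tri k + a * k) (trans (sym (ℕ.+-assoc (tri a) _ _)) (sym (tri-+ a k)))

C2-cancel-< : ∀ {a b} → a C 2 < b C 2 → a < b
C2-cancel-< {a} {b} lt with ℕ.<-≤-connex a b
... | inj₁ a<b = a<b
... | inj₂ b≤a = contradiction lt (ℕ.≤⇒≯ (mono b≤a))
  where
  mono : ∀ {a b} → a ≤ b → a C 2 ≤ b C 2
  mono {zero}          _         = z≤n
  mono {suc a} {suc b} (s≤s a≤b) rewrite [1+n]C2≡tri a | [1+n]C2≡tri b = tri-mono a≤b

module _ (P : ℕ → Bool) where

  private
    best : ℕ → ℕ → ℕ
    best m acc = if P m then m ⊔ acc else acc

  foldr-max-sound : ∀ ms → foldr best 0 ms ≡ 0 ⊎ P (foldr best 0 ms) ≡ true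
  foldr-max-sound []       = inj₁ refl
  foldr-max-sound (m ∷ ms) with P m in eq
  ... | false = foldr-max-sound ms
  ... | true with ℕ.⊔-sel m (foldr best 0 ms)
  ...   | inj₁ e rewrite e = inj₂ eq
  ...   | inj₂ e rewrite e = foldr-max-sound ms

  foldr-max-upper : ∀ {m} ms → m ∈ₗ ms → P m ≡ true → m ≤ foldr best 0 ms
  foldr-max-upper {m} (_ ∷ ms) (here refl) Pm rewrite Pm = ℕ.m≤m⊔n m _
  foldr-max-upper (k ∷ ms) (there m∈) Pm with P k
  ... | false = foldr-max-upper ms m∈ Pm
  ... | true  = ℕ.≤-trans (foldr-max-upper ms m∈ Pm) (ℕ.m≤n⊔m k _)

≤ᵇ-true : ∀ {a b} → a ≤ b → (a ≤ᵇ b) ≡ true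
≤ᵇ-true le = Equivalence.to Bool.T-≡ (ℕ.≤⇒≤ᵇ le)

true-≤ᵇ : ∀ {a b} → (a ≤ᵇ b) ≡ true → a ≤ b
true-≤ᵇ {a} {b} e = ℕ.≤ᵇ⇒≤ a b (Equivalence.from Bool.T-≡ e)

largestM-unique : ∀ a d m → m C d ≤ a → m < suc (a + d) → (∀ {k} → k C d ≤ a → k ≤ m) →
                  largestM a d ≡ m
largestM-unique a d m le lt maximal = ℕ.≤-antisym upper
  (foldr-max-upper P (upTo (suc (a + d))) (∈-upTo⁺ lt) (≤ᵇ-true le))
  where
  P : ℕ → Bool
  P k = (k C d) ≤ᵇ a
  upper : largestM a d ≤ m
  upper with foldr-max-sound P (upTo (suc (a + d)))
  ... | inj₁ e = subst (_≤ m) (sym e) z≤n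
  ... | inj₂ e = maximal (true-≤ᵇ e)

^⟨1⟩≡tri : ∀ r → r ^⟨ 1 ⟩ ≡ tri r
^⟨1⟩≡tri zero      = refl
^⟨1⟩≡tri r@(suc _) rewrite largestM-unique r 1 r (ℕ.≤-reflexive (nC1≡n r)) (s≤s (ℕ.m≤m+n r 1))
                              (λ {k} le → subst (_≤ r) (nC1≡n k) le)
  = trans (ℕ.+-identityʳ _) ([1+n]C2≡tri r)

^⟨2⟩-block : ∀ m r → r ≤ m → (tri m + r) ^⟨ 2 ⟩ ≡ tet m + tri r
^⟨2⟩-block zero zero _ = refl
^⟨2⟩-block m@(suc m') r r≤m
  rewrite largestM-unique (tri m + r) 2 (suc m)
            (subst (_≤ tri m + r) (sym ([1+n]C2≡tri m)) (ℕ.m≤m+n (tri m) r))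
            (s≤s (subst (suc m ≤_) (ℕ.+-comm 2 _)
              (s≤s (s≤s (ℕ.≤-trans (ℕ.n≤1+n m') (ℕ.≤-trans (ℕ.m≤m+n m (tri m')) (ℕ.m≤m+n (tri m) r)))))))
            (λ {k} le → ℕ.m<1+n⇒m≤n (C2-cancel-< {k} {suc (suc m)}
              (ℕ.≤-<-trans le (subst (tri m + r <_) (sym ([1+n]C2≡tri (suc m)))
                (subst (_< suc m + tri m) (ℕ.+-comm r (tri m)) (ℕ.+-monoˡ-< (tri m) (s≤s r≤m)))))))
  = cong₂ _+_ ([2+n]C3≡tet m) (trans (cong (_^⟨ 1 ⟩) (trans (cong (tri m + r ∸_) ([1+n]C2≡tri m)) (ℕ.m+n∸m≡n (tri m) r))) (^⟨1⟩≡tri r))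

^⟨2⟩-value : ∀ m r → r ≤ suc m → (tri m + r) ^⟨ 2 ⟩ ≡ tet m + tri r
^⟨2⟩-value m r r≤ with ℕ.m≤n⇒m<n∨m≡n r≤
... | inj₁ (s≤s r≤m) = ^⟨2⟩-block m r r≤m
... | inj₂ refl = begin
  (tri m + suc m) ^⟨ 2 ⟩       ≡⟨ cong (_^⟨ 2 ⟩) (trans (ℕ.+-comm (tri m) (suc m)) (sym (ℕ.+-identityʳ _))) ⟩
  (tri (suc m) + 0) ^⟨ 2 ⟩     ≡⟨ ^⟨2⟩-block (suc m) 0 z≤n ⟩
  tet (suc m) + 0              ≡⟨ ℕ.+-identityʳ _ ⟩
  tri (suc m) + tet m          ≡⟨ ℕ.+-comm (tri (suc m)) (tet m) ⟩
  tet m + tri (suc m)          ∎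
  where open ≡-Reasoning

record Block (s : ℕ) : Set where
  constructor block
  field
    m r : ℕ
    r≤m : r ≤ m
    eq  : s ≡ tri m + r

toBlock : ∀ s → Block s
toBlock zero = block 0 0 z≤n refl
toBlock (suc s) with toBlock s
... | block m r r≤m refl with ℕ.m≤n⇒m<n∨m≡n r≤m
...   | inj₁ r<m  = block m (suc r) r<m (sym (ℕ.+-suc (tri m) r))
...   | inj₂ refl = block (suc m) 0 z≤n (trans (cong suc (ℕ.+-comm (tri m) m)) (sym (ℕ.+-identityʳ _)))

private
  ^⟨2⟩-suc-arith : ∀ (a b r : ℕ) → a + b + 1 + r ≡ a + ((1 + r) + b)
  ^⟨2⟩-suc-arith = solve-∀

^⟨2⟩-suc : ∀ s → s ^⟨ 2 ⟩ + 1 ≤ suc s ^⟨ 2 ⟩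
^⟨2⟩-suc s with toBlock s
... | block m r r≤m refl = begin
  (tri m + r) ^⟨ 2 ⟩ + 1        ≡⟨ cong (_+ 1) (^⟨2⟩-block m r r≤m) ⟩
  tet m + tri r + 1             ≤⟨ ≤-by r (^⟨2⟩-suc-arith (tet m) (tri r) r) ⟩
  tet m + tri (suc r)           ≡⟨ ^⟨2⟩-value m (suc r) (s≤s r≤m) ⟨
  (tri m + suc r) ^⟨ 2 ⟩        ≡⟨ cong (_^⟨ 2 ⟩) (ℕ.+-suc (tri m) r) ⟩
  suc (tri m + r) ^⟨ 2 ⟩        ∎
  where
  open ℕ.≤-Reasoning

private
  ^⟨2⟩-+-arith : ∀ (a z : ℕ) → a + (1 + z) ≡ a + z + 1
  ^⟨2⟩-+-arith = solve-∀

^⟨2⟩-+ : ∀ s z → s ^⟨ 2 ⟩ + z ≤ (s + z) ^⟨ 2 ⟩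
^⟨2⟩-+ s zero rewrite ℕ.+-identityʳ s | ℕ.+-identityʳ (s ^⟨ 2 ⟩) = ℕ.≤-refl
^⟨2⟩-+ s (suc z) = begin
  s ^⟨ 2 ⟩ + suc z        ≡⟨ ^⟨2⟩-+-arith (s ^⟨ 2 ⟩) z ⟩
  s ^⟨ 2 ⟩ + z + 1        ≤⟨ ℕ.+-monoˡ-≤ 1 (^⟨2⟩-+ s z) ⟩
  (s + z) ^⟨ 2 ⟩ + 1      ≤⟨ ^⟨2⟩-suc (s + z) ⟩
  suc (s + z) ^⟨ 2 ⟩      ≡⟨ cong (_^⟨ 2 ⟩) (ℕ.+-suc s z) ⟨
  (s + suc z) ^⟨ 2 ⟩      ∎
  where
  open ℕ.≤-Reasoning

private
  gain-arith₁ : ∀ (a b c d : ℕ) → a + b + c + d ≡ a + (b + c + d)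
  gain-arith₁ = solve-∀
  gain-arith₂ : ∀ (a b c d e : ℕ) → a + (b + c + d) + e ≡ (e + c + d) + a + b
  gain-arith₂ = solve-∀
  gain-arith₃ : ∀ (a b c : ℕ) → a + b + c ≡ b + (a + c)
  gain-arith₃ = solve-∀
  gain-arith₄ : ∀ (x d r' : ℕ) → x + d + r' ≡ r' + d + x
  gain-arith₄ = solve-∀
  gain-arith₅ : ∀ (a b c r m z : ℕ) → a + b + (c + r + (1 + (1 + m + z))) ≡ ((1 + m) + c) + a + ((1 + r) + b) + z
  gain-arith₅ = solve-∀
  gain-arith₆ : ∀ (m t r z : ℕ) → (1 + m) + t + (1 + r) + z ≡ t + r + (1 + (1 + m + z))
  gain-arith₆ = solve-∀

-- The increments of s ↦ s^⟨2⟩ are 1; 1, 2; 1, 2, 3; …, and s = tri m + r sits at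
-- position r of the block 1, …, m + 1.  The three cases: the next x increments
-- stay in this block, reach the next one, or cover more than a block length.
^⟨2⟩-gain : ∀ s x y → y ≤ tri x → y ≤ s + x → s ^⟨ 2 ⟩ + y ≤ (s + x) ^⟨ 2 ⟩
^⟨2⟩-gain s x y y≤tri y≤s+x with toBlock s
... | block m r r≤m refl with ℕ.≤-<-connex (r + x) (suc m) | ℕ.≤-<-connex x (suc m)
...   | inj₁ inside | _ = begin
  (tri m + r) ^⟨ 2 ⟩ + y             ≡⟨ cong (_+ y) (^⟨2⟩-block m r r≤m) ⟩
  tet m + tri r + y                  ≤⟨ ℕ.+-monoʳ-≤ (tet m + tri r) y≤tri ⟩
  tet m + tri r + tri x              ≤⟨ ≤-by (r * x) (gain-arith₁ (tet m) (tri r) (tri x) (r * x)) ⟩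
  tet m + (tri r + tri x + r * x)    ≡⟨ cong (_+_ (tet m)) (tri-+ r x) ⟨
  tet m + tri (r + x)                ≡⟨ ^⟨2⟩-value m (r + x) inside ⟨
  (tri m + (r + x)) ^⟨ 2 ⟩           ≡⟨ cong (_^⟨ 2 ⟩) (ℕ.+-assoc (tri m) r x) ⟨
  (tri m + r + x) ^⟨ 2 ⟩             ∎
  where
  open ℕ.≤-Reasoning
...   | inj₂ beyond | inj₁ x≤ with ≤-diff x≤ | ≤-diff (ℕ.<⇒≤ beyond)
...     | d , x+d | r' , m+r' = begin
  (tri m + r) ^⟨ 2 ⟩ + y                     ≡⟨ cong (_+ y) (^⟨2⟩-block m r r≤m) ⟩
  tet m + tri r + y                          ≤⟨ ℕ.+-monoʳ-≤ (tet m + tri r) y≤tri ⟩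
  tet m + tri r + tri x                      ≡⟨ cong (λ ρ → tet m + tri ρ + tri x) r≡ ⟩
  tet m + tri (r' + d) + tri x               ≡⟨ cong (λ t → tet m + t + tri x) (tri-+ r' d) ⟩
  tet m + (tri r' + tri d + r' * d) + tri x  ≤⟨ ℕ.+-monoˡ-≤ (tri x) (ℕ.+-monoʳ-≤ (tet m) (ℕ.+-monoʳ-≤ (tri r' + tri d) (ℕ.*-monoˡ-≤ d r'≤x))) ⟩
  tet m + (tri r' + tri d + x * d) + tri x   ≡⟨ gain-arith₂ (tet m) (tri r') (tri d) (x * d) (tri x) ⟩
  (tri x + tri d + x * d) + tet m + tri r'   ≡⟨ cong (λ t → t + tet m + tri r') (trans (sym (tri-+ x d)) (cong tri x+d)) ⟩
  tet (suc m) + tri r'                       ≡⟨ ^⟨2⟩-value (suc m) r' (ℕ.≤-trans r'≤x (ℕ.≤-trans x≤ (ℕ.n≤1+n _))) ⟨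
  (tri (suc m) + r') ^⟨ 2 ⟩                  ≡⟨ cong (_^⟨ 2 ⟩) (trans (gain-arith₃ (suc m) (tri m) r') (trans (cong (_+_ (tri m)) m+r') (sym (ℕ.+-assoc (tri m) r x)))) ⟩
  (tri m + r + x) ^⟨ 2 ⟩                     ∎
  where
  open ℕ.≤-Reasoning
  r≡ : r ≡ r' + d
  r≡ = ℕ.+-cancelʳ-≡ x r (r' + d) (trans (sym m+r') (trans (cong (_+ r') (sym x+d)) (gain-arith₄ x d r')))
  r'≤x : r' ≤ x
  r'≤x = ℕ.+-cancelʳ-≤ d r' x (subst₂ _≤_ r≡ (sym x+d) (ℕ.≤-trans r≤m (ℕ.n≤1+n m)))
^⟨2⟩-gain s x y y≤tri y≤s+x | block m r r≤m refl | inj₂ beyond | inj₂ x> with ≤-diff x>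
... | z , refl = begin
  (tri m + r) ^⟨ 2 ⟩ + y                                 ≡⟨ cong (_+ y) (^⟨2⟩-block m r r≤m) ⟩
  tet m + tri r + y                                      ≤⟨ ℕ.+-monoʳ-≤ (tet m + tri r) y≤s+x ⟩
  tet m + tri r + (tri m + r + suc (suc m + z))          ≡⟨ gain-arith₅ (tet m) (tri r) (tri m) r m z ⟩
  (suc m + tri m) + tet m + (suc r + tri r) + z          ≡⟨ cong (_+ z) (^⟨2⟩-value (suc m) (suc r) (s≤s (ℕ.≤-trans r≤m (ℕ.n≤1+n m)))) ⟨
  (tri (suc m) + suc r) ^⟨ 2 ⟩ + z                       ≤⟨ ^⟨2⟩-+ (tri (suc m) + suc r) z ⟩
  (tri (suc m) + suc r + z) ^⟨ 2 ⟩                       ≡⟨ cong (_^⟨ 2 ⟩) (gain-arith₆ m (tri m) r z) ⟩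
  (tri m + r + suc (suc m + z)) ^⟨ 2 ⟩                   ∎
  where
  open ℕ.≤-Reasoning

-- Counting faces

true∨ : ∀ {a b} → (a ∨ b) ≡ true → a ≡ true ⊎ b ≡ true
true∨ {true}  _ = inj₁ refl
true∨ {false} e = inj₂ e

true∧ : ∀ {a b} → (a ∧ b) ≡ true → a ≡ true × b ≡ true
true∧ {true} e = refl , e

∧true : ∀ {a b} → a ≡ true → b ≡ true → (a ∧ b) ≡ true
∧true refl refl = refl

true-or-false : ∀ b → b ≡ true ⊎ b ≡ false
true-or-false true  = inj₁ refl
true-or-false false = inj₂ refl

true≢false : ∀ {b} → b ≡ true → b ≡ false → ∀ {ℓ} {A : Set ℓ} → A
true≢false refl ()

cnt : FaceFamily n → ℕ → ℕ
cnt {zero}  Δ zero    = if Δ [] then 1 else 0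
cnt {zero}  Δ (suc s) = 0
cnt {suc n} Δ zero    = cnt (Δ ∘ (false ∷_)) zero
cnt {suc n} Δ (suc s) = cnt (Δ ∘ (false ∷_)) (suc s) + cnt (Δ ∘ (true ∷_)) s

module _ {A : Set} where

  length-filterᵇ-++ : (p : A → Bool) (xs ys : List A) →
    length (filterᵇ p (xs ++ ys)) ≡ length (filterᵇ p xs) + length (filterᵇ p ys)
  length-filterᵇ-++ p []       ys = refl
  length-filterᵇ-++ p (x ∷ xs) ys with p x
  ... | true  = cong suc (length-filterᵇ-++ p xs ys)
  ... | false = length-filterᵇ-++ p xs ys

  length-filterᵇ-map : {B : Set} (p : A → Bool) (q : B → Bool) (f : B → A) → (∀ x → p (f x) ≡ q x) →
    (xs : List B) → length (filterᵇ p (map f xs)) ≡ length (filterᵇ q xs)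
  length-filterᵇ-map p q f p≗q []       = refl
  length-filterᵇ-map p q f p≗q (x ∷ xs) rewrite p≗q x with q x
  ... | true  = cong suc (length-filterᵇ-map p q f p≗q xs)
  ... | false = length-filterᵇ-map p q f p≗q xs

  length-filterᵇ-none : (p : A → Bool) → (∀ x → p x ≡ false) → (xs : List A) → length (filterᵇ p xs) ≡ 0
  length-filterᵇ-none p none []       = refl
  length-filterᵇ-none p none (x ∷ xs) rewrite none x = length-filterᵇ-none p none xs

fcount≡cnt : (Δ : FaceFamily n) (s : ℕ) → fcount Δ s ≡ cnt Δ s
fcount≡cnt {zero} Δ zero with Δ []
... | true  = refl
... | false = refl
fcount≡cnt {zero} Δ (suc s) with Δ []
... | true  = refl
... | false = refl
fcount≡cnt {suc n} Δ s =
  trans (length-filterᵇ-++ p (map (false ∷_) (allSubsets n)) (map (true ∷_) (allSubsets n))) (halves s)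
  where
  p : Subset (suc n) → Bool
  p F = Δ F ∧ (∣ F ∣ ≡ᵇ s)
  halves : ∀ s → length (filterᵇ (λ F → Δ F ∧ (∣ F ∣ ≡ᵇ s)) (map (false ∷_) (allSubsets n)))
               + length (filterᵇ (λ F → Δ F ∧ (∣ F ∣ ≡ᵇ s)) (map (true ∷_) (allSubsets n))) ≡ cnt Δ s
  halves zero = trans (cong₂ _+_
    (trans (length-filterᵇ-map _ (λ F → Δ (false ∷ F) ∧ (∣ F ∣ ≡ᵇ 0)) (false ∷_) (λ _ → refl) (allSubsets n))
           (fcount≡cnt (Δ ∘ (false ∷_)) zero))
    (trans (length-filterᵇ-map _ (λ _ → false) (true ∷_) (λ F → Bool.∧-zeroʳ (Δ (true ∷ F))) (allSubsets n))
           (length-filterᵇ-none (λ _ → false) (λ _ → refl) (allSubsets n))))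
    (ℕ.+-identityʳ _)
  halves (suc s) = cong₂ _+_
    (trans (length-filterᵇ-map _ (λ F → Δ (false ∷ F) ∧ (∣ F ∣ ≡ᵇ suc s)) (false ∷_) (λ _ → refl) (allSubsets n))
           (fcount≡cnt (Δ ∘ (false ∷_)) (suc s)))
    (trans (length-filterᵇ-map _ (λ F → Δ (true ∷ F) ∧ (∣ F ∣ ≡ᵇ s)) (true ∷_) (λ _ → refl) (allSubsets n))
           (fcount≡cnt (Δ ∘ (true ∷_)) s))

cnt-mono : {Γ Δ : FaceFamily n} (s : ℕ) → (∀ F → ∣ F ∣ ≡ s → Γ F ≡ true → Δ F ≡ true) → cnt Γ s ≤ cnt Δ s
cnt-mono {zero} {Γ} {Δ} zero Γ≤Δ with Γ [] in eq
... | false = z≤n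
... | true rewrite Γ≤Δ [] refl eq = ℕ.≤-refl
cnt-mono {zero}  (suc s) Γ≤Δ = z≤n
cnt-mono {suc n} zero    Γ≤Δ = cnt-mono zero (λ F → Γ≤Δ (false ∷ F))
cnt-mono {suc n} (suc s) Γ≤Δ = ℕ.+-mono-≤ (cnt-mono (suc s) (λ F → Γ≤Δ (false ∷ F)))
                                          (cnt-mono s (λ F e → Γ≤Δ (true ∷ F) (cong suc e)))

cnt-cong-at : {Γ Δ : FaceFamily n} (s : ℕ) → (∀ F → ∣ F ∣ ≡ s → Γ F ≡ Δ F) → cnt Γ s ≡ cnt Δ s
cnt-cong-at s Γ≗Δ = ℕ.≤-antisym (cnt-mono s (λ F e → trans (sym (Γ≗Δ F e)))) (cnt-mono s (λ F e → trans (Γ≗Δ F e)))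

cnt-cong : {Γ Δ : FaceFamily n} (s : ℕ) → (∀ F → Γ F ≡ Δ F) → cnt Γ s ≡ cnt Δ s
cnt-cong s Γ≗Δ = cnt-cong-at s (λ F _ → Γ≗Δ F)

cnt-false : ∀ n s → cnt {n} (λ _ → false) s ≡ 0
cnt-false zero    zero    = refl
cnt-false zero    (suc s) = refl
cnt-false (suc n) zero    = cnt-false n zero
cnt-false (suc n) (suc s) = cong₂ _+_ (cnt-false n (suc s)) (cnt-false n s)

cnt-none : {Γ : FaceFamily n} (s : ℕ) → (∀ F → ∣ F ∣ ≡ s → Γ F ≡ false) → cnt Γ s ≡ 0
cnt-none {n} s none = trans (cnt-cong-at s none) (cnt-false n s)

+-cancel-<-⊎ : ∀ a b {c d} → a + b < c + d → a < c ⊎ b < d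
+-cancel-<-⊎ a b {c} {d} lt with a <? c | b <? d
... | yes a<c | _       = inj₁ a<c
... | no  _   | yes b<d = inj₂ b<d
... | no  a≮c | no  b≮d = contradiction lt (ℕ.≤⇒≯ (ℕ.+-mono-≤ (ℕ.≮⇒≥ a≮c) (ℕ.≮⇒≥ b≮d)))

cnt-<-witness : {Γ Δ : FaceFamily n} (s : ℕ) → cnt Γ s < cnt Δ s →
                ∃[ F ] (∣ F ∣ ≡ s × Δ F ≡ true × Γ F ≡ false)
cnt-<-witness {zero} {Γ} {Δ} zero lt with Γ [] in eqΓ | Δ [] in eqΔ
... | false | true = [] , refl , eqΔ , eqΓ
cnt-<-witness {zero} {Γ} {Δ} zero (s≤s ()) | true  | true
cnt-<-witness {suc n} zero lt with cnt-<-witness {n} zero lt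
... | F , e , p , q = false ∷ F , e , p , q
cnt-<-witness {suc n} {Γ} {Δ} (suc s) lt with +-cancel-<-⊎ (cnt (Γ ∘ (false ∷_)) (suc s)) (cnt (Γ ∘ (true ∷_)) s) lt
... | inj₁ lt' with cnt-<-witness {n} (suc s) lt'
...   | F , e , p , q = false ∷ F , e , p , q
cnt-<-witness {suc n} {Γ} {Δ} (suc s) lt | inj₂ lt' with cnt-<-witness {n} s lt'
...   | F , e , p , q = true ∷ F , cong suc e , p , q

==ᵛ-sound : {F G : Subset n} → (F ==ᵛ G) ≡ true → F ≡ G
==ᵛ-sound {F = []}        {[]}        e = refl
==ᵛ-sound {F = false ∷ F} {false ∷ G} e = cong (false ∷_) (==ᵛ-sound e)
==ᵛ-sound {F = true ∷ F}  {true ∷ G}  e = cong (true ∷_) (==ᵛ-sound e)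

==ᵛ-refl : (F : Subset n) → (F ==ᵛ F) ≡ true
==ᵛ-refl []          = refl
==ᵛ-refl (false ∷ F) = ==ᵛ-refl F
==ᵛ-refl (true ∷ F)  = ==ᵛ-refl F

add : FaceFamily n → Subset n → FaceFamily n
add Δ F G = Δ G ∨ (G ==ᵛ F)

add-old : (Δ : FaceFamily n) (F G : Subset n) → Δ G ≡ true → add Δ F G ≡ true
add-old Δ F G e rewrite e = refl

add-new : (Δ : FaceFamily n) (F : Subset n) → add Δ F F ≡ true
add-new Δ F rewrite ==ᵛ-refl F = Bool.∨-zeroʳ (Δ F)

add-inv : (Δ : FaceFamily n) (F G : Subset n) → add Δ F G ≡ true → Δ G ≡ true ⊎ G ≡ F
add-inv Δ F G e with true∨ {Δ G} e
... | inj₁ old = inj₁ old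
... | inj₂ new = inj₂ (==ᵛ-sound new)

cnt-add : (Δ : FaceFamily n) (F : Subset n) → Δ F ≡ false → cnt (add Δ F) ∣ F ∣ ≡ suc (cnt Δ ∣ F ∣)
cnt-add Δ [] e rewrite e = refl
cnt-add Δ (false ∷ F) e with ∣ F ∣ in eq
... | zero  = trans (subst (λ s → cnt (add Δ' F) s ≡ suc (cnt Δ' s)) eq (cnt-add Δ' F e)) refl
  where Δ' = Δ ∘ (false ∷_)
... | suc s = cong₂ _+_ (subst (λ s → cnt (add Δ' F) s ≡ suc (cnt Δ' s)) eq (cnt-add Δ' F e))
                        (cnt-cong {Γ = λ G → Δ (true ∷ G) ∨ false} {Δ ∘ (true ∷_)} s (λ G → Bool.∨-identityʳ _))
  where Δ' = Δ ∘ (false ∷_)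
cnt-add {suc n} Δ (true ∷ F) e = trans
  (cong₂ _+_ (cnt-cong {n} {λ G → Δ (false ∷ G) ∨ false} {Δ ∘ (false ∷_)} (suc ∣ F ∣) (λ G → Bool.∨-identityʳ _)) (cnt-add (Δ ∘ (true ∷_)) F e))
  (ℕ.+-suc _ _)

truncate : (Φ : FaceFamily n) (s j : ℕ) → j ≤ cnt Φ s →
           ∃[ Ψ ] ((∀ F → Ψ F ≡ true → Φ F ≡ true × ∣ F ∣ ≡ s) × cnt Ψ s ≡ j)
truncate {n} Φ s zero    _  = (λ _ → false) , (λ _ ()) , cnt-false n s
truncate Φ s (suc j) le with truncate Φ s j (ℕ.≤-trans (ℕ.n≤1+n j) le)
... | Ψ , Ψ≤Φ , refl with cnt-<-witness {Γ = Ψ} {Φ} s le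
... | F , refl , ΦF , ¬ΨF = add Ψ F
  , (λ G e → case add-inv Ψ F G e of λ { (inj₁ p) → Ψ≤Φ G p ; (inj₂ refl) → ΦF , refl })
  , cnt-add Ψ F ¬ΨF

disjoint-∅ʳ : (F : Subset n) → disjointᵇ F ∅ ≡ true
disjoint-∅ʳ []          = refl
disjoint-∅ʳ (true ∷ F)  = disjoint-∅ʳ F
disjoint-∅ʳ (false ∷ F) = disjoint-∅ʳ F

link-zero : (Δ : FaceFamily (suc n)) (G : Subset n) → link Δ ⁅ zero ⁆ (false ∷ G) ≡ Δ (true ∷ G)
link-zero {n} Δ G rewrite disjoint-∅ʳ G | Sub.∪-identityʳ G = refl

cnt-link-zero : (Δ : FaceFamily (suc n)) (s : ℕ) → cnt (link Δ ⁅ zero ⁆) s ≡ cnt (Δ ∘ (true ∷_)) s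
cnt-link-zero Δ zero    = cnt-cong zero (link-zero Δ)
cnt-link-zero {n} Δ (suc s) = trans
  (cong₂ _+_ (cnt-cong (suc s) (link-zero Δ)) (cnt-false n s))
  (ℕ.+-identityʳ _)

∑ : (Fin n → ℕ) → ℕ
∑ {zero}  f = 0
∑ {suc n} f = f zero + ∑ (f ∘ suc)

∑-+ : (f g : Fin n → ℕ) → ∑ (λ i → f i + g i) ≡ ∑ f + ∑ g
∑-+ {zero}  f g = refl
∑-+ {suc n} f g rewrite ∑-+ (f ∘ suc) (g ∘ suc) = interchange (f zero) (g zero) _ _
  where open import Algebra.Properties.CommutativeSemigroup ℕ.+-commutativeSemigroup using (interchange)

∑-mono : {f g : Fin n → ℕ} → (∀ i → f i ≤ g i) → ∑ f ≤ ∑ g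
∑-mono {zero}  le = z≤n
∑-mono {suc n} le = ℕ.+-mono-≤ (le zero) (∑-mono (le ∘ suc))

∑-one : ∀ n → ∑ {n} (λ _ → 1) ≡ n
∑-one zero    = refl
∑-one (suc n) = cong suc (∑-one n)

∑-cnt-link : (Δ : FaceFamily n) (s : ℕ) → ∑ (λ v → cnt (link Δ ⁅ v ⁆) s) ≡ suc s * cnt Δ (suc s)
∑-cnt-link {zero}  Δ s = sym (ℕ.*-zeroʳ (suc s))
∑-cnt-link {suc n} Δ zero = trans
  (cong₂ _+_ (cnt-link-zero Δ 0) (∑-cnt-link (Δ ∘ (false ∷_)) 0)) 
  (arith (cnt (Δ ∘ (true ∷_)) 0) (cnt (Δ ∘ (false ∷_)) 1))
  where
  arith : ∀ (a b : ℕ) → a + (b + 0) ≡ (b + a) + 0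
  arith = solve-∀
∑-cnt-link {suc n} Δ (suc s) = trans
  (cong₂ _+_ (cnt-link-zero Δ (suc s)) (trans
    (∑-+ (λ v → cnt (link (Δ ∘ (false ∷_)) ⁅ v ⁆) (suc s)) (λ v → cnt (link (Δ ∘ (true ∷_)) ⁅ v ⁆) s))
    (cong₂ _+_ (∑-cnt-link (Δ ∘ (false ∷_)) (suc s)) (∑-cnt-link (Δ ∘ (true ∷_)) s))))
  (arith s (cnt (Δ ∘ (true ∷_)) (suc s)) (cnt (Δ ∘ (false ∷_)) (suc (suc s))))
  where
  arith : ∀ (s a b : ℕ) → a + ((1 + (1 + s)) * b + (1 + s) * a) ≡ (1 + (1 + s)) * (b + a)
  arith = solve-∀

_⊆ᵇ_ : Subset n → Subset n → Bool
[]      ⊆ᵇ []      = true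
(a ∷ F) ⊆ᵇ (b ∷ A) = (not a ∨ b) ∧ (F ⊆ᵇ A)

⊆ᵇ-sound : {F A : Subset n} → (F ⊆ᵇ A) ≡ true → F ⊆ A
⊆ᵇ-sound {F = true ∷ F} {true ∷ A}  e Vec.here      = Vec.here
⊆ᵇ-sound {F = a ∷ F}    {b ∷ A}     e (Vec.there i) = Vec.there (⊆ᵇ-sound (proj₂ (true∧ {not a ∨ b} e)) i)

⊆ᵇ-complete : {F A : Subset n} → F ⊆ A → (F ⊆ᵇ A) ≡ true
⊆ᵇ-complete {F = []}        {[]}        le = refl
⊆ᵇ-complete {F = false ∷ F} {b ∷ A}     le = ⊆ᵇ-complete (Sub.drop-∷-⊆ le)
⊆ᵇ-complete {F = true ∷ F}  {true ∷ A}  le = ⊆ᵇ-complete (Sub.drop-∷-⊆ le)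
⊆ᵇ-complete {F = true ∷ F}  {false ∷ A} le = case le Vec.here of λ ()

_↾_ : FaceFamily n → Subset n → FaceFamily n
(Δ ↾ A) F = (F ⊆ᵇ A) ∧ Δ F

infixl 5 _↾_

cnt-↾-∪ : (Δ : FaceFamily n) (A : Subset n) {w : Fin n} → w ∉ A → (s : ℕ) →
  cnt (Δ ↾ A ∪ ⁅ w ⁆) (suc s) ≡ cnt (Δ ↾ A) (suc s) + cnt (link Δ ⁅ w ⁆ ↾ A) s
cnt-↾-∪ Δ (true ∷ A)  {zero} w∉A s = contradiction Vec.here w∉A
cnt-↾-∪ {suc n} Δ (false ∷ A) {zero} w∉A s rewrite Sub.∪-identityʳ A = trans
  (cong₂ _+_ (sym (trans (cong (_+_ _) (cnt-false n s)) (ℕ.+-identityʳ _))) (sym (half s)))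
  refl
  where
  half : ∀ s → cnt (link Δ ⁅ zero ⁆ ↾ (false ∷ A)) s ≡ cnt ((Δ ∘ (true ∷_)) ↾ A) s
  half zero    = cnt-cong 0 (λ G → cong ((G ⊆ᵇ A) ∧_) (link-zero Δ G))
  half (suc s) = trans (cong₂ _+_ (cnt-cong (suc s) (λ G → cong ((G ⊆ᵇ A) ∧_) (link-zero Δ G)))
                                  (cnt-false n s))
                       (ℕ.+-identityʳ _)
cnt-↾-∪ Δ (a ∷ A) {suc w} w∉A zero rewrite Bool.∨-identityʳ a = trans
  (cong₂ _+_ (cnt-↾-∪ (Δ ∘ (false ∷_)) A (w∉A ∘ Vec.there) 0) (size0 a))
  (arith (cnt (Δ ∘ (false ∷_) ↾ A) 1) _ _)
  where
  arith : ∀ (x y z : ℕ) → (x + y) + z ≡ (x + z) + y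
  arith = solve-∀
  ∅⊆ᵇ : ∀ {n} (B : Subset n) (F : Subset n) → ∣ F ∣ ≡ 0 → (F ⊆ᵇ B) ≡ true
  ∅⊆ᵇ [] [] _ = refl
  ∅⊆ᵇ (b ∷ B) (false ∷ F) e = ∅⊆ᵇ B F e
  size0 : ∀ a → cnt (λ F → (a ∧ (F ⊆ᵇ (A ∪ ⁅ w ⁆))) ∧ Δ (true ∷ F)) 0 ≡ cnt (λ F → (a ∧ (F ⊆ᵇ A)) ∧ Δ (true ∷ F)) 0
  size0 false = refl
  size0 true  = cnt-cong-at 0 (λ F e → cong (_∧ Δ (true ∷ F)) (trans (∅⊆ᵇ (A ∪ ⁅ w ⁆) F e) (sym (∅⊆ᵇ A F e))))
cnt-↾-∪ {suc n} Δ (a ∷ A) {suc w} w∉A (suc s) rewrite Bool.∨-identityʳ a = trans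
  (cong₂ _+_ (cnt-↾-∪ (Δ ∘ (false ∷_)) A (w∉A ∘ Vec.there) (suc s)) (head a))
  (arith (cnt (Δ ∘ (false ∷_) ↾ A) (suc (suc s))) _ _ _)
  where
  arith : ∀ (x y z u : ℕ) → (x + y) + (z + u) ≡ (x + z) + (y + u)
  arith = solve-∀
  head : ∀ a → cnt (λ F → (a ∧ (F ⊆ᵇ (A ∪ ⁅ w ⁆))) ∧ Δ (true ∷ F)) (suc s)
             ≡ cnt (λ F → (a ∧ (F ⊆ᵇ A)) ∧ Δ (true ∷ F)) (suc s) + cnt (λ F → (a ∧ (F ⊆ᵇ A)) ∧ link (Δ ∘ (true ∷_)) ⁅ w ⁆ F) s
  head false = trans (cnt-false n (suc s))
                     (sym (cong₂ _+_ (cnt-false n (suc s)) (cnt-false n s)))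
  head true = cnt-↾-∪ (Δ ∘ (true ∷_)) A (w∉A ∘ Vec.there) s

cnt-⊆ᵇ : (U : Subset n) (s : ℕ) → cnt (_⊆ᵇ U) s ≡ ∣ U ∣ C s
cnt-⊆ᵇ []          zero    = refl
cnt-⊆ᵇ []          (suc s) = refl
cnt-⊆ᵇ (true ∷ U)  zero    = cnt-⊆ᵇ U zero
cnt-⊆ᵇ (false ∷ U) zero    = cnt-⊆ᵇ U zero
cnt-⊆ᵇ {suc n} (false ∷ U) (suc s) = trans (cong₂ _+_ (cnt-⊆ᵇ U (suc s)) (cnt-false n s)) (ℕ.+-identityʳ _)
cnt-⊆ᵇ (true ∷ U)  (suc s) = trans (cong₂ _+_ (cnt-⊆ᵇ U (suc s)) (cnt-⊆ᵇ U s))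
  (trans (ℕ.+-comm (∣ U ∣ C suc s) _) (nCk+nC[k+1]≡[n+1]C[k+1] ∣ U ∣ s))

cnt-all : ∀ n s → cnt {n} (λ _ → true) s ≡ n C s
cnt-all n s = trans (cnt-cong {n} s (λ F → sym (⊆ᵇ-complete {F = F} {⊤} Sub.⊆⊤)))
                    (trans (cnt-⊆ᵇ {n} ⊤ s) (cong (_C s) (Sub.∣⊤∣≡n n)))

-- Determinants

module Determinant {c ℓ} (K : Field c ℓ) where

  open LinAlg K public
  open Field K public using (Carrier; 0#; 1#; _≈_; setoid; 0≉1) renaming (_+_ to _+ᴷ_; _*_ to _*ᴷ_; -_ to -ᴷ_)
  private module R = CommutativeRing (Field.commutativeRing K)
  private module RP where
    open import Algebra.Properties.Ring R.ring public
    open import Algebra.Properties.CommutativeSemigroup R.+-commutativeSemigroup public using (interchange)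
    open import Algebra.Properties.CommutativeSemigroup R.*-commutativeSemigroup public using () renaming (x∙yz≈y∙xz to *-left-comm)
  open import Relation.Binary.Reasoning.Setoid setoid

  sumFin-cong : ∀ {k} {f g : Fin k → Carrier} → (∀ i → f i ≈ g i) → sumFin f ≈ sumFin g
  sumFin-cong {zero}  eq = R.refl
  sumFin-cong {suc k} eq = R.+-cong (eq zero) (sumFin-cong (eq ∘ suc))

  sumFin-zero : ∀ {k} {f : Fin k → Carrier} → (∀ i → f i ≈ 0#) → sumFin f ≈ 0#
  sumFin-zero {zero}  eq = R.refl
  sumFin-zero {suc k} eq = R.trans (R.+-cong (eq zero) (sumFin-zero (eq ∘ suc))) (R.+-identityˡ 0#)

  sumFin-+ : ∀ {k} (f g : Fin k → Carrier) → sumFin (λ i → f i +ᴷ g i) ≈ sumFin f +ᴷ sumFin g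
  sumFin-+ {zero}  f g = R.sym (R.+-identityˡ 0#)
  sumFin-+ {suc k} f g = R.trans (R.+-congˡ (sumFin-+ (f ∘ suc) (g ∘ suc))) (RP.interchange _ _ _ _)

  sumFin-*ˡ : ∀ {k} a (f : Fin k → Carrier) → a *ᴷ sumFin f ≈ sumFin (λ i → a *ᴷ f i)
  sumFin-*ˡ {zero}  a f = R.zeroʳ a
  sumFin-*ˡ {suc k} a f = R.trans (R.distribˡ a _ _) (R.+-congˡ (sumFin-*ˡ a (f ∘ suc)))

  sumFin-neg : ∀ {k} (f : Fin k → Carrier) → sumFin (λ i → -ᴷ f i) ≈ -ᴷ sumFin f
  sumFin-neg {zero}  f = R.sym RP.-0#≈0#
  sumFin-neg {suc k} f = R.trans (R.+-congˡ (sumFin-neg (f ∘ suc))) (RP.-‿+-comm _ _)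

  sumFin-swap : ∀ {k m} (f : Fin k → Fin m → Carrier) →
                sumFin (λ i → sumFin (f i)) ≈ sumFin (λ j → sumFin (λ i → f i j))
  sumFin-swap {zero} {m} f = R.sym (sumFin-zero {m} (λ _ → R.refl))
  sumFin-swap {suc k} f = R.trans (R.+-congˡ (sumFin-swap (f ∘ suc)))
    (R.sym (sumFin-+ (f zero) (λ j → sumFin (λ i → f (suc i) j))))

  sumFin-single : ∀ {k} (f : Fin k → Carrier) (p : Fin k) → (∀ i → i ≢ p → f i ≈ 0#) → sumFin f ≈ f p
  sumFin-single f zero    others = R.trans (R.+-congˡ (sumFin-zero (λ i → others (suc i) λ ()))) (R.+-identityʳ _)
  sumFin-single f (suc p) others = R.trans
    (R.+-cong (others zero λ ()) (sumFin-single (f ∘ suc) p (λ i i≢p → others (suc i) (i≢p ∘ Fin.suc-injective))))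
    (R.+-identityˡ _)

  sgn : ∀ {k} → Fin k → Carrier
  sgn j = signed (toℕ j) 1#

  signed-suc : ∀ k x → signed (suc k) x ≈ -ᴷ signed k x
  signed-suc zero          x = R.refl
  signed-suc (suc zero)    x = R.sym (RP.-‿involutive x)
  signed-suc (suc (suc k)) x = signed-suc k x

  signed≈* : ∀ k x → signed k x ≈ signed k 1# *ᴷ x
  signed≈* zero          x = R.sym (R.*-identityˡ x)
  signed≈* (suc zero)    x = R.trans (R.-‿cong (R.sym (R.*-identityˡ x))) (RP.-‿distribˡ-* 1# x)
  signed≈* (suc (suc k)) x = signed≈* k x

  Matrix : ℕ → Set c
  Matrix k = Fin k → Fin k → Carrier

  minor : ∀ {k} → Matrix (suc k) → Fin (suc k) → Matrix k
  minor M j i l = M (suc i) (punchIn j l)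

  term : ∀ {k} → Matrix (suc k) → Fin (suc k) → Carrier
  term M j = sgn j *ᴷ (M zero j *ᴷ det (minor M j))

  det-expand : ∀ {k} (M : Matrix (suc k)) → det M ≈ sumFin (term M)
  det-expand M = sumFin-cong (λ j → signed≈* (toℕ j) (M zero j *ᴷ det (minor M j)))

  det-cong : ∀ {k} {M N : Matrix k} → (∀ i j → M i j ≈ N i j) → det M ≈ det N
  det-cong {zero}  eq = R.refl
  det-cong {suc k} {M} {N} eq = begin
    det M             ≈⟨ det-expand M ⟩
    sumFin (term M)   ≈⟨ sumFin-cong (λ j → R.*-congˡ {sgn j} (R.*-cong (eq zero j) (det-cong (λ i l → eq (suc i) (punchIn j l))))) ⟩
    sumFin (term N)   ≈⟨ det-expand N ⟨
    det N             ∎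

  -- Laplace expansion along the first two rows: each pair of columns occurs twice, with opposite signs.
  cross : ∀ {p} (f g : Fin (suc p) → Carrier) (x : Carrier) (ψ : Fin p → Carrier) → Carrier
  cross f g x ψ = sumFin (λ k → sgn k *ᴷ (x *ᴷ (g (suc k) *ᴷ ψ k)))

  double : ∀ {p} (f g : Fin (suc p) → Carrier) (Ψ : Fin (suc p) → Fin p → Carrier) → Carrier
  double f g Ψ = sumFin (λ j → sgn j *ᴷ (f j *ᴷ sumFin (λ k → sgn k *ᴷ (g (punchIn j k) *ᴷ Ψ j k))))

  tail² : ∀ {p} (Ψ : Fin (suc (suc p)) → Fin (suc p) → Carrier) → Fin (suc p) → Fin p → Carrier
  tail² Ψ j k = Ψ (suc j) (suc k)

  double-split : ∀ {p} (f g : Fin (suc (suc p)) → Carrier) (Ψ : Fin (suc (suc p)) → Fin (suc p) → Carrier) →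
    (∀ k → Ψ zero k ≈ Ψ (suc k) zero) →
    double f g Ψ ≈ (cross f g (f zero) (Ψ zero) +ᴷ -ᴷ cross g f (g zero) (Ψ zero)) +ᴷ double (f ∘ suc) (g ∘ suc) (tail² Ψ)
  double-split {p} f g Ψ sym₀ = R.trans (R.+-cong first rest) (R.sym (R.+-assoc _ _ _))
    where
    first : 1# *ᴷ (f zero *ᴷ sumFin (λ k → sgn k *ᴷ (g (suc k) *ᴷ Ψ zero k))) ≈ cross f g (f zero) (Ψ zero)
    first = begin
      1# *ᴷ (f zero *ᴷ sumFin (λ k → sgn k *ᴷ (g (suc k) *ᴷ Ψ zero k)))  ≈⟨ R.*-identityˡ _ ⟩
      f zero *ᴷ sumFin (λ k → sgn k *ᴷ (g (suc k) *ᴷ Ψ zero k))          ≈⟨ sumFin-*ˡ (f zero) (λ k → sgn k *ᴷ (g (suc k) *ᴷ Ψ zero k)) ⟩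
      sumFin (λ k → f zero *ᴷ (sgn k *ᴷ (g (suc k) *ᴷ Ψ zero k)))        ≈⟨ sumFin-cong (λ k → RP.*-left-comm (f zero) (sgn k) (g (suc k) *ᴷ Ψ zero k)) ⟩
      cross f g (f zero) (Ψ zero)                                        ∎
    entry : Fin (suc p) → Fin p → Carrier
    entry j k = g (suc (punchIn j k)) *ᴷ Ψ (suc j) (suc k)
    inner : Fin (suc p) → Carrier
    inner j = sumFin (λ k → sgn k *ᴷ entry j k)
    neg-sgn : ∀ {m} (k : Fin m) → signed (suc (toℕ k)) 1# ≈ -ᴷ sgn k
    neg-sgn k = signed-suc (toℕ k) 1#
    neg*neg : ∀ a b → (-ᴷ a) *ᴷ (-ᴷ b) ≈ a *ᴷ b
    neg*neg a b = R.trans (R.sym (RP.-‿distribˡ-* a _)) (R.trans (R.-‿cong (R.sym (RP.-‿distribʳ-* a b))) (RP.-‿involutive _))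
    one : ∀ j → signed (suc (toℕ j)) 1# *ᴷ (f (suc j) *ᴷ (1# *ᴷ (g zero *ᴷ Ψ (suc j) zero)
                 +ᴷ sumFin (λ k → signed (suc (toℕ k)) 1# *ᴷ (g (suc (punchIn j k)) *ᴷ Ψ (suc j) (suc k)))))
              ≈ (-ᴷ (sgn j *ᴷ (g zero *ᴷ (f (suc j) *ᴷ Ψ zero j)))) +ᴷ sgn j *ᴷ (f (suc j) *ᴷ inner j)
    one j = begin
      signed (suc (toℕ j)) 1# *ᴷ (f (suc j) *ᴷ (1# *ᴷ (g zero *ᴷ Ψ (suc j) zero) +ᴷ _))
        ≈⟨ R.*-cong (neg-sgn j) (R.*-congˡ (R.+-cong (R.*-identityˡ _)
             (R.trans (sumFin-cong {p} (λ k → R.trans (R.*-congʳ (neg-sgn k)) (R.sym (RP.-‿distribˡ-* (sgn k) (entry j k)))))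
                (sumFin-neg (λ k → sgn k *ᴷ entry j k))))) ⟩
      (-ᴷ sgn j) *ᴷ (f (suc j) *ᴷ (g zero *ᴷ Ψ (suc j) zero +ᴷ -ᴷ inner j))
        ≈⟨ R.*-congˡ (R.distribˡ _ _ _) ⟩
      (-ᴷ sgn j) *ᴷ (f (suc j) *ᴷ (g zero *ᴷ Ψ (suc j) zero) +ᴷ f (suc j) *ᴷ (-ᴷ inner j))
        ≈⟨ R.distribˡ _ _ _ ⟩
      (-ᴷ sgn j) *ᴷ (f (suc j) *ᴷ (g zero *ᴷ Ψ (suc j) zero)) +ᴷ (-ᴷ sgn j) *ᴷ (f (suc j) *ᴷ (-ᴷ inner j))
        ≈⟨ R.+-cong
             (R.trans (R.sym (RP.-‿distribˡ-* _ _)) (R.-‿cong (R.*-congˡ (R.trans (RP.*-left-comm _ _ _) (R.*-congˡ (R.*-congˡ (R.sym (sym₀ j))))))))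
             (R.trans (R.*-congˡ (R.sym (RP.-‿distribʳ-* _ _))) (neg*neg _ _)) ⟩
      (-ᴷ (sgn j *ᴷ (g zero *ᴷ (f (suc j) *ᴷ Ψ zero j)))) +ᴷ sgn j *ᴷ (f (suc j) *ᴷ inner j)  ∎
    rest : sumFin (λ j → signed (suc (toℕ j)) 1# *ᴷ (f (suc j) *ᴷ (1# *ᴷ (g zero *ᴷ Ψ (suc j) zero)
                 +ᴷ sumFin (λ k → signed (suc (toℕ k)) 1# *ᴷ (g (suc (punchIn j k)) *ᴷ Ψ (suc j) (suc k))))))
           ≈ (-ᴷ cross g f (g zero) (Ψ zero)) +ᴷ double (f ∘ suc) (g ∘ suc) (tail² Ψ)
    rest = R.trans (sumFin-cong one) (R.trans (sumFin-+ {suc p} (λ j → -ᴷ (sgn j *ᴷ (g zero *ᴷ (f (suc j) *ᴷ Ψ zero j)))) (λ j → sgn j *ᴷ (f (suc j) *ᴷ inner j)))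
      (R.+-congʳ (sumFin-neg {suc p} (λ j → sgn j *ᴷ (g zero *ᴷ (f (suc j) *ᴷ Ψ zero j))))))

  data Symmetric : ∀ {p} → (Fin (suc p) → Fin p → Carrier) → Set (c Level.⊔ ℓ) where
    sym-zero : {Ψ : Fin 1 → Fin 0 → Carrier} → Symmetric Ψ
    sym-suc  : ∀ {p} {Ψ : Fin (suc (suc p)) → Fin (suc p) → Carrier} →
               (∀ k → Ψ zero k ≈ Ψ (suc k) zero) → Symmetric (tail² Ψ) → Symmetric Ψ

  double-single : ∀ (f g : Fin 1 → Carrier) {Ψ : Fin 1 → Fin 0 → Carrier} → double f g Ψ ≈ 0#
  double-single f g = sumFin-zero {1} (λ j → R.trans (R.*-congˡ {sgn j} (R.zeroʳ (f j))) (R.zeroʳ (sgn j)))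

  double-alternating : ∀ {p} (f : Fin (suc p) → Carrier) {Ψ : Fin (suc p) → Fin p → Carrier} → Symmetric Ψ → double f f Ψ ≈ 0#
  double-alternating f {Ψ} sym-zero = double-single f f {Ψ}
  double-alternating f {Ψ} (sym-suc e s) = begin
    double f f Ψ                                          ≈⟨ double-split f f Ψ e ⟩
    (_ +ᴷ -ᴷ _) +ᴷ double (f ∘ suc) (f ∘ suc) (tail² Ψ)   ≈⟨ R.+-cong (R.-‿inverseʳ _) (double-alternating (f ∘ suc) s) ⟩
    0# +ᴷ 0#                                              ≈⟨ R.+-identityˡ 0# ⟩
    0#                                                    ∎

  double-antisymmetric : ∀ {p} (f g : Fin (suc p) → Carrier) {Ψ : Fin (suc p) → Fin p → Carrier} → Symmetric Ψ →
                         double f g Ψ +ᴷ double g f Ψ ≈ 0#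
  double-antisymmetric f g {Ψ} sym-zero = R.trans (R.+-cong (double-single f g {Ψ}) (double-single g f {Ψ})) (R.+-identityˡ 0#)
  double-antisymmetric f g {Ψ} (sym-suc e s) = begin
    double f g Ψ +ᴷ double g f Ψ            ≈⟨ R.+-cong (double-split f g Ψ e) (double-split g f Ψ e) ⟩
    ((a +ᴷ -ᴷ b) +ᴷ r) +ᴷ ((b +ᴷ -ᴷ a) +ᴷ r')  ≈⟨ RP.interchange _ _ _ _ ⟩
    ((a +ᴷ -ᴷ b) +ᴷ (b +ᴷ -ᴷ a)) +ᴷ (r +ᴷ r')  ≈⟨ R.+-cong cancel (double-antisymmetric (f ∘ suc) (g ∘ suc) s) ⟩
    0# +ᴷ 0#                                ≈⟨ R.+-identityˡ 0# ⟩
    0#                                      ∎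
    where
    a = cross f g (f zero) (Ψ zero)
    b = cross g f (g zero) (Ψ zero)
    r = double (f ∘ suc) (g ∘ suc) (tail² Ψ)
    r' = double (g ∘ suc) (f ∘ suc) (tail² Ψ)
    cancel : (a +ᴷ -ᴷ b) +ᴷ (b +ᴷ -ᴷ a) ≈ 0#
    cancel = R.trans (R.+-congˡ (R.+-comm b (-ᴷ a))) (R.trans (RP.interchange a (-ᴷ b) (-ᴷ a) b)
               (R.trans (R.+-cong (R.-‿inverseʳ a) (R.-‿inverseˡ b)) (R.+-identityˡ 0#)))

  lift : ∀ {q m} → (Fin q → Fin m) → Fin (suc q) → Fin (suc m)
  lift φ zero    = zero
  lift φ (suc i) = suc (φ i)

  -- Deleting two columns leaves the same columns in either order; D is an arbitrary function of the remaining ones.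
  deletions-symmetric : ∀ {p} (D : (Fin p → Fin (suc (suc p))) → Carrier) → (∀ {φ χ} → (∀ i → φ i ≡ χ i) → D φ ≈ D χ) →
    (Ψ : Fin (suc (suc p)) → Fin (suc p) → Carrier) → (∀ j l → Ψ j l ≈ D (λ i → punchIn j (punchIn l i))) → Symmetric Ψ
  deletions-symmetric {zero}  D ext Ψ Ψ≈ = sym-suc
    (λ k → R.trans (Ψ≈ zero k) (R.trans (ext λ ()) (R.sym (Ψ≈ (suc k) zero)))) sym-zero
  deletions-symmetric {suc p} D ext Ψ Ψ≈ = sym-suc
    (λ k → R.trans (Ψ≈ zero k) (R.sym (Ψ≈ (suc k) zero)))
    (deletions-symmetric (D ∘ lift) (λ eq → ext λ { zero → refl ; (suc i) → cong suc (eq i) }) (tail² Ψ)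
      (λ j l → R.trans (Ψ≈ (suc j) (suc l)) (ext λ { zero → refl ; (suc i) → refl })))

  minors2 : ∀ {k} → Matrix (suc (suc k)) → Fin (suc (suc k)) → Fin (suc k) → Carrier
  minors2 M j l = det (λ r i → M (suc (suc r)) (punchIn j (punchIn l i)))

  double-congʳ : ∀ {p} (f : Fin (suc p) → Carrier) {g g' : Fin (suc p) → Carrier} (Ψ : Fin (suc p) → Fin p → Carrier) →
                 (∀ j → g j ≈ g' j) → double f g Ψ ≈ double f g' Ψ
  double-congʳ f {g} {g'} Ψ eq = sumFin-cong
    (λ j → R.*-congˡ {sgn j} (R.*-congˡ {f j} (sumFin-cong (λ l → R.*-congˡ {sgn l} (R.*-congʳ {Ψ j l} (eq (punchIn j l)))))))

  det-double : ∀ {k} (M : Matrix (suc (suc k))) →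
    det M ≈ double (M zero) (M (suc zero)) (minors2 M)
  det-double M = R.trans (det-expand M) (sumFin-cong (λ j → R.*-congˡ {sgn j} (R.*-congˡ {M zero j} (det-expand (minor M j)))))

  minors-symmetric : ∀ {k} (M : Matrix (suc (suc k))) → Symmetric (minors2 M)
  minors-symmetric M = deletions-symmetric (λ φ → det (λ r i → M (suc (suc r)) (φ i)))
    (λ eq → det-cong (λ r i → R.reflexive (cong (M (suc (suc r))) (eq i)))) (minors2 M) (λ j l → R.refl)

  swap₀₁ : ∀ {k} {A : Set c} → (Fin (suc (suc k)) → A) → Fin (suc (suc k)) → A
  swap₀₁ M zero          = M (suc zero)
  swap₀₁ M (suc zero)    = M zero
  swap₀₁ M (suc (suc i)) = M (suc (suc i))

  det-swap₀₁ : ∀ {k} (M : Matrix (suc (suc k))) → det (swap₀₁ M) ≈ 0# → det M ≈ 0#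
  det-swap₀₁ M swapped = begin
    det M                      ≈⟨ R.+-identityʳ _ ⟨
    det M +ᴷ 0#                ≈⟨ R.+-congˡ swapped ⟨
    det M +ᴷ det (swap₀₁ M)    ≈⟨ R.+-cong (det-double M) (det-double (swap₀₁ M)) ⟩
    _                          ≈⟨ double-antisymmetric (M zero) (M (suc zero)) (minors-symmetric M) ⟩
    0#                         ∎

  det-zero-terms : ∀ {k} (M : Matrix (suc k)) → (∀ j → det (minor M j) ≈ 0#) → det M ≈ 0#
  det-zero-terms M eq = R.trans (det-expand M)
    (sumFin-zero (λ j → R.trans (R.*-congˡ {sgn j} (R.trans (R.*-congˡ {M zero j} (eq j)) (R.zeroʳ (M zero j)))) (R.zeroʳ (sgn j))))

  det-equal-rows-< : ∀ {k} (M : Matrix k) {a b : Fin k} → toℕ a < toℕ b → (∀ j → M a j ≈ M b j) → det M ≈ 0#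
  det-equal-rows-< M {suc a} {suc b}       (s≤s a<b) eq = det-zero-terms M
    (λ j → det-equal-rows-< (minor M j) a<b (λ i → eq (punchIn j i)))
  det-equal-rows-< M {zero}  {suc zero}    _ eq = R.trans (det-double M) (R.trans
    (double-congʳ (M zero) {M (suc zero)} {M zero} (minors2 M) (R.sym ∘ eq))
    (double-alternating (M zero) (minors-symmetric M)))
  det-equal-rows-< M {zero}  {suc (suc b)} _ eq = det-swap₀₁ M (det-zero-terms (swap₀₁ M)
    (λ j → det-equal-rows-< (minor (swap₀₁ M) j) {zero} {suc b} (s≤s z≤n) (λ i → eq (punchIn j i))))

  det-equal-rows : ∀ {k} (M : Matrix k) {a b : Fin k} → a ≢ b → (∀ j → M a j ≈ M b j) → det M ≈ 0#
  det-equal-rows M {a} {b} a≢b eq with ℕ.<-cmp (toℕ a) (toℕ b)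
  ... | tri< a<b _ _ = det-equal-rows-< M a<b eq
  ... | tri≈ _ a≡b _ = contradiction (Fin.toℕ-injective a≡b) a≢b
  ... | tri> _ _ b<a = det-equal-rows-< M b<a (R.sym ∘ eq)

  update : ∀ {k} {A : Set c} → (Fin k → A) → Fin k → A → Fin k → A
  update M zero    v zero    = v
  update M zero    v (suc i) = M (suc i)
  update M (suc p) v zero    = M zero
  update M (suc p) v (suc i) = update (M ∘ suc) p v i

  update-at : ∀ {k} {A : Set c} (M : Fin k → A) p v → update M p v p ≡ v
  update-at M zero    v = refl
  update-at M (suc p) v = update-at (M ∘ suc) p v

  update-other : ∀ {k} {A : Set c} (M : Fin k → A) {p i} v → i ≢ p → update M p v i ≡ M i
  update-other M {zero}  {zero}  v i≢p = contradiction refl i≢p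
  update-other M {zero}  {suc i} v i≢p = refl
  update-other M {suc p} {zero}  v i≢p = refl
  update-other M {suc p} {suc i} v i≢p = update-other (M ∘ suc) v (i≢p ∘ cong suc)

  update-map : ∀ {k} {A B : Set c} (h : A → B) (M : Fin k → A) p v i → h (update M p v i) ≡ update (h ∘ M) p (h v) i
  update-map h M zero    v zero    = refl
  update-map h M zero    v (suc i) = refl
  update-map h M (suc p) v zero    = refl
  update-map h M (suc p) v (suc i) = update-map h (M ∘ suc) p v i

  det-row-linear : ∀ {k m} (M : Matrix k) (p : Fin k) (a : Fin m → Carrier) (V : Fin m → Fin k → Carrier) →
    det (update M p (λ j → sumFin (λ i → a i *ᴷ V i j))) ≈ sumFin (λ i → a i *ᴷ det (update M p (V i)))
  det-row-linear {suc k} {m} M p a V = begin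
    det (update M p W)                                        ≈⟨ det-expand (update M p W) ⟩
    sumFin (term (update M p W))                              ≈⟨ sumFin-cong {suc k} (step p) ⟩
    sumFin (λ j → sumFin (λ i → a i *ᴷ term (update M p (V i)) j))  ≈⟨ sumFin-swap {suc k} {m} (λ j i → a i *ᴷ term (update M p (V i)) j) ⟩
    sumFin (λ i → sumFin (λ j → a i *ᴷ term (update M p (V i)) j))  ≈⟨ sumFin-cong {m} (λ i → R.sym (sumFin-*ˡ {suc k} (a i) (term (update M p (V i))))) ⟩
    sumFin (λ i → a i *ᴷ sumFin (term (update M p (V i))))    ≈⟨ sumFin-cong {m} (λ i → R.*-congˡ (det-expand (update M p (V i)))) ⟨
    sumFin (λ i → a i *ᴷ det (update M p (V i)))              ∎
    where
    W : Fin (suc k) → Carrier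
    W j = sumFin (λ i → a i *ᴷ V i j)
    rearrange : ∀ s d x v → s *ᴷ (d *ᴷ (x *ᴷ v)) ≈ x *ᴷ (s *ᴷ (v *ᴷ d))
    rearrange s d x v = R.trans (R.*-congˡ (R.trans (RP.*-left-comm d x v) (R.*-congˡ (R.*-comm d v)))) (RP.*-left-comm s x _)
    step : ∀ p j → term (update M p W) j ≈ sumFin (λ i → a i *ᴷ term (update M p (V i)) j)
    step zero j = begin
      sgn j *ᴷ (W j *ᴷ det (minor M j))                         ≈⟨ R.*-congˡ (R.*-comm _ _) ⟩
      sgn j *ᴷ (det (minor M j) *ᴷ W j)                         ≈⟨ R.*-congˡ (sumFin-*ˡ {m} _ _) ⟩
      sgn j *ᴷ sumFin (λ i → det (minor M j) *ᴷ (a i *ᴷ V i j)) ≈⟨ sumFin-*ˡ {m} _ _ ⟩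
      sumFin (λ i → sgn j *ᴷ (det (minor M j) *ᴷ (a i *ᴷ V i j)))
        ≈⟨ sumFin-cong {m} (λ i → rearrange (sgn j) _ (a i) (V i j)) ⟩
      sumFin (λ i → a i *ᴷ (sgn j *ᴷ (V i j *ᴷ det (minor M j))))  ∎
    step (suc p) j = begin
      sgn j *ᴷ (M zero j *ᴷ det (minor (update M (suc p) W) j))
        ≈⟨ R.*-congˡ (R.*-congˡ (minor-update W)) ⟩
      sgn j *ᴷ (M zero j *ᴷ det (update (minor M j) p (W ∘ punchIn j)))
        ≈⟨ R.*-congˡ (R.*-congˡ (det-row-linear (minor M j) p a (λ i → V i ∘ punchIn j))) ⟩
      sgn j *ᴷ (M zero j *ᴷ sumFin (λ i → a i *ᴷ det (update (minor M j) p (V i ∘ punchIn j))))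
        ≈⟨ R.*-congˡ (sumFin-*ˡ {m} _ _) ⟩
      sgn j *ᴷ sumFin (λ i → M zero j *ᴷ (a i *ᴷ det (update (minor M j) p (V i ∘ punchIn j))))
        ≈⟨ sumFin-*ˡ {m} _ _ ⟩
      sumFin (λ i → sgn j *ᴷ (M zero j *ᴷ (a i *ᴷ det (update (minor M j) p (V i ∘ punchIn j)))))
        ≈⟨ sumFin-cong {m} (λ i → R.trans (R.*-congˡ (RP.*-left-comm _ _ _)) (R.trans (RP.*-left-comm _ _ _)
             (R.*-congˡ (R.*-congˡ (R.*-congˡ (R.sym (minor-update (V i)))))))) ⟩
      sumFin (λ i → a i *ᴷ (sgn j *ᴷ (M zero j *ᴷ det (minor (update M (suc p) (V i)) j))))  ∎
      where
      minor-update : ∀ v → det (minor (update M (suc p) v) j) ≈ det (update (minor M j) p (v ∘ punchIn j))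
      minor-update v = det-cong (λ r i → R.reflexive (cong (λ f → f i) (update-map (_∘ punchIn j) (M ∘ suc) p v r)))

  det-zero-row : ∀ {k} (M : Matrix k) (p : Fin k) {v : Fin k → Carrier} → (∀ j → v j ≈ 0#) → det (update M p v) ≈ 0#
  det-zero-row M p {v} v≈0 = R.trans
    (det-cong (λ i j → row i j))
    (det-row-linear {m = 0} M p (λ ()) (λ ()))
    where
    row : ∀ i j → update M p v i j ≈ update M p (λ _ → 0#) i j
    row i j with i Fin.≟ p
    ... | yes refl rewrite update-at M p v | update-at M p (λ _ → 0#) = v≈0 j
    ... | no i≢p rewrite update-other M v i≢p | update-other M (λ _ → 0#) i≢p = R.refl

  det-dependent-rows : ∀ {k} (M : Matrix k) (a : Fin k → Carrier) (p : Fin k) → a p ≈ 1# →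
                       (∀ j → sumFin (λ i → a i *ᴷ M i j) ≈ 0#) → det M ≈ 0#
  det-dependent-rows M a p a≈1 dep = begin
    det M                                         ≈⟨ R.*-identityˡ _ ⟨
    1# *ᴷ det M                                   ≈⟨ R.*-cong a≈1 (det-cong same) ⟨
    a p *ᴷ det (update M p (M p))                 ≈⟨ sumFin-single _ p others ⟨
    sumFin (λ i → a i *ᴷ det (update M p (M i)))  ≈⟨ det-row-linear M p a M ⟨
    det (update M p _)                            ≈⟨ det-zero-row M p dep ⟩
    0#                                            ∎
    where
    same : ∀ i j → update M p (M p) i j ≈ M i j
    same i j with i Fin.≟ p
    ... | yes refl rewrite update-at M p (M p) = R.refl
    ... | no i≢p rewrite update-other M (M p) i≢p = R.refl
    others : ∀ i → i ≢ p → a i *ᴷ det (update M p (M i)) ≈ 0#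
    others i i≢p = R.trans (R.*-congˡ (det-equal-rows (update M p (M i)) (i≢p ∘ sym)
      (λ j → R.reflexive (cong (λ f → f j) (trans (update-at M p (M i)) (sym (update-other M (M i) i≢p))))))) (R.zeroʳ _)

-- Faces with at most three vertices

pair : Fin n → Fin n → Subset n
pair x y = ⁅ x ⁆ ∪ ⁅ y ⁆

triple : Fin n → Fin n → Fin n → Subset n
triple x y z = ⁅ x ⁆ ∪ pair y z

pair-comm : ∀ (x y : Fin n) → pair x y ≡ pair y x
pair-comm x y = Sub.∪-comm ⁅ x ⁆ ⁅ y ⁆

triple-swap : ∀ (x y z : Fin n) → triple x y z ≡ triple x z y
triple-swap x y z = cong (⁅ x ⁆ ∪_) (pair-comm y z)

triple-rot : ∀ (x y z : Fin n) → triple x y z ≡ triple y z x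
triple-rot x y z = trans (Sub.∪-comm ⁅ x ⁆ (pair y z)) (Sub.∪-assoc ⁅ y ⁆ ⁅ z ⁆ ⁅ x ⁆)

∈-cons : x ∈ ⁅ x ⁆ ∪ G
∈-cons {x = x} = Sub.x∈p∪q⁺ (inj₁ (Sub.x∈⁅x⁆ x))

∈-there : y ∈ G → y ∈ ⁅ x ⁆ ∪ G
∈-there y∈G = Sub.x∈p∪q⁺ (inj₂ y∈G)

∈-∪⁻ : y ∈ ⁅ x ⁆ ∪ G → y ≡ x ⊎ y ∈ G
∈-∪⁻ {x = x} {G} y∈ with Sub.x∈p∪q⁻ ⁅ x ⁆ G y∈
... | inj₁ y∈x = inj₁ (Sub.x∈⁅y⁆⇒x≡y x y∈x)
... | inj₂ y∈G = inj₂ y∈G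

∈-pair⁻ : z ∈ pair x y → z ≡ x ⊎ z ≡ y
∈-pair⁻ z∈ with ∈-∪⁻ z∈
... | inj₁ e = inj₁ e
... | inj₂ z∈y = inj₂ (Sub.x∈⁅y⁆⇒x≡y _ z∈y)

∈-triple⁻ : w ∈ triple x y z → w ≡ x ⊎ w ≡ y ⊎ w ≡ z
∈-triple⁻ w∈ with ∈-∪⁻ w∈
... | inj₁ e   = inj₁ e
... | inj₂ w∈p = inj₂ (∈-pair⁻ w∈p)

∈-pairʳ : y ∈ pair x y
∈-pairʳ {y = y} = ∈-there (Sub.x∈⁅x⁆ y)

∪-⊆ : x ∈ F → G ⊆ F → ⁅ x ⁆ ∪ G ⊆ F
∪-⊆ x∈F G⊆F y∈ with ∈-∪⁻ y∈
... | inj₁ refl = x∈F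
... | inj₂ y∈G  = G⊆F y∈G

⁅⁆-⊆ : x ∈ F → ⁅ x ⁆ ⊆ F
⁅⁆-⊆ {x = x} x∈F y∈ with Sub.x∈⁅y⁆⇒x≡y x y∈
... | refl = x∈F

pair-⊆ : x ∈ F → y ∈ F → pair x y ⊆ F
pair-⊆ x∈F y∈F = ∪-⊆ x∈F (⁅⁆-⊆ y∈F)

∣∪⁅⁆∣ : (A : Subset n) {w : Fin n} → w ∉ A → ∣ A ∪ ⁅ w ⁆ ∣ ≡ suc ∣ A ∣
∣∪⁅⁆∣ (true ∷ A)  {zero}  w∉A = contradiction Vec.here w∉A
∣∪⁅⁆∣ (false ∷ A) {zero}  w∉A = cong (suc ∘ ∣_∣) (Sub.∪-identityʳ A)
∣∪⁅⁆∣ (true ∷ A)  {suc w} w∉A = cong suc (∣∪⁅⁆∣ A (w∉A ∘ Vec.there))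
∣∪⁅⁆∣ (false ∷ A) {suc w} w∉A = ∣∪⁅⁆∣ A (w∉A ∘ Vec.there)

∣⁅⁆∪∣ : x ∉ G → ∣ ⁅ x ⁆ ∪ G ∣ ≡ suc ∣ G ∣
∣⁅⁆∪∣ {x = x} {G} x∉G = trans (cong ∣_∣ (Sub.∪-comm ⁅ x ⁆ G)) (∣∪⁅⁆∣ G x∉G)

∉-⁅⁆ : x ≢ y → x ∉ ⁅ y ⁆
∉-⁅⁆ = Sub.x≢y⇒x∉⁅y⁆

∉-pair : x ≢ y → x ≢ z → x ∉ pair y z
∉-pair x≢y x≢z x∈ with ∈-pair⁻ x∈
... | inj₁ e = x≢y e
... | inj₂ e = x≢z e

∣pair∣ : x ≢ y → ∣ pair x y ∣ ≡ 2
∣pair∣ {x = x} {y} x≢y = trans (∣⁅⁆∪∣ (∉-⁅⁆ x≢y)) (cong suc (Sub.∣⁅x⁆∣≡1 y))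

∣triple∣ : x ≢ y → x ≢ z → y ≢ z → ∣ triple x y z ∣ ≡ 3
∣triple∣ x≢y x≢z y≢z = trans (∣⁅⁆∪∣ (∉-pair x≢y x≢z)) (cong suc (∣pair∣ y≢z))

∣F∣≡0⇒∅ : (F : Subset n) → ∣ F ∣ ≡ 0 → F ≡ ∅
∣F∣≡0⇒∅ []          _ = refl
∣F∣≡0⇒∅ (false ∷ F) e = cong (false ∷_) (∣F∣≡0⇒∅ F e)

uncons : ∀ (F : Subset n) {k} → ∣ F ∣ ≡ suc k → ∃₂ λ x G → F ≡ ⁅ x ⁆ ∪ G × x ∉ G × ∣ G ∣ ≡ k
uncons (true ∷ F) e = zero , false ∷ F , cong (true ∷_) (sym (Sub.∪-identityˡ F)) , (λ ()) , ℕ.suc-injective e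
uncons (false ∷ F) e with uncons F e
... | x , G , refl , x∉G , e' = suc x , false ∷ G , refl , (λ { (Vec.there x∈) → x∉G x∈ }) , e'

∣F∣≡1⇒⁅⁆ : (F : Subset n) → ∣ F ∣ ≡ 1 → ∃[ x ] F ≡ ⁅ x ⁆
∣F∣≡1⇒⁅⁆ F e with uncons F e
... | x , G , refl , _ , e' rewrite ∣F∣≡0⇒∅ G e' = x , Sub.∪-identityʳ ⁅ x ⁆

∣F∣≡2⇒pair : (F : Subset n) → ∣ F ∣ ≡ 2 → ∃₂ λ x y → x ≢ y × F ≡ pair x y
∣F∣≡2⇒pair F e with uncons F e
... | x , G , refl , x∉G , e' with ∣F∣≡1⇒⁅⁆ G e'
...   | y , refl = x , y , (λ { refl → x∉G (Sub.x∈⁅x⁆ x) }) , refl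

disjoint-sound : {F G : Subset n} → disjointᵇ F G ≡ true → x ∈ F → x ∉ G
disjoint-sound {F = true ∷ F} {true ∷ G} () Vec.here Vec.here
disjoint-sound {F = a ∷ F}    {b ∷ G}    e (Vec.there p) (Vec.there q) = disjoint-sound (proj₂ (true∧ {not (a ∧ b)} e)) p q

disjoint-complete : {F G : Subset n} → (∀ {x} → x ∈ F → x ∉ G) → disjointᵇ F G ≡ true
disjoint-complete {F = []}        {[]}        dis = refl
disjoint-complete {F = true ∷ F}  {true ∷ G}  dis = contradiction Vec.here (dis Vec.here)
disjoint-complete {F = true ∷ F}  {false ∷ G} dis = disjoint-complete (λ p q → dis (Vec.there p) (Vec.there q))
disjoint-complete {F = false ∷ F} {b ∷ G}     dis = disjoint-complete (λ p q → dis (Vec.there p) (Vec.there q))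

link⁺ : (Δ : FaceFamily n) {F G : Subset n} → (∀ {x} → x ∈ G → x ∉ F) → Δ (G ∪ F) ≡ true → link Δ F G ≡ true
link⁺ Δ dis e = ∧true (disjoint-complete dis) e

link⁻ : (Δ : FaceFamily n) {F G : Subset n} → link Δ F G ≡ true → (∀ {x} → x ∈ G → x ∉ F) × Δ (G ∪ F) ≡ true
link⁻ Δ {F} {G} e with true∧ {disjointᵇ G F} e
... | d , e' = disjoint-sound d , e'

link-vertex⁺ : (Δ : FaceFamily n) {v y : Fin n} → y ≢ v → Δ (pair v y) ≡ true → link Δ ⁅ v ⁆ ⁅ y ⁆ ≡ true
link-vertex⁺ Δ {v} {y} y≢v e = link⁺ Δ
  (λ x∈y x∈v → y≢v (trans (sym (Sub.x∈⁅y⁆⇒x≡y y x∈y)) (Sub.x∈⁅y⁆⇒x≡y v x∈v)))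
  (trans (cong Δ (pair-comm y v)) e)

link-vertex⁻ : (Δ : FaceFamily n) {v y : Fin n} → link Δ ⁅ v ⁆ ⁅ y ⁆ ≡ true → y ≢ v × Δ (pair v y) ≡ true
link-vertex⁻ Δ {v} {y} e with link⁻ Δ e
... | dis , e' = (λ { refl → dis (Sub.x∈⁅x⁆ y) (Sub.x∈⁅x⁆ y) }) , trans (cong Δ (pair-comm v y)) e'

link-pair⁺ : (Δ : FaceFamily n) {v y z : Fin n} → y ≢ v → z ≢ v → Δ (triple v y z) ≡ true → link Δ ⁅ v ⁆ (pair y z) ≡ true
link-pair⁺ Δ {v} {y} {z} y≢v z≢v e = link⁺ Δ dis (trans (cong Δ (Sub.∪-comm (pair y z) ⁅ v ⁆)) e)
  where
  dis : ∀ {x} → x ∈ pair y z → x ∉ ⁅ v ⁆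
  dis x∈ x∈v with Sub.x∈⁅y⁆⇒x≡y v x∈v | ∈-pair⁻ x∈
  ... | refl | inj₁ refl = y≢v refl
  ... | refl | inj₂ refl = z≢v refl

link-pair⁻ : (Δ : FaceFamily n) {v y z : Fin n} → link Δ ⁅ v ⁆ (pair y z) ≡ true → y ≢ v × z ≢ v × Δ (triple v y z) ≡ true
link-pair⁻ Δ {v} {y} {z} e with link⁻ Δ e
... | dis , e' = (λ { refl → dis ∈-cons (Sub.x∈⁅x⁆ y) }) , (λ { refl → dis ∈-pairʳ (Sub.x∈⁅x⁆ z) })
               , trans (cong Δ (Sub.∪-comm ⁅ v ⁆ (pair y z))) e'

cnt₀ : (Δ : FaceFamily n) → cnt Δ 0 ≡ (if Δ ∅ then 1 else 0)
cnt₀ {zero}  Δ = refl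
cnt₀ {suc n} Δ = cnt₀ (Δ ∘ (false ∷_))

cnt₁ : (Δ : FaceFamily n) → (∀ i → Δ ⁅ i ⁆ ≡ true) → cnt Δ 1 ≡ n
cnt₁ {n} Δ v = trans (cnt-cong-at 1 (λ F e → case ∣F∣≡1⇒⁅⁆ F e of λ { (x , refl) → v x })) (trans (cnt-all n 1) (nC1≡n n))

module _ {A : Set} where
  open import Data.List.Relation.Unary.Unique.Propositional using (Unique)
  open import Data.List.Relation.Unary.AllPairs using (_∷_)
  import Data.List.Relation.Unary.All as All

  lookup-unique : {xs : List A} → Unique xs → ∀ {i j} → lookup xs i ≡ lookup xs j → i ≡ j
  lookup-unique {_ ∷ xs} (_ ∷ _)   {zero}  {zero}  _ = refl
  lookup-unique {_ ∷ xs} (x∉ ∷ _)  {zero}  {suc j} e = contradiction e (All.lookup x∉ (∈-lookup j))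
  lookup-unique {_ ∷ xs} (x∉ ∷ _)  {suc i} {zero}  e = contradiction (sym e) (All.lookup x∉ (∈-lookup i))
  lookup-unique {_ ∷ xs} (_ ∷ uxs) {suc i} {suc j} e = cong suc (lookup-unique uxs e)

module _ where
  open import Data.List.Relation.Unary.Unique.Propositional using (Unique)
  open import Data.List.Relation.Unary.AllPairs using ([]; _∷_)
  import Data.List.Relation.Unary.All as All
  import Data.List.Relation.Unary.Unique.Propositional.Properties as Unique
  open import Data.List.Membership.Propositional.Properties using (∈-map⁻)

  allSubsets-unique : ∀ n → Unique (allSubsets n)
  allSubsets-unique zero    = All.[] ∷ []
  allSubsets-unique (suc n) = Unique.++⁺
    (Unique.map⁺ Vec.∷-injectiveʳ (allSubsets-unique n)) (Unique.map⁺ Vec.∷-injectiveʳ (allSubsets-unique n))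
    (λ { (p , q) → case (∈-map⁻ (false ∷_) p , ∈-map⁻ (true ∷_) q) of λ { ((_ , _ , refl) , (_ , _ , ())) } })

  ∈-allSubsets : (F : Subset n) → F ∈ₗ allSubsets n
  ∈-allSubsets []          = here refl
  ∈-allSubsets (false ∷ F) = ∈-++⁺ˡ (∈-map⁺ (false ∷_) (∈-allSubsets F))
  ∈-allSubsets {suc n} (true ∷ F) = ∈-++⁺ʳ (map (false ∷_) (allSubsets n)) (∈-map⁺ (true ∷_) (∈-allSubsets F))

  faces-unique : (Δ : FaceFamily n) (s : ℕ) → Unique (faces Δ s)
  faces-unique {n} Δ s = Unique.filter⁺ _ (allSubsets-unique n)

face : (Δ : FaceFamily n) (s : ℕ) → Fin (fcount Δ s) → Subset n
face Δ s = lookup (faces Δ s)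

face-injective : (Δ : FaceFamily n) (s : ℕ) {i j : Fin (fcount Δ s)} → face Δ s i ≡ face Δ s j → i ≡ j
face-injective Δ s = lookup-unique (faces-unique Δ s)

≡ᵇ-sound : ∀ {a b} → (a ≡ᵇ b) ≡ true → a ≡ b
≡ᵇ-sound {a} {b} e = ℕ.≡ᵇ⇒≡ a b (Equivalence.from Bool.T-≡ e)

≡ᵇ-refl : ∀ a → (a ≡ᵇ a) ≡ true
≡ᵇ-refl a = Equivalence.to Bool.T-≡ (ℕ.≡⇒≡ᵇ a a refl)

face-spec : (Δ : FaceFamily n) (s : ℕ) (i : Fin (fcount Δ s)) → Δ (face Δ s i) ≡ true × ∣ face Δ s i ∣ ≡ s
face-spec {n} Δ s i with ∈-filter⁻ (Bool.T? ∘ (λ F → Δ F ∧ (∣ F ∣ ≡ᵇ s))) {xs = allSubsets n} (∈-lookup {xs = faces Δ s} i)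
... | _ , t with true∧ {Δ (face Δ s i)} (Equivalence.to Bool.T-≡ t)
...   | e , e' = e , ≡ᵇ-sound e'

face-index : (Δ : FaceFamily n) (s : ℕ) {F : Subset n} → Δ F ≡ true → ∣ F ∣ ≡ s → ∃[ i ] face Δ s i ≡ F
face-index Δ s {F} e refl = index F∈ , sym (lookup-index F∈)
  where
  open import Data.List.Relation.Unary.Any.Properties using (lookup-index)
  F∈ : F ∈ₗ faces Δ ∣ F ∣
  F∈ = ∈-filter⁺ (Bool.T? ∘ (λ G → Δ G ∧ (∣ G ∣ ≡ᵇ ∣ F ∣))) (∈-allSubsets F)
         (Equivalence.from Bool.T-≡ (∧true e (≡ᵇ-refl ∣ F ∣)))

-- Homology of graphs

injective-or-collision : ∀ {r m} (ρ : Fin r → Fin m) →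
  (∃₂ λ i j → i ≢ j × ρ i ≡ ρ j) ⊎ (∀ {i j} → ρ i ≡ ρ j → i ≡ j)
injective-or-collision ρ with Fin.any? (λ i → Fin.any? (λ j → ¬? (i Fin.≟ j) ×-dec (ρ i Fin.≟ ρ j)))
... | yes (i , j , i≢j , e) = inj₁ (i , j , i≢j , e)
... | no none = inj₂ λ {i} {j} e → decidable-stable (i Fin.≟ j) (λ i≢j → none (i , j , i≢j , e))

module _ {A : Set} {r : ℕ} (u : A) (ρ : Fin r → A) where

  extend : Fin (suc r) → A
  extend zero    = u
  extend (suc i) = ρ i

  extend-injective : (∀ {i j} → ρ i ≡ ρ j → i ≡ j) → (∀ i → ρ i ≢ u) → ∀ {i j} → extend i ≡ extend j → i ≡ j
  extend-injective inj miss {zero}  {zero}  _ = refl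
  extend-injective inj miss {zero}  {suc j} e = contradiction (sym e) (miss j)
  extend-injective inj miss {suc i} {zero}  e = contradiction e (miss i)
  extend-injective inj miss {suc i} {suc j} e = cong suc (inj e)

Star-crossing : ∀ {A : Set} {R : A → A → Set} {P : A → Set} → (∀ a → Dec (P a)) →
                ∀ {a b} → Star R a b → ¬ P a → P b → ∃₂ λ x y → R x y × ¬ P x × P y
Star-crossing P? ε ¬Pa Pb = contradiction Pb ¬Pa
Star-crossing P? {a} (_◅_ {j = c} Rac walk) ¬Pa Pb with P? c
... | yes Pc = a , c , Rac , ¬Pa , Pc
... | no ¬Pc = Star-crossing P? walk ¬Pc Pb

Adjacent : FaceFamily n → Fin n → Fin n → Set
Adjacent Γ x y = x ≢ y × Γ (pair x y) ≡ true

module GraphHomology {c ℓ} (K : Field c ℓ) where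

  open Determinant K
  private module R = CommutativeRing (Field.commutativeRing K)
  private module RP where
    open import Algebra.Properties.Ring R.ring public
  open import Relation.Binary.Reasoning.Setoid setoid

  IsSign : Carrier → Set ℓ
  IsSign a = a ≈ 1# ⊎ a ≈ -ᴷ 1#

  sign-cancel : ∀ {a x} → IsSign a → a *ᴷ x ≈ 0# → x ≈ 0#
  sign-cancel {a} {x} (inj₁ a≈1) e = R.trans (R.trans (R.sym (R.*-identityˡ x)) (R.*-congʳ (R.sym a≈1))) e
  sign-cancel {a} {x} (inj₂ a≈-1) e = begin
    x                ≈⟨ RP.-‿involutive x ⟨
    -ᴷ (-ᴷ x)        ≈⟨ R.-‿cong (RP.-1*x≈-x x) ⟨
    -ᴷ ((-ᴷ 1#) *ᴷ x)  ≈⟨ R.-‿cong (R.*-congʳ a≈-1) ⟨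
    -ᴷ (a *ᴷ x)      ≈⟨ R.-‿cong e ⟩
    -ᴷ 0#            ≈⟨ RP.-0#≈0# ⟩
    0#               ∎

  incidence-∅ : (z : Fin n) → incidence ∅ ⁅ z ⁆ ≈ 1#
  incidence-∅ {suc n} zero rewrite ==ᵛ-refl {n} ∅ = R.refl
  incidence-∅ (suc z) = incidence-∅ z

  incidence-∉ : (x : Fin n) (P : Subset n) → x ∉ P → incidence ⁅ x ⁆ P ≈ 0#
  incidence-∉ zero    (false ∷ P) x∉P = R.refl
  incidence-∉ zero    (true ∷ P)  x∉P = contradiction Vec.here x∉P
  incidence-∉ (suc x) (false ∷ P) x∉P = incidence-∉ x P (x∉P ∘ Vec.there)
  incidence-∉ (suc x) (true ∷ P)  x∉P with ⁅ x ⁆ ==ᵛ P in eq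
  ... | false = R.refl
  ... | true  = contradiction (Vec.there (subst (x ∈_) (==ᵛ-sound eq) (Sub.x∈⁅x⁆ x))) x∉P

  incidence-ends : (y z : Fin n) → y ≢ z →
    IsSign (incidence ⁅ y ⁆ (pair y z)) × incidence ⁅ y ⁆ (pair y z) +ᴷ incidence ⁅ z ⁆ (pair y z) ≈ 0#
  incidence-ends zero zero y≢z = contradiction refl y≢z
  incidence-ends zero (suc z) _ rewrite Sub.∪-identityˡ ⁅ z ⁆ | ==ᵛ-refl ⁅ z ⁆ =
    inj₂ (R.-‿cong (incidence-∅ z)) , R.trans (R.+-congʳ (R.-‿cong (incidence-∅ z))) (R.-‿inverseˡ 1#)
  incidence-ends (suc y) zero _ rewrite Sub.∪-identityʳ ⁅ y ⁆ | ==ᵛ-refl ⁅ y ⁆ =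
    inj₁ R.refl , R.trans (R.+-congˡ (R.-‿cong (incidence-∅ y))) (R.-‿inverseʳ 1#)
  incidence-ends (suc y) (suc z) y≢z = incidence-ends y z (y≢z ∘ cong suc)

  sumFin-two : ∀ {k} (f : Fin k → Carrier) {p q : Fin k} → p ≢ q → (∀ i → i ≢ p → i ≢ q → f i ≈ 0#) →
               sumFin f ≈ f p +ᴷ f q
  sumFin-two f {zero}  {zero}  p≢q others = contradiction refl p≢q
  sumFin-two f {zero}  {suc q} p≢q others = R.+-congˡ
    (sumFin-single (f ∘ suc) q (λ i i≢q → others (suc i) (λ ()) (i≢q ∘ Fin.suc-injective)))
  sumFin-two f {suc p} {zero}  p≢q others = R.trans (R.+-congˡ
    (sumFin-single (f ∘ suc) p (λ i i≢p → others (suc i) (i≢p ∘ Fin.suc-injective) (λ ())))) (R.+-comm _ _)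
  sumFin-two f {suc p} {suc q} p≢q others = R.trans
    (R.+-cong (others zero (λ ()) (λ ()))
              (sumFin-two (f ∘ suc) (p≢q ∘ cong suc) (λ i i≢p i≢q → others (suc i) (i≢p ∘ Fin.suc-injective) (i≢q ∘ Fin.suc-injective))))
    (R.+-identityˡ _)

  rank-zero : ∀ {m p} (M : Fin m → Fin p → Carrier) → m ≡ 0 ⊎ p ≡ 0 → IsRank M 0
  rank-zero M empty = ((λ ()) , (λ ()) , 0≉1 ∘ R.sym) , λ rows cols → vanish M empty rows cols
    where
    vanish : ∀ {m p} (M : Fin m → Fin p → Carrier) → m ≡ 0 ⊎ p ≡ 0 →
             ∀ (rows : Fin 1 → Fin m) (cols : Fin 1 → Fin p) → det (λ i j → M (rows i) (cols j)) ≈ 0#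
    vanish M (inj₁ refl) rows cols = case rows zero of λ ()
    vanish M (inj₂ refl) rows cols = case cols zero of λ ()

  collision-vanishes : ∀ {r m p} (M : Fin m → Fin p → Carrier) (rows : Fin r → Fin m) (cols : Fin r → Fin p) →
    (∃₂ λ i j → i ≢ j × rows i ≡ rows j) → det (λ i j → M (rows i) (cols j)) ≈ 0#
  collision-vanishes M rows cols (i , j , i≢j , e) =
    det-equal-rows (λ i j → M (rows i) (cols j)) i≢j (λ l → R.reflexive (cong (λ r → M r (cols l)) e))

  module _ (Γ : FaceFamily n) (empty : Γ ∅ ≡ true) where

    fcount-empty : fcount Γ 0 ≡ 1
    fcount-empty = trans (fcount≡cnt Γ 0) (trans (cnt₀ Γ) (cong (λ b → if b then 1 else 0) empty))

    rank-≤1 : ∀ {r} → IsRank (boundary Γ 0) r → r ≤ 1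
    rank-≤1 {r} ((rows , cols , nonzero) , _) with injective-or-collision rows
    ... | inj₁ collision = contradiction (collision-vanishes (boundary Γ 0) rows cols collision) nonzero
    ... | inj₂ injective = subst (r ≤_) fcount-empty (Fin.injective⇒≤ injective)

    rank-one : {v : Fin n} → Γ ⁅ v ⁆ ≡ true → IsRank (boundary Γ 0) 1
    rank-one {v} Γv with face-index Γ 0 empty (Sub.∣⊥∣≡0 n) | face-index Γ 1 Γv (Sub.∣⁅x⁆∣≡1 v)
    ... | i , i≡ | j , j≡ = ((λ _ → i) , (λ _ → j) , λ e → 0≉1 (R.trans (R.sym e) entry)) , vanish
      where
      entry : det {1} (λ _ _ → boundary Γ 0 i j) ≈ 1#
      entry = R.trans (R.+-identityʳ _) (R.trans (R.*-identityʳ _)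
        (R.trans (R.reflexive (cong₂ incidence i≡ j≡)) (incidence-∅ v)))
      vanish : ∀ (rows : Fin 2 → Fin (fcount Γ 0)) (cols : Fin 2 → Fin (fcount Γ 1)) →
               det (λ i j → boundary Γ 0 (rows i) (cols j)) ≈ 0#
      vanish rows cols with injective-or-collision rows
      ... | inj₁ collision = collision-vanishes (boundary Γ 0) rows cols collision
      ... | inj₂ injective = case subst (2 ≤_) fcount-empty (Fin.injective⇒≤ injective) of λ { (s≤s ()) }

    betti-zero : {v : Fin n} → Γ ⁅ v ⁆ ≡ true → IsBetti Γ 0 0
    betti-zero Γv = 0 , 1 , Level.lift refl , rank-one Γv , fcount-empty

  betti-above : (Γ : FaceFamily n) (s : ℕ) → (∀ F → s < ∣ F ∣ → Γ F ≡ false) → IsBetti Γ (suc s) 0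
  betti-above {n} Γ s none = 0 , 0 , rank-zero (boundary Γ s) (inj₂ (absent ℕ.≤-refl))
                                   , rank-zero (boundary Γ (suc s)) (inj₁ (absent ℕ.≤-refl)) , absent ℕ.≤-refl
    where
    absent : ∀ {t} → s < t → fcount Γ t ≡ 0
    absent {t} s<t = trans (fcount≡cnt Γ t) (cnt-none t (λ F e → none F (subst (s <_) (sym e) s<t)))

  module Graph (Γ : FaceFamily n) (empty : Γ ∅ ≡ true) (ends : ∀ {x y} → Γ (pair x y) ≡ true → Γ ⁅ x ⁆ ≡ true) where

    private
      V = fcount Γ 1
      E = fcount Γ 2

    vertex : Fin V → Fin n
    vertex i = proj₁ (∣F∣≡1⇒⁅⁆ (face Γ 1 i) (proj₂ (face-spec Γ 1 i)))

    face-vertex : (i : Fin V) → face Γ 1 i ≡ ⁅ vertex i ⁆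
    face-vertex i = proj₂ (∣F∣≡1⇒⁅⁆ (face Γ 1 i) (proj₂ (face-spec Γ 1 i)))

    vertex-injective : ∀ {i j} → vertex i ≡ vertex j → i ≡ j
    vertex-injective {i} {j} e = face-injective Γ 1 (trans (face-vertex i) (trans (cong ⁅_⁆ e) (sym (face-vertex j))))

    vertex-index : ∀ {x} → Γ ⁅ x ⁆ ≡ true → ∃[ i ] vertex i ≡ x
    vertex-index {x} Γx with face-index Γ 1 Γx (Sub.∣⁅x⁆∣≡1 x)
    ... | i , e = i , Sub.x∈⁅y⁆⇒x≡y x (subst (vertex i ∈_) (trans (sym (face-vertex i)) e) (Sub.x∈⁅x⁆ (vertex i)))

    vertex-face : (i : Fin V) → Γ ⁅ vertex i ⁆ ≡ true
    vertex-face i = subst (λ F → Γ F ≡ true) (face-vertex i) (proj₁ (face-spec Γ 1 i))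

    ends′ : ∀ {x y} → Γ (pair x y) ≡ true → Γ ⁅ y ⁆ ≡ true
    ends′ {x} {y} e = ends (trans (cong Γ (pair-comm y x)) e)

    entry : ∀ i j {P} → face Γ 2 j ≡ P → boundary Γ 1 i j ≈ incidence ⁅ vertex i ⁆ P
    entry i j e = R.reflexive (cong₂ incidence (face-vertex i) e)

    -- The rows of a union of connected components sum to zero.
    component-dependent : ∀ {r} (rows : Fin r → Fin V) (cols : Fin r → Fin E) → (∀ {i j} → rows i ≡ rows j → i ≡ j) →
      (S : Fin n → Bool) → (∀ {x y} → Adjacent Γ x y → S x ≡ S y) →
      (∀ {x} → Γ ⁅ x ⁆ ≡ true → S x ≡ true → ∃[ i ] vertex (rows i) ≡ x) →
      (p : Fin r) → S (vertex (rows p)) ≡ true →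
      det (λ i j → boundary Γ 1 (rows i) (cols j)) ≈ 0#
    component-dependent {r} rows cols injective S closed covered p Sp =
      det-dependent-rows (λ i j → boundary Γ 1 (rows i) (cols j)) coeff p (R.reflexive (cong (λ b → if b then 1# else 0#) Sp)) column
      where
      coeff : Fin r → Carrier
      coeff i = if S (vertex (rows i)) then 1# else 0#
      column : ∀ j → sumFin (λ i → coeff i *ᴷ boundary Γ 1 (rows i) (cols j)) ≈ 0#
      column j with ∣F∣≡2⇒pair (face Γ 2 (cols j)) (proj₂ (face-spec Γ 2 (cols j)))
      ... | y , z , y≢z , e = by-case (true-or-false (S y))
        where
        Γyz : Γ (pair y z) ≡ true
        Γyz = subst (λ F → Γ F ≡ true) e (proj₁ (face-spec Γ 2 (cols j)))
        Sy≡Sz : S y ≡ S z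
        Sy≡Sz = closed (y≢z , Γyz)
        off : ∀ i → vertex (rows i) ≢ y → vertex (rows i) ≢ z → coeff i *ᴷ boundary Γ 1 (rows i) (cols j) ≈ 0#
        off i ≢y ≢z = R.trans (R.*-congˡ (R.trans (entry (rows i) (cols j) e) (incidence-∉ _ _ (∉-pair ≢y ≢z)))) (R.zeroʳ _)
        on : ∀ i x → vertex (rows i) ≡ x → S x ≡ true → coeff i *ᴷ boundary Γ 1 (rows i) (cols j) ≈ incidence ⁅ x ⁆ (pair y z)
        on i x refl Sx = R.trans (R.*-cong (R.reflexive (cong (λ b → if b then 1# else 0#) Sx)) (entry (rows i) (cols j) e)) (R.*-identityˡ _)
        by-case : S y ≡ true ⊎ S y ≡ false → sumFin (λ i → coeff i *ᴷ boundary Γ 1 (rows i) (cols j)) ≈ 0#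
        by-case (inj₁ Sy) with covered (ends Γyz) Sy | covered (ends′ Γyz) (trans (sym Sy≡Sz) Sy)
        ... | a , a≡ | b , b≡ = begin
          sumFin (λ i → coeff i *ᴷ boundary Γ 1 (rows i) (cols j))
            ≈⟨ sumFin-two _ (λ { refl → y≢z (trans (sym a≡) b≡) })
                 (λ i i≢a i≢b → off i (λ ≡y → i≢a (injective (vertex-injective (trans ≡y (sym a≡)))))
                                      (λ ≡z → i≢b (injective (vertex-injective (trans ≡z (sym b≡)))))) ⟩
          _ ≈⟨ R.+-cong (on a y a≡ Sy) (on b z b≡ (trans (sym Sy≡Sz) Sy)) ⟩
          incidence ⁅ y ⁆ (pair y z) +ᴷ incidence ⁅ z ⁆ (pair y z)  ≈⟨ proj₂ (incidence-ends y z y≢z) ⟩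
          0#  ∎
        by-case (inj₂ ¬Sy) = sumFin-zero outside
          where
          outside : ∀ i → coeff i *ᴷ boundary Γ 1 (rows i) (cols j) ≈ 0#
          outside i with true-or-false (S (vertex (rows i)))
          ... | inj₁ Si = off i (λ { ≡y → true≢false (subst (λ x → S x ≡ true) ≡y Si) ¬Sy })
                                (λ { ≡z → true≢false (subst (λ x → S x ≡ true) ≡z Si) (trans (sym Sy≡Sz) ¬Sy) })
          ... | inj₂ ¬Si = R.trans (R.*-congʳ (R.reflexive (cong (λ b → if b then 1# else 0#) ¬Si))) (R.zeroˡ _)

    missed? : ∀ {r} (rows : Fin r → Fin V) (u : Fin V) → (∃[ i ] rows i ≡ u) ⊎ (∀ i → rows i ≢ u)
    missed? rows u with Fin.any? (λ i → rows i Fin.≟ u)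
    ... | yes hit = inj₁ hit
    ... | no miss = inj₂ (λ i e → miss (i , e))

    betti-one⇒connected : IsBetti Γ 1 0 → (S : Fin n → Bool) → (∀ {x y} → Adjacent Γ x y → S x ≡ S y) →
      ∀ {y z} → Γ ⁅ y ⁆ ≡ true → S y ≡ true → Γ ⁅ z ⁆ ≡ true → S z ≡ false → ∀ {a} {A : Set a} → A
    betti-one⇒connected (r₁ , r₂ , rank₁ , ((rows , cols , nonzero) , _) , total) S closed {y} {z} Γy Sy Γz ¬Sz =
      ⊥-elim (nonzero vanish)
      where
      large : V ≤ suc r₂
      large = subst (_≤ suc r₂) (sym (trans total (ℕ.+-identityʳ (r₁ + r₂)))) (ℕ.+-monoˡ-≤ r₂ (rank-≤1 Γ empty rank₁))
      side : (S : Fin n → Bool) → (∀ {x y} → Adjacent Γ x y → S x ≡ S y) → (∀ {i j} → rows i ≡ rows j → i ≡ j) →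
             ∀ {y} → Γ ⁅ y ⁆ ≡ true → S y ≡ true →
             (∀ {x} → Γ ⁅ x ⁆ ≡ true → S x ≡ true → ∃[ i ] vertex (rows i) ≡ x) →
             det (λ i j → boundary Γ 1 (rows i) (cols j)) ≈ 0#
      side S closed injective Γy Sy covered with covered Γy Sy
      ... | p , refl = component-dependent rows cols injective S closed covered p Sy
      hits : (S : Fin n → Bool) → (∀ {x} → Γ ⁅ x ⁆ ≡ true → S x ≡ true → ∃[ i ] vertex (rows i) ≡ x)
             ⊎ ∃[ u ] (S (vertex u) ≡ true × ∀ i → rows i ≢ u)
      hits S with Fin.any? (λ u → (S (vertex u) Bool.≟ true) ×-dec Fin.all? (λ i → ¬? (rows i Fin.≟ u)))
      ... | yes (u , Su , miss) = inj₂ (u , Su , miss)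
      ... | no none = inj₁ λ {x} Γx Sx → case vertex-index Γx of λ { (u , refl) → case missed? rows u of λ
              { (inj₁ (i , e)) → i , cong vertex e
              ; (inj₂ miss) → contradiction (u , Sx , miss) none } }
      vanish : det (λ i j → boundary Γ 1 (rows i) (cols j)) ≈ 0#
      vanish with injective-or-collision rows
      ... | inj₁ collision = collision-vanishes (boundary Γ 1) rows cols collision
      ... | inj₂ injective with hits S | hits (not ∘ S)
      ...   | inj₁ covered | _ = side S closed injective Γy Sy covered
      ...   | inj₂ _ | inj₁ covered = side (not ∘ S) (cong not ∘ closed) injective Γz (cong not ¬Sz) covered
      ...   | inj₂ (u , Su , miss-u) | inj₂ (v , ¬Sv , miss-v) =
        contradiction (ℕ.≤-trans (Fin.injective⇒≤ (extend-injective v (extend u rows) (extend-injective u rows injective miss-u)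
            (λ { zero refl → true≢false ¬Sv (cong not Su) ; (suc i) → miss-v i })))
            large) (ℕ.<-irrefl refl)

    module _ {root : Fin n} (Γroot : Γ ⁅ root ⁆ ≡ true)
             (connected : ∀ {y} → Γ ⁅ y ⁆ ≡ true → Star (Adjacent Γ) y root) where

      Visited : ∀ {k} → (Fin k → Fin V) → Fin n → Set
      Visited rows x = x ≡ root ⊎ ∃[ i ] vertex (rows i) ≡ x

      visited? : ∀ {k} (rows : Fin k → Fin V) x → Dec (Visited rows x)
      visited? rows x = (x Fin.≟ root) ⊎-dec Fin.any? (λ i → vertex (rows i) Fin.≟ x)

      record Tree (k : ℕ) : Set (c Level.⊔ ℓ) where
        field
          rows    : Fin k → Fin V
          cols    : Fin k → Fin E
          nonzero : ¬ (det (λ i j → boundary Γ 1 (rows i) (cols j)) ≈ 0#)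
          spans   : ∀ j {x} → x ∈ face Γ 2 (cols j) → Visited rows x

      unvisited : ∀ {k} (rows : Fin k → Fin V) → suc k < V → ∃[ u ] ¬ Visited rows (vertex u)
      unvisited {k} rows lt with Fin.any? (λ u → ¬? (visited? rows (vertex u)))
      ... | yes found = found
      ... | no none = contradiction lt (ℕ.≤⇒≯ (Fin.injective⇒≤ {f = label ∘ seen} (λ {u} {v} → label-injective u v (seen u) (seen v))))
        where
        seen : ∀ u → Visited rows (vertex u)
        seen u = decidable-stable (visited? rows (vertex u)) (λ ¬v → none (u , ¬v))
        label : ∀ {x} → Visited rows x → Fin (suc k)
        label (inj₁ _)       = zero
        label (inj₂ (i , _)) = suc i
        label-injective : ∀ u v (p : Visited rows (vertex u)) (q : Visited rows (vertex v)) → label p ≡ label q → u ≡ v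
        label-injective u v (inj₁ p)       (inj₁ q)        _    = vertex-injective (trans p (sym q))
        label-injective u v (inj₂ (i , p)) (inj₂ (.i , q)) refl = vertex-injective (trans (sym p) q)

      grow : ∀ k → suc k ≤ V → Tree k
      grow zero    _  = record { rows = λ () ; cols = λ () ; nonzero = 0≉1 ∘ R.sym ; spans = λ () }
      grow (suc k) lt with grow k (ℕ.≤-trans (ℕ.n≤1+n _) lt)
      ... | T with unvisited (Tree.rows T) lt
      ... | u , ¬vu with Star-crossing (visited? (Tree.rows T)) (connected (vertex-face u)) ¬vu (inj₁ refl)
      ... | z , y , (z≢y , Γzy) , ¬vz , vy with vertex-index (ends Γzy) | face-index Γ 2 Γzy (∣pair∣ z≢y)
      ... | i , refl | j , j≡ = record
        { rows    = extend i rows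
        ; cols    = extend j cols
        ; nonzero = λ e → nonzero (sign-cancel (proj₁ (incidence-ends z y z≢y)) (R.trans (R.sym expand) e))
        ; spans   = λ { zero x∈ → case ∈-pair⁻ (subst (_ ∈_) j≡ x∈) of λ
                          { (inj₁ refl) → inj₂ (zero , refl) ; (inj₂ refl) → older vy }
                      ; (suc l) x∈ → older (spans l x∈) }
        }
        where
        open Tree T
        older : ∀ {x} → Visited rows x → Visited (extend i rows) x
        older (inj₁ e)       = inj₁ e
        older (inj₂ (l , e)) = inj₂ (suc l , e)
        M : Matrix (suc k)
        M a b = boundary Γ 1 (extend i rows a) (extend j cols b)
        expand : det M ≈ incidence ⁅ z ⁆ (pair z y) *ᴷ det (λ a b → boundary Γ 1 (rows a) (cols b))
        expand = begin
          det M            ≈⟨ det-expand M ⟩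
          sumFin (term M)  ≈⟨ sumFin-single (term M) zero later ⟩
          term M zero      ≈⟨ R.*-identityˡ _ ⟩
          boundary Γ 1 i j *ᴷ det (minor M zero)  ≈⟨ R.*-congʳ (entry i j j≡) ⟩
          incidence ⁅ z ⁆ (pair z y) *ᴷ det (minor M zero)  ∎
          where
          later : ∀ b → b ≢ zero → term M b ≈ 0#
          later zero    b≢ = contradiction refl b≢
          later (suc b) _  = R.trans (R.*-congˡ {sgn (suc b)} (R.trans (R.*-congʳ {det (minor M (suc b))}
            (R.trans (entry i (cols b) refl) (incidence-∉ z _ (λ z∈ → ¬vz (spans b z∈))))) (R.zeroˡ _))) (R.zeroʳ _)

      betti-one : IsBetti Γ 1 0
      betti-one with inhabited (proj₁ (vertex-index Γroot))
        where
        inhabited : ∀ {m} → Fin m → ∃[ k ] m ≡ suc k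
        inhabited {suc k} _ = k , refl
      ... | k , V≡ = 1 , k , rank-one Γ empty Γroot , (nonzero-minor , vanish) , trans V≡ (sym (cong suc (ℕ.+-identityʳ k)))
        where
        open Tree (grow k (ℕ.≤-reflexive (sym V≡)))
        nonzero-minor : Σ (Fin k → Fin V) λ rows → Σ (Fin k → Fin E) λ cols → ¬ (det (λ i j → boundary Γ 1 (rows i) (cols j)) ≈ 0#)
        nonzero-minor = rows , cols , nonzero
        vanish : ∀ (rows : Fin (suc k) → Fin V) (cols : Fin (suc k) → Fin E) → det (λ i j → boundary Γ 1 (rows i) (cols j)) ≈ 0#
        vanish rows cols with injective-or-collision rows
        ... | inj₁ collision = collision-vanishes (boundary Γ 1) rows cols collision
        ... | inj₂ injective = component-dependent rows cols injective (λ _ → true) (λ _ → refl) covered zero refl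
          where
          covered : ∀ {x} → Γ ⁅ x ⁆ ≡ true → true ≡ true → ∃[ i ] vertex (rows i) ≡ x
          covered Γx _ with vertex-index Γx
          ... | u , refl with missed? rows u
          ...   | inj₁ (i , e) = i , cong vertex e
          ...   | inj₂ miss = contradiction (subst (suc (suc k) ≤_) V≡ (Fin.injective⇒≤ (extend-injective u rows injective miss))) (ℕ.<-irrefl refl)

-- Links of pure 2-dimensional complexes

∣∪∣-disjoint : (G F : Subset n) → disjointᵇ G F ≡ true → ∣ G ∪ F ∣ ≡ ∣ G ∣ + ∣ F ∣
∣∪∣-disjoint []          []          _ = refl
∣∪∣-disjoint (true ∷ G)  (false ∷ F) d = cong suc (∣∪∣-disjoint G F d)
∣∪∣-disjoint (false ∷ G) (true ∷ F)  d = trans (cong suc (∣∪∣-disjoint G F d)) (sym (ℕ.+-suc ∣ G ∣ ∣ F ∣))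
∣∪∣-disjoint (false ∷ G) (false ∷ F) d = ∣∪∣-disjoint G F d

link-size : (Δ : FaceFamily n) {F G : Subset n} → link Δ F G ≡ true → ∣ G ∪ F ∣ ≡ ∣ G ∣ + ∣ F ∣
link-size Δ {F} {G} e = ∣∪∣-disjoint G F (proj₁ (true∧ {disjointᵇ G F} e))

link-∅ : (Γ : FaceFamily n) (G : Subset n) → link Γ ∅ G ≡ Γ G
link-∅ Γ G rewrite disjoint-∅ʳ G | Sub.∪-identityʳ G = refl

link-∅⁺ : (Γ : FaceFamily n) (G : Subset n) → Γ G ≡ true → link Γ ∅ G ≡ true
link-∅⁺ Γ G = trans (link-∅ Γ G)

link-∅⁻ : (Γ : FaceFamily n) (G : Subset n) → link Γ ∅ G ≡ true → Γ G ≡ true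
link-∅⁻ Γ G = trans (sym (link-∅ Γ G))

module _ {A : Set} (f : A → ℕ) where

  foldr-⊔-upper : {x : A} (xs : List A) → x ∈ₗ xs → f x ≤ foldr _⊔_ 0 (map f xs)
  foldr-⊔-upper (x ∷ xs) (here refl) = ℕ.m≤m⊔n (f x) _
  foldr-⊔-upper (y ∷ xs) (there x∈)  = ℕ.≤-trans (foldr-⊔-upper xs x∈) (ℕ.m≤n⊔m (f y) _)

  foldr-⊔-least : ∀ {b} (xs : List A) → (∀ {x} → x ∈ₗ xs → f x ≤ b) → foldr _⊔_ 0 (map f xs) ≤ b
  foldr-⊔-least []       le = z≤n
  foldr-⊔-least (x ∷ xs) le = ℕ.⊔-lub (le (here refl)) (foldr-⊔-least xs (le ∘ there))

dim-upper : (Δ : FaceFamily n) {F : Subset n} → Δ F ≡ true → ∣ F ∣ ≤ dimPlusOne Δ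
dim-upper Δ {F} e = foldr-⊔-upper ∣_∣ _ (∈-filter⁺ (Bool.T? ∘ Δ) (∈-allSubsets F) (Equivalence.from Bool.T-≡ e))

dim-least : (Δ : FaceFamily n) {b : ℕ} → (∀ {F} → Δ F ≡ true → ∣ F ∣ ≤ b) → dimPlusOne Δ ≤ b
dim-least {n} Δ le = foldr-⊔-least ∣_∣ _
  (λ F∈ → le (Equivalence.to Bool.T-≡ (proj₂ (∈-filter⁻ (Bool.T? ∘ Δ) {xs = allSubsets n} F∈))))

dim-unique : (Δ : FaceFamily n) {F : Subset n} → Δ F ≡ true → (∀ {G} → Δ G ≡ true → ∣ G ∣ ≤ ∣ F ∣) → dimPlusOne Δ ≡ ∣ F ∣
dim-unique Δ ΔF le = ℕ.≤-antisym (dim-least Δ le) (dim-upper Δ ΔF)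

record Pure₃ (Δ : FaceFamily n) : Set where
  field
    simplicial : IsSimplicialComplex Δ
    small      : ∀ {F} → Δ F ≡ true → ∣ F ∣ ≤ 3
    neighbour  : ∀ x → ∃[ y ] (x ≢ y × Δ (pair x y) ≡ true)
    triangle   : ∀ {x y} → x ≢ y → Δ (pair x y) ≡ true → ∃[ z ] (x ≢ z × y ≢ z × Δ (triple x y z) ≡ true)

  down : ∀ {F G} → G ⊆ F → Δ F ≡ true → Δ G ≡ true
  down {F} {G} = proj₂ simplicial F G

  vertex-triangle : ∀ x → ∃₂ λ y z → x ≢ y × x ≢ z × y ≢ z × Δ (triple x y z) ≡ true
  vertex-triangle x with neighbour x
  ... | y , x≢y , Δxy with triangle x≢y Δxy
  ... | z , x≢z , y≢z , Δxyz = y , z , x≢y , x≢z , y≢z , Δxyz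

Connected : FaceFamily n → Set
Connected {n} Γ = ∃[ r ] (∀ {y : Fin n} → Γ ⁅ y ⁆ ≡ true → Star (Adjacent Γ) y r)

Star-last : ∀ {A : Set} {R : A → A → Set} {a b} → a ≢ b → Star R a b → ∃[ x ] R x b
Star-last a≢b ε = contradiction refl a≢b
Star-last {b = b} a≢b (Rac ◅ ε) = _ , Rac
Star-last {R = R} a≢b (Rac ◅ (Rcd ◅ walk)) = last Rcd walk
  where
  last : ∀ {a c b} → R a c → Star R c b → ∃[ x ] R x b
  last Rac ε            = _ , Rac
  last _   (Rcd ◅ walk) = last Rcd walk

module _ {c ℓ} (K : Field c ℓ) where

  open GraphHomology K
  open LinAlg K using (IsBetti; IsCohenMacaulay; IsBuchsbaum)

  module _ {Δ : FaceFamily n} (P : Pure₃ Δ) where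

    open Pure₃ P

    dim≡3 : Fin n → dimPlusOne Δ ≡ 3
    dim≡3 x with vertex-triangle x
    ... | y , z , x≢y , x≢z , y≢z , Δxyz =
      trans (dim-unique Δ Δxyz (λ {G} ΔG → subst (∣ G ∣ ≤_) (sym (∣triple∣ x≢y x≢z y≢z)) (small ΔG))) (∣triple∣ x≢y x≢z y≢z)

    private
      lk : Fin n → FaceFamily n
      lk v = link Δ ⁅ v ⁆

    lk-∅ : ∀ v → lk v ∅ ≡ true
    lk-∅ v = link⁺ Δ {⁅ v ⁆} {∅} (λ x∈∅ → contradiction x∈∅ Sub.∉⊥) (trans (cong Δ (Sub.∪-identityˡ ⁅ v ⁆)) (proj₁ simplicial v))

    lk-small : ∀ v {G} → lk v G ≡ true → ∣ G ∣ ≤ 2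
    lk-small v {G} e = ℕ.≤-pred (subst (_≤ 3)
      (trans (link-size Δ {⁅ v ⁆} {G} e) (trans (cong (λ k → ∣ G ∣ + k) (Sub.∣⁅x⁆∣≡1 v)) (ℕ.+-comm ∣ G ∣ 1))) (small (proj₂ (link⁻ Δ {⁅ v ⁆} {G} e))))

    lk-edge : ∀ v → ∃₂ λ y z → y ≢ z × lk v (pair y z) ≡ true
    lk-edge v with vertex-triangle v
    ... | y , z , v≢y , v≢z , y≢z , e = y , z , y≢z , link-pair⁺ Δ (v≢y ∘ sym) (v≢z ∘ sym) e

    lk-dim : ∀ v → dimPlusOne (lk v) ≡ 2
    lk-dim v with lk-edge v
    ... | y , z , y≢z , e = trans (dim-unique (lk v) e (λ {G} eG → subst (∣ G ∣ ≤_) (sym (∣pair∣ y≢z)) (lk-small v {G} eG))) (∣pair∣ y≢z)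

    lk-down : ∀ v {F G} → G ⊆ F → lk v F ≡ true → lk v G ≡ true
    lk-down v {F} {G} G⊆F e with link⁻ Δ {⁅ v ⁆} {F} e
    ... | dis , e' = link⁺ Δ {⁅ v ⁆} {G} (dis ∘ G⊆F) (down sub e')
      where
      sub : G ∪ ⁅ v ⁆ ⊆ F ∪ ⁅ v ⁆
      sub x∈ with Sub.x∈p∪q⁻ G ⁅ v ⁆ x∈
      ... | inj₁ x∈G = Sub.x∈p∪q⁺ (inj₁ (G⊆F x∈G))
      ... | inj₂ x∈v = Sub.x∈p∪q⁺ (inj₂ x∈v)

    lk-end : ∀ v {y z} → lk v (pair y z) ≡ true → lk v ⁅ y ⁆ ≡ true
    lk-end v {y} {z} = lk-down v {pair y z} {⁅ y ⁆} (⁅⁆-⊆ ∈-cons)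

    lk-vertex : ∀ v → ∃[ y ] lk v ⁅ y ⁆ ≡ true
    lk-vertex v with lk-edge v
    ... | y , z , _ , e = y , lk-end v e

    extends : Fin n → ∀ F → Δ F ≡ true → ∣ F ∣ ≡ 3 ⊎ ∃[ G ] (F ⊆ G × Δ G ≡ true × ∣ F ∣ < ∣ G ∣)
    extends v F ΔF with ∣ F ∣ in eq | small ΔF
    ... | 0 | _ rewrite ∣F∣≡0⇒∅ F eq =
      inj₂ (⁅ v ⁆ , Sub.⊥⊆ , proj₁ simplicial v , ℕ.≤-reflexive (sym (Sub.∣⁅x⁆∣≡1 v)))
    ... | 1 | _ with ∣F∣≡1⇒⁅⁆ F eq
    ...   | x , refl with neighbour x
    ...     | y , x≢y , Δxy = inj₂ (pair x y , ⁅⁆-⊆ ∈-cons , Δxy , ℕ.≤-reflexive (sym (∣pair∣ x≢y)))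
    extends v F ΔF | 2 | _ with ∣F∣≡2⇒pair F eq
    ...   | x , y , x≢y , refl with triangle x≢y ΔF
    ...     | z , x≢z , y≢z , Δxyz = inj₂ (triple x y z , pair-⊆ ∈-cons (∈-there ∈-cons) , Δxyz
                                           , ℕ.≤-reflexive (sym (∣triple∣ x≢y x≢z y≢z)))
    extends v F ΔF | 3 | _ = inj₁ refl
    extends v F ΔF | suc (suc (suc (suc _))) | s≤s (s≤s (s≤s ()))

    pure : Fin n → IsPure Δ
    pure v F ΔF maximal with extends v F ΔF
    ... | inj₁ e = trans e (sym (dim≡3 v))
    ... | inj₂ (G , F⊆G , ΔG , lt) = contradiction lt (ℕ.≤⇒≯ (Sub.p⊆q⇒∣p∣≤∣q∣ (maximal G F⊆G ΔG)))

    module _ (connected : ∀ v → Connected (lk v)) where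

      cohen-macaulay : ∀ v → IsCohenMacaulay (lk v)
      cohen-macaulay v F lkF s s≢ = bySize ∣ F ∣ refl s (subst (λ d → s + ∣ F ∣ ≢ d) (lk-dim v) s≢)
        where
        Γ : FaceFamily n
        Γ = link (lk v) F
        Γ∅ : Γ ∅ ≡ true
        Γ∅ = link⁺ (lk v) {F} {∅} (λ x∈∅ → contradiction x∈∅ Sub.∉⊥) (trans (cong (lk v) (Sub.∪-identityˡ F)) lkF)
        above : ∀ s → 2 ≤ s + ∣ F ∣ → IsBetti Γ (suc s) 0
        above s le = betti-above Γ s λ G s<G → case true-or-false (Γ G) of λ
          { (inj₂ e) → e
          ; (inj₁ e) → contradiction
              (ℕ.≤-trans (ℕ.+-monoˡ-≤ ∣ F ∣ s<G) (ℕ.≤-trans (subst (_≤ 2) (link-size (lk v) {F} {G} e) (lk-small v {G ∪ F} (proj₂ (link⁻ (lk v) {F} {G} e)))) le))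
              (ℕ.<-irrefl refl) }
        bySize : ∀ k → ∣ F ∣ ≡ k → ∀ s → s + ∣ F ∣ ≢ 2 → IsBetti Γ s 0
        bySize 0 e s s≢2 rewrite ∣F∣≡0⇒∅ F e = empty-case s s≢2
          where
          empty-case : ∀ s → s + ∣ ∅ {n} ∣ ≢ 2 → IsBetti (link (lk v) ∅) s 0
          empty-case 0 _ = betti-zero (link (lk v) ∅) (trans (link-∅ (lk v) ∅) (lk-∅ v)) {proj₁ (lk-vertex v)}
                                      (link-∅⁺ (lk v) ⁅ proj₁ (lk-vertex v) ⁆ (proj₂ (lk-vertex v)))
          empty-case 1 _ with connected v | lk-vertex v
          ... | r , walk | y , lky = Graph.betti-one (link (lk v) ∅) (trans (link-∅ (lk v) ∅) (lk-∅ v))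
                (λ {x} {z} e → link-∅⁺ (lk v) ⁅ x ⁆ (lk-end v (link-∅⁻ (lk v) (pair x z) e)))
                (link-∅⁺ (lk v) ⁅ r ⁆ root) (λ {y} e → Star.map step (walk (link-∅⁻ (lk v) ⁅ y ⁆ e)))
            where
            step : ∀ {x z} → Adjacent (lk v) x z → Adjacent (link (lk v) ∅) x z
            step {x} {z} (x≢z , e) = x≢z , link-∅⁺ (lk v) (pair x z) e
            root : lk v ⁅ r ⁆ ≡ true
            root with y Fin.≟ r
            ... | yes refl = lky
            ... | no y≢r with Star-last y≢r (walk lky)
            ...   | x , x≢r , e = lk-end v (trans (cong (lk v) (pair-comm r x)) e)
          empty-case 2 s≢2 = contradiction (cong (λ k → 2 + k) (Sub.∣⊥∣≡0 n)) s≢2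
          empty-case (suc (suc (suc s))) _ = betti-above (link (lk v) ∅) (suc (suc s)) λ G lt → trans (link-∅ (lk v) G)
            (case true-or-false (lk v G) of λ { (inj₂ e) → e ; (inj₁ e) → contradiction (ℕ.≤-trans lt (lk-small v {G} e)) λ { (s≤s (s≤s ())) } })
        bySize 1 e s s≢2 with ∣F∣≡1⇒⁅⁆ F e
        bySize 1 e 0 s≢2 | w , refl with link-vertex⁻ Δ lkF
        ... | w≢v , Δvw with triangle (w≢v ∘ sym) Δvw
        ...   | z , v≢z , w≢z , Δvwz = betti-zero Γ Γ∅ {z} (link-vertex⁺ (lk v) (w≢z ∘ sym)
                  (link-pair⁺ Δ w≢v (v≢z ∘ sym) Δvwz))
        bySize 1 e 1 s≢2 | w , refl = contradiction (cong suc e) s≢2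
        bySize 1 e (suc (suc s)) s≢2 | w , refl = above (suc s) (s≤s (subst (1 ≤_) (sym (trans (cong (λ k → s + k) e) (ℕ.+-comm s 1))) (s≤s z≤n)))
        bySize 2 e 0 s≢2 = contradiction e s≢2
        bySize 2 e (suc s) s≢2 = above s (subst (λ f → 2 ≤ s + f) (sym e) (ℕ.m≤n+m 2 s))
        bySize (suc (suc (suc k))) e s s≢2 = contradiction (subst (_≤ 2) e (lk-small v {F} lkF)) λ { (s≤s (s≤s ())) }

      buchsbaum : Fin n → IsBuchsbaum Δ
      buchsbaum v = pure v , cohen-macaulay

  module _ {Δ : FaceFamily n} (simplicial : IsSimplicialComplex Δ) (dim : dimPlusOne Δ ≡ 3) (B : IsBuchsbaum Δ) where

    private
      larger : ∀ F → Δ F ≡ true → ∣ F ∣ ≢ 3 → ∃[ i ] (i ∉ F × Δ (⁅ i ⁆ ∪ F) ≡ true)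
      larger F ΔF ≢3 with Fin.any? (λ i → ¬? (i Sub.∈? F) ×-dec (Δ (⁅ i ⁆ ∪ F) Bool.≟ true))
      ... | yes found = found
      ... | no none = contradiction (trans (proj₁ B F ΔF maximal) dim) ≢3
        where
        maximal : ∀ G → F ⊆ G → Δ G ≡ true → G ⊆ F
        maximal G F⊆G ΔG {i} i∈G with i Sub.∈? F
        ... | yes i∈F = i∈F
        ... | no i∉F = contradiction (i , i∉F , proj₂ simplicial G _ (∪-⊆ i∈G F⊆G) ΔG) none

    buchsbaum⇒pure₃ : Pure₃ Δ
    buchsbaum⇒pure₃ = record
      { simplicial = simplicial
      ; small      = λ {F} ΔF → subst (∣ F ∣ ≤_) dim (dim-upper Δ ΔF)
      ; neighbour  = λ x → case larger ⁅ x ⁆ (proj₁ simplicial x) (λ e → case trans (sym (Sub.∣⁅x⁆∣≡1 x)) e of λ ()) of λ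
          { (y , y∉x , e) → y , (λ { refl → y∉x (Sub.x∈⁅x⁆ y) }) , trans (cong Δ (pair-comm x y)) e }
      ; triangle   = λ {x} {y} x≢y Δxy → case larger (pair x y) Δxy (λ e → case trans (sym (∣pair∣ x≢y)) e of λ ()) of λ
          { (z , z∉ , e) → z , (λ { refl → z∉ ∈-cons }) , (λ { refl → z∉ ∈-pairʳ }) , trans (cong Δ (sym (triple-rot z x y))) e }
      }

    open Pure₃ buchsbaum⇒pure₃

    -- The homological condition, made effective by a finite search.
    link-crossing : ∀ v (S : Fin n → Bool) {y z} → link Δ ⁅ v ⁆ ⁅ y ⁆ ≡ true → S y ≡ true → link Δ ⁅ v ⁆ ⁅ z ⁆ ≡ true → S z ≡ false →
                    ∃₂ λ a b → Adjacent (link Δ ⁅ v ⁆) a b × S a ≡ true × S b ≡ false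
    link-crossing v S {y} {z} ly Sy lz ¬Sz
      with Fin.any? (λ a → Fin.any? (λ b → (¬? (a Fin.≟ b) ×-dec (link Δ ⁅ v ⁆ (pair a b) Bool.≟ true))
                                           ×-dec ((S a Bool.≟ true) ×-dec (S b Bool.≟ false))))
    ... | yes (a , b , adj , Sa , ¬Sb) = a , b , adj , Sa , ¬Sb
    ... | no none = Graph.betti-one⇒connected (link Γ ∅) (trans (link-∅ Γ ∅) (lk-∅ buchsbaum⇒pure₃ v))
          (λ {a} {b} e → link-∅⁺ Γ ⁅ a ⁆ (lk-end buchsbaum⇒pure₃ v (link-∅⁻ Γ (pair a b) e)))
          (proj₂ B v ∅ (lk-∅ buchsbaum⇒pure₃ v) 1 (λ e → case trans (sym (cong suc (Sub.∣⊥∣≡0 n))) (trans e (lk-dim buchsbaum⇒pure₃ v)) of λ ()))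
          S closed (link-∅⁺ Γ ⁅ y ⁆ ly) Sy (link-∅⁺ Γ ⁅ z ⁆ lz) ¬Sz
      where
      Γ = link Δ ⁅ v ⁆
      closed : ∀ {a b} → Adjacent (link Γ ∅) a b → S a ≡ S b
      closed {a} {b} (a≢b , e) with true-or-false (S a) | true-or-false (S b)
      ... | inj₁ Sa  | inj₁ Sb  = trans Sa (sym Sb)
      ... | inj₂ ¬Sa | inj₂ ¬Sb = trans ¬Sa (sym ¬Sb)
      ... | inj₁ Sa  | inj₂ ¬Sb = contradiction (a , b , (a≢b , link-∅⁻ Γ (pair a b) e) , Sa , ¬Sb) none
      ... | inj₂ ¬Sa | inj₁ Sb  = contradiction (b , a , (a≢b ∘ sym , trans (cong Γ (pair-comm b a)) (link-∅⁻ Γ (pair a b) e)) , Sb , ¬Sa) none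

-- Growing a complex by vertices

∈⇒lookup : {A : Subset n} → x ∈ A → Vec.lookup A x ≡ true
∈⇒lookup = Vec.[]=⇒lookup

lookup⇒∈ : (A : Subset n) (x : Fin n) → Vec.lookup A x ≡ true → x ∈ A
lookup⇒∈ A x = Vec.lookup⇒[]= x A

∉⇒lookup : (A : Subset n) (x : Fin n) → x ∉ A → Vec.lookup A x ≡ false
∉⇒lookup A x x∉A with true-or-false (Vec.lookup A x)
... | inj₁ e = contradiction (lookup⇒∈ A x e) x∉A
... | inj₂ e = e

lookup⇒∉ : {A : Subset n} → Vec.lookup A x ≡ false → x ∉ A
lookup⇒∉ e x∈A = true≢false (∈⇒lookup x∈A) e

∈-∪⁅⁆⁻ : {A : Subset n} → x ∈ A ∪ ⁅ w ⁆ → x ∈ A ⊎ x ≡ w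
∈-∪⁅⁆⁻ {w = w} {A} x∈ with Sub.x∈p∪q⁻ A ⁅ w ⁆ x∈
... | inj₁ x∈A = inj₁ x∈A
... | inj₂ x∈w = inj₂ (Sub.x∈⁅y⁆⇒x≡y w x∈w)

∈-∪⁅⁆ˡ : {A : Subset n} → x ∈ A → x ∈ A ∪ ⁅ w ⁆
∈-∪⁅⁆ˡ x∈A = Sub.x∈p∪q⁺ (inj₁ x∈A)

∈-∪⁅⁆ʳ : {A : Subset n} → w ∈ A ∪ ⁅ w ⁆
∈-∪⁅⁆ʳ {w = w} = Sub.x∈p∪q⁺ (inj₂ (Sub.x∈⁅x⁆ w))

remove : {U : Subset n} → w ∈ U → ∃[ U' ] (w ∉ U' × U ≡ U' ∪ ⁅ w ⁆)
remove {U = _ ∷ U} Vec.here = false ∷ U , (λ ()) , cong (true ∷_) (sym (Sub.∪-identityʳ U))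
remove {U = b ∷ U} (Vec.there w∈U) with remove w∈U
... | U' , w∉U' , refl = b ∷ U' , (λ { (Vec.there w∈) → w∉U' w∈ }) , cong (_∷ (U' ∪ _)) (sym (Bool.∨-identityʳ b))

∣A∣≡n⇒∈ : {A : Subset n} → n ≤ ∣ A ∣ → ∀ x → x ∈ A
∣A∣≡n⇒∈ {A = A} le x = subst (x ∈_) (sym (Sub.∣p∣≡n⇒p≡⊤ (ℕ.≤-antisym (Sub.∣p∣≤n A) le))) Sub.∈⊤

verts : FaceFamily n → Subset n
verts Γ = Vec.tabulate (Γ ∘ ⁅_⁆)

∈-verts⁺ : (Γ : FaceFamily n) → Γ ⁅ x ⁆ ≡ true → x ∈ verts Γ
∈-verts⁺ {x = x} Γ e = lookup⇒∈ (verts Γ) x (trans (Vec.lookup∘tabulate (Γ ∘ ⁅_⁆) x) e)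

∈-verts⁻ : (Γ : FaceFamily n) → x ∈ verts Γ → Γ ⁅ x ⁆ ≡ true
∈-verts⁻ {x = x} Γ x∈ = trans (sym (Vec.lookup∘tabulate (Γ ∘ ⁅_⁆) x)) (∈⇒lookup x∈)

cnt-verts : (Γ : FaceFamily n) → cnt Γ 1 ≡ ∣ verts Γ ∣
cnt-verts {zero}  Γ = refl
cnt-verts {suc n} Γ rewrite cnt₀ (Γ ∘ (true ∷_)) | cnt-verts (Γ ∘ (false ∷_)) with Γ (true ∷ ∅)
... | true  = ℕ.+-comm _ 1
... | false = ℕ.+-identityʳ _

cnt-positive : (Γ : FaceFamily n) {F : Subset n} → Γ F ≡ true → 1 ≤ cnt Γ ∣ F ∣
cnt-positive {n} Γ {F} ΓF = subst (_≤ cnt Γ ∣ F ∣)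
  (trans (cnt-add (λ _ → false) F refl) (cong suc (cnt-false n ∣ F ∣)))
  (cnt-mono ∣ F ∣ (λ G _ e → case add-inv (λ _ → false) F G e of λ { (inj₂ refl) → ΓF }))

↾⁻ : (Γ : FaceFamily n) (A : Subset n) {F : Subset n} → (Γ ↾ A) F ≡ true → F ⊆ A × Γ F ≡ true
↾⁻ Γ A {F} e with true∧ {F ⊆ᵇ A} e
... | p , q = ⊆ᵇ-sound {F = F} {A} p , q

↾⁺ : (Γ : FaceFamily n) (A : Subset n) {F : Subset n} → F ⊆ A → Γ F ≡ true → (Γ ↾ A) F ≡ true
↾⁺ Γ A F⊆A e = ∧true (⊆ᵇ-complete F⊆A) e

cnt-↾-mono : (Γ : FaceFamily n) {A B : Subset n} → A ⊆ B → ∀ s → cnt (Γ ↾ A) s ≤ cnt (Γ ↾ B) s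
cnt-↾-mono Γ {A} {B} A⊆B s = cnt-mono {Γ = Γ ↾ A} {Γ ↾ B} s (λ F _ e → case ↾⁻ Γ A {F} e of λ { (F⊆A , ΓF) → ↾⁺ Γ B (A⊆B ∘ F⊆A) ΓF })

cnt-↾-C : (Γ : FaceFamily n) (A : Subset n) (s : ℕ) → cnt (Γ ↾ A) s ≤ ∣ A ∣ C s
cnt-↾-C Γ A s = subst (cnt (Γ ↾ A) s ≤_) (cnt-⊆ᵇ A s) (cnt-mono {Γ = Γ ↾ A} {_⊆ᵇ A} s (λ F _ e → proj₁ (true∧ {F ⊆ᵇ A} e)))

cnt-↾-full : (Γ : FaceFamily n) {A : Subset n} → (∀ x → x ∈ A) → ∀ s → cnt (Γ ↾ A) s ≡ cnt Γ s
cnt-↾-full Γ {A} full s = cnt-cong {Γ = Γ ↾ A} {Γ} s (λ F → cong (_∧ Γ F) (⊆ᵇ-complete {F = F} {A} (λ {x} _ → full x)))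

module _ (Γ : FaceFamily n) (ends : ∀ {x y} → Γ (pair x y) ≡ true → Γ ⁅ y ⁆ ≡ true)
         (crossing : ∀ (S : Fin n → Bool) {y z} → Γ ⁅ y ⁆ ≡ true → S y ≡ true → Γ ⁅ z ⁆ ≡ true → S z ≡ false →
                     ∃₂ λ a b → Adjacent Γ a b × S a ≡ true × S b ≡ false) where

  private
    span : ∀ k (A : Subset n) {r} → r ∈ A → n ≤ ∣ A ∣ + k → Γ ⁅ r ⁆ ≡ true →
           ∣ A ∣ ≤ suc (cnt (Γ ↾ A) 2) → cnt Γ 1 ≤ suc (cnt Γ 2)
    span k A r∈A fuel Γr inv with Fin.any? (λ z → (Γ ⁅ z ⁆ Bool.≟ true) ×-dec ¬? (z Sub.∈? A))
    ... | no none = begin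
      cnt Γ 1                  ≡⟨ cnt-verts Γ ⟩
      ∣ verts Γ ∣              ≤⟨ Sub.p⊆q⇒∣p∣≤∣q∣ verts⊆A ⟩
      ∣ A ∣                    ≤⟨ inv ⟩
      suc (cnt (Γ ↾ A) 2)      ≤⟨ s≤s (cnt-mono {Γ = Γ ↾ A} {Γ} 2 (λ F _ e → proj₂ (↾⁻ Γ A {F} e))) ⟩
      suc (cnt Γ 2)            ∎
      where
      open ℕ.≤-Reasoning
      verts⊆A : verts Γ ⊆ A
      verts⊆A {z} z∈ = decidable-stable (z Sub.∈? A) (λ z∉A → none (z , ∈-verts⁻ Γ z∈ , z∉A))
    span zero A r∈A fuel Γr inv | yes (z , _ , z∉A) = contradiction (∣A∣≡n⇒∈ (subst (n ≤_) (ℕ.+-identityʳ _) fuel) z) z∉A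
    span (suc k) A r∈A fuel Γr inv | yes (z , Γz , z∉A)
      with crossing (Vec.lookup A) Γr (∈⇒lookup r∈A) Γz (∉⇒lookup A z z∉A)
    ... | a , b , (a≢b , Γab) , Sa , ¬Sb = span k (A ∪ ⁅ b ⁆) (∈-∪⁅⁆ˡ r∈A)
            (subst (n ≤_) (trans (ℕ.+-suc _ k) (cong (_+ k) (sym (∣∪⁅⁆∣ A b∉A)))) fuel) Γr
            (subst₂ _≤_ (trans (ℕ.+-comm _ 1) (sym (∣∪⁅⁆∣ A b∉A))) (cong suc (sym (cnt-↾-∪ Γ A b∉A 1))) (ℕ.+-mono-≤ inv edge))
      where
      b∉A = lookup⇒∉ ¬Sb
      edge : 1 ≤ cnt (link Γ ⁅ b ⁆ ↾ A) 1
      edge = subst (λ s → 1 ≤ cnt (link Γ ⁅ b ⁆ ↾ A) s) (Sub.∣⁅x⁆∣≡1 a)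
        (cnt-positive (link Γ ⁅ b ⁆ ↾ A) {⁅ a ⁆} (↾⁺ (link Γ ⁅ b ⁆) A {⁅ a ⁆} (⁅⁆-⊆ (lookup⇒∈ A a Sa))
          (link-vertex⁺ Γ a≢b (trans (cong Γ (pair-comm b a)) Γab))))

  connected-graph-bound : ∀ {r} → Γ ⁅ r ⁆ ≡ true → cnt Γ 1 ≤ suc (cnt Γ 2)
  connected-graph-bound {r} Γr = span n ⁅ r ⁆ (Sub.x∈⁅x⁆ r) (ℕ.m≤n+m n ∣ ⁅ r ⁆ ∣) Γr
    (ℕ.≤-trans (ℕ.≤-reflexive (Sub.∣⁅x⁆∣≡1 r)) (s≤s z≤n))

module _ (Δ : FaceFamily n) (P : Pure₃ Δ)
         (crossing : ∀ v (S : Fin n → Bool) {y z} → link Δ ⁅ v ⁆ ⁅ y ⁆ ≡ true → S y ≡ true →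
                     link Δ ⁅ v ⁆ ⁅ z ⁆ ≡ true → S z ≡ false →
                     ∃₂ λ a b → Adjacent (link Δ ⁅ v ⁆) a b × S a ≡ true × S b ≡ false) where

  open Pure₃ P

  triple-edge : ∀ {x y z} → Δ (triple x y z) ≡ true → Δ (pair x y) ≡ true
  triple-edge = down (pair-⊆ ∈-cons (∈-there ∈-cons))

  -- Sum over all vertices of the bound for the links.
  euler-bound : 2 * cnt Δ 2 ≤ 3 * cnt Δ 3 + n
  euler-bound = begin
    2 * cnt Δ 2                                        ≡⟨ ∑-cnt-link Δ 1 ⟨
    ∑ (λ v → cnt (link Δ ⁅ v ⁆) 1)                     ≤⟨ ∑-mono local ⟩
    ∑ (λ v → cnt (link Δ ⁅ v ⁆) 2 + 1)                 ≡⟨ ∑-+ (λ v → cnt (link Δ ⁅ v ⁆) 2) (λ _ → 1) ⟩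
    ∑ (λ v → cnt (link Δ ⁅ v ⁆) 2) + ∑ {n} (λ _ → 1)   ≡⟨ cong₂ _+_ (∑-cnt-link Δ 2) (∑-one n) ⟩
    3 * cnt Δ 3 + n                                    ∎
    where
    open ℕ.≤-Reasoning
    local : ∀ v → cnt (link Δ ⁅ v ⁆) 1 ≤ cnt (link Δ ⁅ v ⁆) 2 + 1
    local v with neighbour v
    ... | y , v≢y , Δvy = subst (cnt (link Δ ⁅ v ⁆) 1 ≤_) (ℕ.+-comm 1 _)
      (connected-graph-bound (link Δ ⁅ v ⁆)
        (λ {x} {z} e → case link-pair⁻ Δ e of λ { (_ , z≢v , Δvxz) →
            link-vertex⁺ Δ z≢v (triple-edge (trans (cong Δ (triple-swap v z x)) Δvxz)) })
        (crossing v) (link-vertex⁺ Δ (v≢y ∘ sym) Δvy))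

  nbrs : Fin n → Subset n → Subset n
  nbrs w A = verts (link Δ ⁅ w ⁆ ↾ A)

  deg : Fin n → Subset n → ℕ
  deg w A = ∣ nbrs w A ∣

  ∈-nbrs⁺ : ∀ {w y A} → y ∈ A → y ≢ w → Δ (pair w y) ≡ true → y ∈ nbrs w A
  ∈-nbrs⁺ {w} {y} {A} y∈A y≢w e = ∈-verts⁺ (link Δ ⁅ w ⁆ ↾ A) (↾⁺ (link Δ ⁅ w ⁆) A (⁅⁆-⊆ y∈A) (link-vertex⁺ Δ y≢w e))

  ∈-nbrs⁻ : ∀ {w y A} → y ∈ nbrs w A → y ∈ A × Δ (pair w y) ≡ true
  ∈-nbrs⁻ {w} {y} {A} y∈ with ↾⁻ (link Δ ⁅ w ⁆) A (∈-verts⁻ (link Δ ⁅ w ⁆ ↾ A) y∈)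
  ... | y⊆A , e = y⊆A (Sub.x∈⁅x⁆ y) , proj₂ (link-vertex⁻ Δ e)

  edges-in tris-in : Subset n → ℕ
  edges-in A = cnt (Δ ↾ A) 2
  tris-in A = cnt (Δ ↾ A) 3

  new-triangles : Fin n → Subset n → ℕ
  new-triangles w A = cnt (link Δ ⁅ w ⁆ ↾ A) 2

  edges-in-∪ : ∀ {A w} → w ∉ A → edges-in (A ∪ ⁅ w ⁆) ≡ edges-in A + deg w A
  edges-in-∪ {A} {w} w∉A = trans (cnt-↾-∪ Δ A w∉A 1) (cong (λ k → edges-in A + k) (cnt-verts (link Δ ⁅ w ⁆ ↾ A)))

  tris-in-∪ : ∀ {A w} → w ∉ A → tris-in (A ∪ ⁅ w ⁆) ≡ tris-in A + new-triangles w A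
  tris-in-∪ {A} w∉A = cnt-↾-∪ Δ A w∉A 2

  new-triangles-in-nbrs : ∀ w A → new-triangles w A ≤ edges-in (nbrs w A)
  new-triangles-in-nbrs w A = cnt-mono {Γ = link Δ ⁅ w ⁆ ↾ A} {Δ ↾ nbrs w A} 2 inside
    where
    inside : ∀ F → ∣ F ∣ ≡ 2 → (link Δ ⁅ w ⁆ ↾ A) F ≡ true → (Δ ↾ nbrs w A) F ≡ true
    inside F e F∈ with ∣F∣≡2⇒pair F e
    ... | y , z , y≢z , refl with ↾⁻ (link Δ ⁅ w ⁆) A F∈
    ...   | F⊆A , l with link-pair⁻ Δ l
    ...     | y≢w , z≢w , Δwyz = ↾⁺ Δ (nbrs w A)
      (pair-⊆ (∈-nbrs⁺ (F⊆A ∈-cons) y≢w (triple-edge Δwyz))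
              (∈-nbrs⁺ (F⊆A ∈-pairʳ) z≢w (triple-edge (trans (cong Δ (triple-swap w z y)) Δwyz))))
      (down ∈-there Δwyz)

  new-triangles-C : ∀ w A → new-triangles w A ≤ deg w A C 2
  new-triangles-C w A = ℕ.≤-trans (new-triangles-in-nbrs w A) (cnt-↾-C Δ (nbrs w A) 2)

  deg-mono : ∀ {w U A} → U ⊆ A → deg w U ≤ deg w A
  deg-mono {w} {U} {A} U⊆A = subst₂ _≤_ (cnt-verts (link Δ ⁅ w ⁆ ↾ U)) (cnt-verts (link Δ ⁅ w ⁆ ↾ A))
    (cnt-↾-mono (link Δ ⁅ w ⁆) U⊆A 1)

  -- Bounds the triangles at a new vertex, which lie over edges among its neighbours.
  Sparse : Subset n → ℕ → Set
  Sparse A s = ∀ U → U ⊆ A → 2 ≤ ∣ U ∣ → edges-in U + 3 ≤ 2 * ∣ U ∣ + s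

  sparse-∪ : ∀ {A w s} x → w ∉ A → deg w A ≤ 2 + x → Sparse A s → Sparse (A ∪ ⁅ w ⁆) (s + x)
  sparse-∪ {A} {w} {s} x w∉A d≤ sparse U U⊆ 2≤U with w Sub.∈? U
  ... | no w∉U = ℕ.≤-trans (sparse U (λ {y} y∈U → case ∈-∪⁅⁆⁻ (U⊆ y∈U) of λ
                   { (inj₁ y∈A) → y∈A ; (inj₂ refl) → contradiction y∈U w∉U }) 2≤U)
                   (ℕ.+-monoʳ-≤ (2 * ∣ U ∣) (ℕ.m≤m+n s x))
  ... | yes w∈U with remove w∈U
  ...   | U' , w∉U' , refl rewrite ∣∪⁅⁆∣ U' w∉U' with ℕ.≤-<-connex 2 ∣ U' ∣
  ...     | inj₁ 2≤U' = begin
    edges-in (U' ∪ ⁅ w ⁆) + 3             ≡⟨ cong (_+ 3) (edges-in-∪ w∉U') ⟩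
    edges-in U' + deg w U' + 3            ≤⟨ ℕ.+-monoˡ-≤ 3 (ℕ.+-monoʳ-≤ (edges-in U') (ℕ.≤-trans (deg-mono U'⊆A) d≤)) ⟩
    edges-in U' + (2 + x) + 3             ≡⟨ arith₁ (edges-in U') x ⟩
    (edges-in U' + 3) + (2 + x)           ≤⟨ ℕ.+-monoˡ-≤ (2 + x) (sparse U' U'⊆A 2≤U') ⟩
    (2 * ∣ U' ∣ + s) + (2 + x)     ≡⟨ arith₂ ∣ U' ∣ s x ⟩
    2 * suc ∣ U' ∣ + (s + x)       ∎
    where
    open ℕ.≤-Reasoning
    arith₁ : ∀ (e x : ℕ) → e + (2 + x) + 3 ≡ (e + 3) + (2 + x)
    arith₁ = solve-∀
    arith₂ : ∀ (u s x : ℕ) → (2 * u + s) + (2 + x) ≡ 2 * (1 + u) + (s + x)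
    arith₂ = solve-∀
    U'⊆A : U' ⊆ A
    U'⊆A y∈U' = case ∈-∪⁅⁆⁻ (U⊆ (∈-∪⁅⁆ˡ y∈U')) of λ
      { (inj₁ y∈A) → y∈A ; (inj₂ refl) → contradiction y∈U' w∉U' }
  ...     | inj₂ (s≤s U'≤1) = begin
    edges-in (U' ∪ ⁅ w ⁆) + 3             ≤⟨ ℕ.+-monoˡ-≤ 3 (cnt-↾-C Δ (U' ∪ ⁅ w ⁆) 2) ⟩
    (∣ U' ∪ ⁅ w ⁆ ∣ C 2) + 3       ≡⟨ cong (λ u → (u C 2) + 3) (trans (∣∪⁅⁆∣ U' w∉U') (cong suc U'≡1)) ⟩
    4                              ≤⟨ ℕ.m≤m+n 4 (s + x) ⟩
    2 * 2 + (s + x)                ≡⟨ cong (λ u → 2 * suc u + (s + x)) (sym U'≡1) ⟩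
    2 * suc ∣ U' ∣ + (s + x)       ∎
    where
    open ℕ.≤-Reasoning
    U'≡1 : ∣ U' ∣ ≡ 1
    U'≡1 = ℕ.≤-antisym U'≤1 (ℕ.≤-pred 2≤U)

  -- c components; m vertices beyond three for each of them; s edges beyond the three
  -- of the first triangle and the two that attach each of the m vertices.
  record Counts (A : Subset n) (c m s : ℕ) : Set where
    field
      size   : ∣ A ∣ ≡ 3 * c + m
      edges  : edges-in A ≡ 3 * c + 2 * m + s
      tris   : tris-in A ≤ c + m + s + s ^⟨ 2 ⟩
      bound  : s ≤ tri m
      sparse : Sparse A s

  Closed : Subset n → Set
  Closed A = ∀ {x y} → x ∈ A → y ∉ A → Δ (pair x y) ≡ true → ⊥

  record Growing (A B : Subset n) (c m s : ℕ) : Set where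
    field
      counts    : Counts A c m s
      B⊆A       : B ⊆ A
      B-size    : ∣ B ∣ ≤ m + 3
      frontier  : ∀ {x y} → x ∈ A → y ∉ A → Δ (pair x y) ≡ true → x ∈ B
      separated : ∀ {x y} → x ∈ A → y ∈ B → Δ (pair x y) ≡ true → x ∈ B
      matched   : ∀ {x} → x ∈ B → ∃[ y ] (y ∈ B × y ≢ x × Δ (pair x y) ≡ true)

  Enters : (A B : Subset n) → Fin n → Set
  Enters A B w = w ∉ A × ∃₂ λ y z → y ∈ B × z ∈ B × y ≢ z × Δ (pair w y) ≡ true × Δ (pair w z) ≡ true

  enters? : ∀ A B → Dec (∃ (Enters A B))
  enters? A B = Fin.any? λ w → ¬? (w Sub.∈? A) ×-dec Fin.any? λ y → Fin.any? λ z →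
      (y Sub.∈? B) ×-dec ((z Sub.∈? B) ×-dec (¬? (y Fin.≟ z) ×-dec ((Δ (pair w y) Bool.≟ true) ×-dec (Δ (pair w z) Bool.≟ true))))

  enter : ∀ {A B c m s w} → Growing A B c m s → Enters A B w →
          ∃[ s' ] Growing (A ∪ ⁅ w ⁆) (B ∪ ⁅ w ⁆) c (suc m) s'
  enter {A} {B} {c} {m} {s} {w} g (w∉A , y , z , y∈B , z∈B , y≢z , Δwy , Δwz) with ≤-diff two-nbrs
    where
    open Growing g
    ≢w : ∀ {y} → y ∈ B → y ≢ w
    ≢w y∈B refl = w∉A (B⊆A y∈B)
    two-nbrs : 2 ≤ deg w A
    two-nbrs = subst (_≤ deg w A) (∣pair∣ y≢z)
      (Sub.p⊆q⇒∣p∣≤∣q∣ (pair-⊆ (∈-nbrs⁺ (B⊆A y∈B) (≢w y∈B) Δwy) (∈-nbrs⁺ (B⊆A z∈B) (≢w z∈B) Δwz)))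
  ... | x , 2+x≡deg = s + x , record
    { counts = record
      { size   = trans (∣∪⁅⁆∣ A w∉A) (trans (cong suc size) (sym (ℕ.+-suc _ m)))
      ; edges  = trans (edges-in-∪ w∉A) (trans (cong₂ _+_ edges (sym 2+x≡deg)) (arith₁ c m s x))
      ; tris   = tris'
      ; bound  = ℕ.≤-trans (ℕ.+-mono-≤ bound x≤) (ℕ.≤-reflexive (ℕ.+-comm (tri m) (suc m)))
      ; sparse = sparse-∪ x w∉A (ℕ.≤-reflexive (sym 2+x≡deg)) sparse
      }
    ; B⊆A = λ y∈ → case ∈-∪⁅⁆⁻ y∈ of λ { (inj₁ y∈B) → ∈-∪⁅⁆ˡ (B⊆A y∈B) ; (inj₂ refl) → ∈-∪⁅⁆ʳ }
    ; B-size = subst (_≤ suc m + 3) (sym (∣∪⁅⁆∣ B (w∉A ∘ B⊆A))) (s≤s B-size)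
    ; frontier = λ x∈ y∉ e → case ∈-∪⁅⁆⁻ x∈ of λ
        { (inj₁ x∈A) → ∈-∪⁅⁆ˡ (frontier x∈A (y∉ ∘ ∈-∪⁅⁆ˡ) e) ; (inj₂ refl) → ∈-∪⁅⁆ʳ }
    ; separated = λ x∈ y∈ e → case (∈-∪⁅⁆⁻ x∈ , ∈-∪⁅⁆⁻ y∈) of λ
        { (inj₁ x∈A , inj₁ y∈B) → ∈-∪⁅⁆ˡ (separated x∈A y∈B e)
        ; (inj₁ x∈A , inj₂ refl) → ∈-∪⁅⁆ˡ (frontier x∈A w∉A e)
        ; (inj₂ refl , _) → ∈-∪⁅⁆ʳ }
    ; matched = λ x∈ → case ∈-∪⁅⁆⁻ x∈ of λ
        { (inj₁ x∈B) → case matched x∈B of λ { (y , y∈B , y≢x , e) → y , ∈-∪⁅⁆ˡ y∈B , y≢x , e }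
        ; (inj₂ refl) → y , ∈-∪⁅⁆ˡ y∈B , (λ { refl → w∉A (B⊆A y∈B) }) , Δwy }
    }
    where
    open Growing g
    open Counts counts
    arith₁ : ∀ (c m s x : ℕ) → (3 * c + 2 * m + s) + (2 + x) ≡ 3 * c + 2 * (1 + m) + (s + x)
    arith₁ = solve-∀
    nbrs⊆B : nbrs w A ⊆ B
    nbrs⊆B {v} v∈ with ∈-nbrs⁻ v∈
    ... | v∈A , Δwv = frontier v∈A w∉A (trans (cong Δ (pair-comm v w)) Δwv)
    x≤ : x ≤ suc m
    x≤ = ℕ.+-cancelˡ-≤ 2 x (suc m) (subst₂ _≤_ (sym 2+x≡deg) (ℕ.+-comm m 3) (ℕ.≤-trans (Sub.p⊆q⇒∣p∣≤∣q∣ nbrs⊆B) B-size))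
    new = new-triangles w A
    new≤tri : new ≤ suc x + tri x
    new≤tri = subst (new ≤_) (trans (cong (_C 2) (sym 2+x≡deg)) ([1+n]C2≡tri (suc x))) (new-triangles-C w A)
    new≤s : new ≤ suc x + (s + x)
    new≤s = ℕ.+-cancelʳ-≤ 3 new (suc x + (s + x)) (ℕ.≤-trans (ℕ.+-monoˡ-≤ 3 (new-triangles-in-nbrs w A))
      (subst (edges-in (nbrs w A) + 3 ≤_) (trans (cong (λ d → 2 * d + s) (sym 2+x≡deg)) (arith x s))
        (sparse (nbrs w A) (B⊆A ∘ nbrs⊆B) (subst (2 ≤_) 2+x≡deg (ℕ.m≤m+n 2 x)))))
      where
      arith : ∀ (x s : ℕ) → 2 * (2 + x) + s ≡ (1 + x) + (s + x) + 3
      arith = solve-∀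
    excess = new ∸ suc x
    new≤excess : new ≤ suc x + excess
    new≤excess = ℕ.m≤n+m∸n new (suc x)
    tris' : tris-in (A ∪ ⁅ w ⁆) ≤ c + suc m + (s + x) + (s + x) ^⟨ 2 ⟩
    tris' = begin
      tris-in (A ∪ ⁅ w ⁆)                                 ≡⟨ tris-in-∪ w∉A ⟩
      tris-in A + new                                     ≤⟨ ℕ.+-mono-≤ tris new≤excess ⟩
      c + m + s + s ^⟨ 2 ⟩ + (suc x + excess)       ≡⟨ arith c m s (s ^⟨ 2 ⟩) x excess ⟩
      c + suc m + (s + x) + (s ^⟨ 2 ⟩ + excess)     ≤⟨ ℕ.+-monoʳ-≤ (c + suc m + (s + x)) (^⟨2⟩-gain s x excess
                                                         (ℕ.m≤n+o⇒m∸n≤o new (suc x) new≤tri) (ℕ.m≤n+o⇒m∸n≤o new (suc x) new≤s)) ⟩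
      c + suc m + (s + x) + (s + x) ^⟨ 2 ⟩          ∎
      where
      open ℕ.≤-Reasoning
      arith : ∀ (c m s g x y : ℕ) → c + m + s + g + ((1 + x) + y) ≡ c + (1 + m) + (s + x) + (g + y)
      arith = solve-∀

  component-closed : ∀ {A B c m s} → Growing A B c m s → ¬ ∃ (Enters A B) → Closed A
  component-closed {A} {B} g none {x} {y} x∈A y∉A Δxy with Growing.frontier g x∈A y∉A Δxy
  ... | x∈B with Growing.matched g x∈B
  ... | b , b∈B , b≢x , Δxb with crossing x (Vec.lookup B) (link-vertex⁺ Δ b≢x Δxb) (∈⇒lookup b∈B)
                                 (link-vertex⁺ Δ (λ { refl → y∉A x∈A }) Δxy) (∉⇒lookup B y (y∉A ∘ Growing.B⊆A g))
  ... | a , w , (a≢w , law) , Sa , ¬Sw with link-pair⁻ Δ law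
  ... | a≢x , w≢x , Δxaw = ⊥-elim (none (w , w∉A , x , a , x∈B , lookup⇒∈ B a Sa , a≢x ∘ sym , Δwx , Δwa))
    where
    Δwx : Δ (pair w x) ≡ true
    Δwx = triple-edge (trans (cong Δ (triple-rot w x a)) Δxaw)
    Δwa : Δ (pair w a) ≡ true
    Δwa = triple-edge (trans (cong Δ (trans (triple-swap w a x) (triple-rot w x a))) Δxaw)
    w∉A : w ∉ A
    w∉A w∈A = lookup⇒∉ ¬Sw (Growing.separated g w∈A x∈B Δwx)

  start : ∀ {A c m s w} → Counts A c m s → Closed A → w ∉ A →
          ∃₂ λ A' B → ∣ A' ∣ ≡ 3 + ∣ A ∣ × Growing A' B (suc c) m s
  start {A} {c} {m} {s} {u} k closed u∉A with vertex-triangle u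
  ... | v , w , u≢v , u≢w , v≢w , Δuvw = A₃ , B , size₃ , record
    { counts = record
      { size   = trans size₃ (trans (cong (λ k → 3 + k) size) (arith₀ c m))
      ; edges  = trans (edges-in-∪ w∉A₂) (trans (cong₂ _+_ (trans (edges-in-∪ v∉A₁) (cong₂ _+_ (trans (edges-in-∪ u∉A) (cong₂ _+_ edges deg-u)) deg-v)) deg-w)
                   (arith₁ c m s))
      ; tris   = tris'
      ; bound  = bound
      ; sparse = subst (Sparse A₃) (ℕ.+-identityʳ s)
                   (sparse-∪ 0 w∉A₂ (ℕ.≤-reflexive deg-w) (subst (Sparse A₂) (ℕ.+-identityʳ s)
                   (sparse-∪ 0 v∉A₁ (ℕ.≤-trans (ℕ.≤-reflexive deg-v) (s≤s z≤n)) (subst (Sparse A₁) (ℕ.+-identityʳ s)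
                   (sparse-∪ 0 u∉A (ℕ.≤-trans (ℕ.≤-reflexive deg-u) z≤n) sparse)))))
      }
    ; B⊆A = ∪-⊆ u∈A₃ (pair-⊆ v∈A₃ w∈A₃)
    ; B-size = subst (_≤ m + 3) (sym (∣triple∣ u≢v u≢w v≢w)) (ℕ.m≤n+m 3 m)
    ; frontier = λ x∈ y∉ e → case x∈A₃⁻ x∈ of λ
        { (inj₁ x∈A) → ⊥-elim (closed x∈A (y∉ ∘ ∈-∪⁅⁆ˡ ∘ ∈-∪⁅⁆ˡ ∘ ∈-∪⁅⁆ˡ) e) ; (inj₂ x∈B) → x∈B }
    ; separated = λ x∈ y∈B e → case x∈A₃⁻ x∈ of λ
        { (inj₁ x∈A) → ⊥-elim (closed x∈A (B∩A y∈B) e) ; (inj₂ x∈B) → x∈B }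
    ; matched = λ x∈B → case ∈-triple⁻ x∈B of λ
        { (inj₁ refl) → v , ∈-there ∈-cons , (u≢v ∘ sym) , Δuv
        ; (inj₂ (inj₁ refl)) → u , ∈-cons , u≢v , trans (cong Δ (pair-comm v u)) Δuv
        ; (inj₂ (inj₂ refl)) → u , ∈-cons , u≢w , trans (cong Δ (pair-comm w u)) Δuw }
    }
    where
    open Counts k
    Δuv : Δ (pair u v) ≡ true
    Δuv = triple-edge Δuvw
    Δuw : Δ (pair u w) ≡ true
    Δuw = triple-edge (trans (cong Δ (triple-swap u w v)) Δuvw)
    Δvw : Δ (pair v w) ≡ true
    Δvw = down ∈-there Δuvw
    A₁ = A ∪ ⁅ u ⁆
    A₂ = A₁ ∪ ⁅ v ⁆
    A₃ = A₂ ∪ ⁅ w ⁆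
    B = triple u v w
    outside : ∀ {x} → Δ (pair u x) ≡ true → x ∉ A
    outside {x} e x∈A = closed x∈A u∉A (trans (cong Δ (pair-comm x u)) e)
    v∉A = outside Δuv
    w∉A = outside Δuw
    v∉A₁ : v ∉ A₁
    v∉A₁ v∈ = case ∈-∪⁅⁆⁻ v∈ of λ { (inj₁ v∈A) → v∉A v∈A ; (inj₂ refl) → u≢v refl }
    w∉A₂ : w ∉ A₂
    w∉A₂ w∈ = case ∈-∪⁅⁆⁻ w∈ of λ
      { (inj₁ w∈A₁) → case ∈-∪⁅⁆⁻ w∈A₁ of λ { (inj₁ w∈A) → w∉A w∈A ; (inj₂ refl) → u≢w refl }
      ; (inj₂ refl) → v≢w refl }
    u∈A₃ = ∈-∪⁅⁆ˡ {w = w} (∈-∪⁅⁆ˡ {w = v} (∈-∪⁅⁆ʳ {w = u} {A = A}))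
    v∈A₃ = ∈-∪⁅⁆ˡ {w = w} (∈-∪⁅⁆ʳ {w = v} {A = A₁})
    w∈A₃ = ∈-∪⁅⁆ʳ {w = w} {A = A₂}
    x∈A₃⁻ : ∀ {x} → x ∈ A₃ → x ∈ A ⊎ x ∈ B
    x∈A₃⁻ x∈ with ∈-∪⁅⁆⁻ x∈
    ... | inj₂ refl = inj₂ (∈-there ∈-pairʳ)
    ... | inj₁ x∈A₂ with ∈-∪⁅⁆⁻ x∈A₂
    ...   | inj₂ refl = inj₂ (∈-there ∈-cons)
    ...   | inj₁ x∈A₁ with ∈-∪⁅⁆⁻ x∈A₁
    ...     | inj₂ refl = inj₂ ∈-cons
    ...     | inj₁ x∈A  = inj₁ x∈A
    B∩A : ∀ {x} → x ∈ B → x ∉ A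
    B∩A x∈B = case ∈-triple⁻ x∈B of λ
      { (inj₁ refl) → u∉A ; (inj₂ (inj₁ refl)) → v∉A ; (inj₂ (inj₂ refl)) → w∉A }
    size₃ : ∣ A₃ ∣ ≡ 3 + ∣ A ∣
    size₃ = trans (∣∪⁅⁆∣ A₂ w∉A₂) (cong suc (trans (∣∪⁅⁆∣ A₁ v∉A₁) (cong suc (∣∪⁅⁆∣ A u∉A))))
    no-nbr : ∀ {x y} → x ∉ A → y ∈ A → ¬ (Δ (pair x y) ≡ true)
    no-nbr {x} {y} x∉A y∈A e = closed y∈A x∉A (trans (cong Δ (pair-comm y x)) e)
    deg-u : deg u A ≡ 0
    deg-u = trans (cong ∣_∣ (Sub.Empty-unique {p = nbrs u A} λ { (y , y∈) → case ∈-nbrs⁻ {u} {y} {A} y∈ of λ { (y∈A , e) → no-nbr u∉A y∈A e } })) (Sub.∣⊥∣≡0 n)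
    deg-v : deg v A₁ ≡ 1
    deg-v = trans (cong ∣_∣ (Sub.⊆-antisym {i = nbrs v A₁} {j = ⁅ u ⁆}
      (λ {y} y∈ → case ∈-nbrs⁻ {v} {y} {A₁} y∈ of λ { (y∈A₁ , e) → case ∈-∪⁅⁆⁻ y∈A₁ of λ
        { (inj₁ y∈A) → ⊥-elim (no-nbr v∉A y∈A e) ; (inj₂ refl) → Sub.x∈⁅x⁆ u } })
      (⁅⁆-⊆ (∈-nbrs⁺ ∈-∪⁅⁆ʳ u≢v (trans (cong Δ (pair-comm v u)) Δuv))))) (Sub.∣⁅x⁆∣≡1 u)
    deg-w : deg w A₂ ≡ 2
    deg-w = trans (cong ∣_∣ (Sub.⊆-antisym {i = nbrs w A₂} {j = pair u v}
      (λ {y} y∈ → case ∈-nbrs⁻ {w} {y} {A₂} y∈ of λ { (y∈A₂ , e) → case ∈-∪⁅⁆⁻ y∈A₂ of λ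
        { (inj₂ refl) → ∈-pairʳ
        ; (inj₁ y∈A₁) → case ∈-∪⁅⁆⁻ y∈A₁ of λ
          { (inj₁ y∈A) → ⊥-elim (no-nbr w∉A y∈A e) ; (inj₂ refl) → ∈-cons } } })
      (pair-⊆ (∈-nbrs⁺ (∈-∪⁅⁆ˡ ∈-∪⁅⁆ʳ) u≢w (trans (cong Δ (pair-comm w u)) Δuw))
              (∈-nbrs⁺ ∈-∪⁅⁆ʳ v≢w (trans (cong Δ (pair-comm w v)) Δvw))))) (∣pair∣ u≢v)
    arith₀ : ∀ (c m : ℕ) → 3 + (3 * c + m) ≡ 3 * (1 + c) + m
    arith₀ = solve-∀
    arith₁ : ∀ (c m s : ℕ) → 3 * c + 2 * m + s + 0 + 1 + 2 ≡ 3 * (1 + c) + 2 * m + s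
    arith₁ = solve-∀
    new≤ : ∀ {d} x X → deg x X ≡ d → new-triangles x X ≤ d C 2
    new≤ x X e = subst (λ d → new-triangles x X ≤ d C 2) e (new-triangles-C x X)
    tris' : tris-in A₃ ≤ suc c + m + s + s ^⟨ 2 ⟩
    tris' = begin
      tris-in A₃                                                                   ≡⟨ trans (tris-in-∪ w∉A₂) (cong (_+ new-triangles w A₂) (trans (tris-in-∪ v∉A₁) (cong (_+ new-triangles v A₁) (tris-in-∪ u∉A)))) ⟩
      tris-in A + new-triangles u A + new-triangles v A₁ + new-triangles w A₂      ≤⟨ ℕ.+-mono-≤ (ℕ.+-mono-≤ (ℕ.+-mono-≤ tris (new≤ u A deg-u)) (new≤ v A₁ deg-v)) (new≤ w A₂ deg-w) ⟩
      c + m + s + s ^⟨ 2 ⟩ + 0 + 0 + 1                                       ≡⟨ arith c m s (s ^⟨ 2 ⟩) ⟩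
      suc c + m + s + s ^⟨ 2 ⟩                                               ∎
      where
      open ℕ.≤-Reasoning
      arith : ∀ (c m s g : ℕ) → c + m + s + g + 0 + 0 + 1 ≡ (1 + c) + m + s + g
      arith = solve-∀

  record Decomposition : Set where
    field
      extra h₁ h₂ : ℕ
      size    : n ≡ 3 * suc extra + h₁
      edges   : cnt Δ 2 ≡ 3 * suc extra + 2 * h₁ + h₂
      tris    : cnt Δ 3 ≤ suc extra + h₁ + h₂ + h₂ ^⟨ 2 ⟩
      bound   : h₂ ≤ tri h₁

  private
    step-fuel : ∀ {A A' : Subset n} {k} → n ≤ ∣ A ∣ + suc k → suc ∣ A ∣ ≤ ∣ A' ∣ → n ≤ ∣ A' ∣ + k
    step-fuel {A} {A'} {k} fuel le = ℕ.≤-trans fuel (ℕ.≤-trans (ℕ.≤-reflexive (ℕ.+-suc ∣ A ∣ k)) (ℕ.+-monoˡ-≤ k le))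

    exhausted : ∀ {A : Subset n} → n ≤ ∣ A ∣ + 0 → ∀ {w} → w ∈ A
    exhausted {A} fuel {w} = ∣A∣≡n⇒∈ (subst (n ≤_) (ℕ.+-identityʳ ∣ A ∣) fuel) w

    run-open   : ∀ k {A B c m s} → n ≤ ∣ A ∣ + k → Growing A B (suc c) m s → Decomposition
    run-closed : ∀ k {A c m s} → n ≤ ∣ A ∣ + k → Counts A (suc c) m s → Closed A → Decomposition

    run-open k {A} {B} fuel g with enters? A B
    ... | no none = run-closed k fuel (Growing.counts g) (component-closed g none)
    run-open zero    fuel g | yes (w , ent) = contradiction (exhausted fuel) (proj₁ ent)
    run-open (suc k) {A} fuel g | yes (w , ent) =
      run-open k (step-fuel {A} {A ∪ ⁅ w ⁆} fuel (ℕ.≤-reflexive (sym (∣∪⁅⁆∣ A (proj₁ ent))))) (proj₂ (enter g ent))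

    run-closed k {A} {c} {m} {s} fuel counts closed with Fin.any? (λ w → ¬? (w Sub.∈? A))
    ... | no none = record
      { extra = c ; h₁ = m ; h₂ = s
      ; size  = trans (sym (trans (cong ∣_∣ A≡⊤) (Sub.∣⊤∣≡n n))) (Counts.size counts)
      ; edges = trans (sym (cnt-↾-full Δ {A} full 2)) (Counts.edges counts)
      ; tris  = subst (_≤ _) (cnt-↾-full Δ {A} full 3) (Counts.tris counts)
      ; bound = Counts.bound counts }
      where
      full : ∀ x → x ∈ A
      full x = decidable-stable (x Sub.∈? A) (λ x∉A → none (x , x∉A))
      A≡⊤ : A ≡ ⊤
      A≡⊤ = Sub.⊆-antisym Sub.⊆⊤ (λ {x} _ → full x)
    run-closed zero    fuel counts closed | yes (w , w∉A) = contradiction (exhausted fuel) w∉A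
    run-closed (suc k) {A} fuel counts closed | yes (w , w∉A) with start counts closed w∉A
    ... | A' , B , size' , g = run-open k (step-fuel {A} {A'} fuel (subst (suc ∣ A ∣ ≤_) (sym size') (s≤s (ℕ.m≤n+m ∣ A ∣ 2)))) g

  decompose : Fin n → Decomposition
  decompose w with start {∅} {0} {0} {0} {w} counts (λ x∈∅ → contradiction x∈∅ Sub.∉⊥) Sub.∉⊥
    where
    empty : ∀ s → cnt (Δ ↾ ∅) (suc s) ≡ 0
    empty s = cnt-none (suc s) λ F e → case true-or-false ((Δ ↾ ∅) F) of λ
      { (inj₂ f) → f
      ; (inj₁ t) → contradiction (subst₂ _≤_ e (Sub.∣⊥∣≡0 n) (Sub.p⊆q⇒∣p∣≤∣q∣ (proj₁ (↾⁻ Δ ∅ {F} t)))) λ () }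
    counts : Counts ∅ 0 0 0
    counts = record
      { size = Sub.∣⊥∣≡0 n ; edges = empty 1 ; tris = ℕ.≤-reflexive (empty 2) ; bound = z≤n
      ; sparse = λ U U⊆∅ 2≤U → contradiction (ℕ.≤-trans 2≤U (ℕ.≤-trans (Sub.p⊆q⇒∣p∣≤∣q∣ U⊆∅) (ℕ.≤-reflexive (Sub.∣⊥∣≡0 n)))) λ () }
  ... | A' , B , _ , g = run-open n (ℕ.m≤n+m n ∣ A' ∣) g

-- Attaching vertices

record Tame (Δ : FaceFamily n) : Set where
  field
    simplicial : IsSimplicialComplex Δ
    small      : ∀ {F} → Δ F ≡ true → ∣ F ∣ ≤ 3
    connected  : ∀ v → Connected (link Δ ⁅ v ⁆)

  down : ∀ {F G} → G ⊆ F → Δ F ≡ true → Δ G ≡ true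
  down {F} {G} = proj₂ simplicial F G

  empty-face : Fin n → Δ ∅ ≡ true
  empty-face v = down Sub.⊥⊆ (proj₁ simplicial v)

  no-edge⇒no-triangle : ∀ {x y z} → Δ (pair x y) ≡ false → Δ (triple x y z) ≡ false
  no-edge⇒no-triangle {x} {y} {z} e with true-or-false (Δ (triple x y z))
  ... | inj₁ t = true≢false (down (pair-⊆ ∈-cons (∈-there ∈-cons)) t) e
  ... | inj₂ f = f

module _ {Δ : FaceFamily n} (tame : Tame Δ) where
  open Tame tame

  -- A walk from y to z in the connected link of x starts with such a triangle.
  edge-in-triangle : ∀ {x y z} → x ≢ y → Δ (pair x y) ≡ true → x ≢ z → y ≢ z → Δ (pair x z) ≡ true →
                     ∃[ w ] (x ≢ w × y ≢ w × Δ (triple x y w) ≡ true)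
  edge-in-triangle {x} {y} {z} x≢y Δxy x≢z y≢z Δxz with connected x
  ... | r , walk with y Fin.≟ r
  ...   | yes refl with Star-last (y≢z ∘ sym) (walk (link-vertex⁺ Δ (x≢z ∘ sym) Δxz))
  ...     | w , w≢y , l with link-pair⁻ Δ l
  ...       | w≢x , _ , Δxwy = w , w≢x ∘ sym , w≢y ∘ sym , trans (cong Δ (triple-swap x y w)) Δxwy
  edge-in-triangle {x} {y} {z} x≢y Δxy x≢z y≢z Δxz | r , walk | no y≢r with walk (link-vertex⁺ Δ (x≢y ∘ sym) Δxy)
  ... | ε = contradiction refl y≢r
  ... | _◅_ {j = w} (y≢w , l) _ with link-pair⁻ Δ l
  ...   | _ , w≢x , Δxyw = w , w≢x ∘ sym , y≢w , Δxyw

  tame⇒pure₃ : (∀ x → ∃₂ λ y z → x ≢ y × x ≢ z × y ≢ z × Δ (pair x y) ≡ true × Δ (pair x z) ≡ true) → Pure₃ Δ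
  tame⇒pure₃ nbrs₂ = record
    { simplicial = simplicial
    ; small      = small
    ; neighbour  = λ x → case nbrs₂ x of λ { (y , _ , x≢y , _ , _ , Δxy , _) → y , x≢y , Δxy }
    ; triangle   = λ {x} {y} x≢y Δxy → case nbrs₂ x of λ { (u , v , x≢u , x≢v , u≢v , Δxu , Δxv) → case y Fin.≟ u of λ
        { (yes refl) → edge-in-triangle x≢y Δxy x≢v u≢v Δxv
        ; (no y≢u)   → edge-in-triangle x≢y Δxy x≢u y≢u Δxu } }
    }

ext : FaceFamily n → FaceFamily n → FaceFamily (suc n)
ext Δ L (false ∷ F) = Δ F
ext Δ L (true ∷ F)  = L F

ext-spoke : (Δ L : FaceFamily n) (y : Fin n) → ext Δ L (pair zero (suc y)) ≡ L ⁅ y ⁆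
ext-spoke Δ L y = cong L (Sub.∪-identityˡ ⁅ y ⁆)

-- L is a possible link of a new vertex.  By anchored, the new vertex appears in the link of an old
-- vertex v next to an old neighbour of v, unless v had none.
record Attachable (Δ L : FaceFamily n) : Set where
  field
    empty     : L ∅ ≡ true
    closed    : ∀ {F G} → G ⊆ F → L F ≡ true → L G ≡ true
    inside    : ∀ {F} → L F ≡ true → Δ F ≡ true
    graph     : ∀ {F} → L F ≡ true → ∣ F ∣ ≤ 2
    connected : Connected L
    anchored  : ∀ {v} → L ⁅ v ⁆ ≡ true → (∃[ y ] (v ≢ y × L (pair v y) ≡ true)) ⊎ (∀ {y} → v ≢ y → Δ (pair v y) ≡ false)

ext-tame : {Δ L : FaceFamily n} → Tame Δ → Attachable Δ L → Tame (ext Δ L)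
ext-tame {n} {Δ} {L} tame att = record
  { simplicial = (λ { zero → empty ; (suc i) → proj₁ simplicial i }) , down′
  ; small      = λ { {false ∷ F} e → small e ; {true ∷ F} e → s≤s (graph e) }
  ; connected  = connected′
  }
  where
  open Tame tame using (simplicial; small; down) renaming (connected to Δ-connected)
  open Attachable att
  down′ : ∀ F G → G ⊆ F → ext Δ L F ≡ true → ext Δ L G ≡ true
  down′ (false ∷ F) (false ∷ G) G⊆F e = down (Sub.drop-∷-⊆ G⊆F) e
  down′ (true ∷ F)  (false ∷ G) G⊆F e = down (Sub.drop-∷-⊆ G⊆F) (inside e)
  down′ (true ∷ F)  (true ∷ G)  G⊆F e = closed (Sub.drop-∷-⊆ G⊆F) e
  down′ (false ∷ F) (true ∷ G)  G⊆F e = case G⊆F Vec.here of λ ()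
  connected′ : ∀ v → Connected (link (ext Δ L) ⁅ v ⁆)
  connected′ zero with connected
  ... | r , walk = suc r , λ { {zero} e → case proj₁ (link-vertex⁻ (ext Δ L) {zero} {zero} e) refl of λ ()
                             ; {suc y} e → Star.gmap suc step (walk (trans (sym (link-zero (ext Δ L) ⁅ y ⁆)) e)) }
    where
    step : ∀ {a b} → Adjacent L a b → Adjacent (link (ext Δ L) ⁅ zero ⁆) (suc a) (suc b)
    step {a} {b} (a≢b , e) = a≢b ∘ Fin.suc-injective , trans (link-zero (ext Δ L) (pair a b)) e
  connected′ (suc v) with Δ-connected v
  ... | r , walk = attach (true-or-false (L ⁅ v ⁆))
    where
    lifted : ∀ {a b} → Star (Adjacent (link Δ ⁅ v ⁆)) a b → Star (Adjacent (link (ext Δ L) ⁅ suc v ⁆)) (suc a) (suc b)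
    lifted = Star.gmap suc (λ { (a≢b , e) → a≢b ∘ Fin.suc-injective , e })
    spoke : link (ext Δ L) ⁅ suc v ⁆ ⁅ zero ⁆ ≡ true → L ⁅ v ⁆ ≡ true
    spoke e = trans (sym (ext-spoke Δ L v)) (trans (cong (ext Δ L) (pair-comm zero (suc v))) (proj₂ (link-vertex⁻ (ext Δ L) {suc v} {zero} e)))
    attach : L ⁅ v ⁆ ≡ true ⊎ L ⁅ v ⁆ ≡ false → Connected (link (ext Δ L) ⁅ suc v ⁆)
    attach (inj₂ ¬Lv) = suc r , λ { {zero} e → true≢false (spoke e) ¬Lv ; {suc y} e → lifted (walk e) }
    attach (inj₁ Lv) with anchored Lv
    ... | inj₂ isolated = zero , λ { {zero} e → ε
                                   ; {suc y} e → case link-vertex⁻ Δ {v} {y} e of λ { (y≢v , Δvy) → true≢false Δvy (isolated (y≢v ∘ sym)) } }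
    ... | inj₁ (y , v≢y , Lvy) = suc r , λ { {zero} e → first ◅ lifted (walk (link-vertex⁺ Δ (v≢y ∘ sym) (inside Lvy)))
                                           ; {suc y} e → lifted (walk e) }
      where
      first : Adjacent (link (ext Δ L) ⁅ suc v ⁆) zero (suc y)
      first = (λ ()) , trans (cong (link L ⁅ v ⁆) (Sub.∪-identityˡ ⁅ y ⁆)) (link-vertex⁺ L (v≢y ∘ sym) Lvy)

record Hubbed (Δ : FaceFamily n) : Set where
  field
    tame    : Tame Δ
    hub     : Fin n
    hub-adj : ∀ {y} → hub ≢ y → Δ (pair hub y) ≡ true
  open Tame tame public

third : (x y : Fin (suc (suc (suc n)))) → ∃[ z ] (x ≢ z × y ≢ z)
third zero          zero          = suc zero , (λ ()) , λ ()
third zero          (suc zero)    = suc (suc zero) , (λ ()) , λ ()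
third zero          (suc (suc y)) = suc zero , (λ ()) , λ ()
third (suc zero)    zero          = suc (suc zero) , (λ ()) , λ ()
third (suc (suc x)) zero          = suc zero , (λ ()) , λ ()
third (suc x)       (suc y)       = zero , (λ ()) , λ ()

hubbed⇒pure₃ : {Δ : FaceFamily (suc (suc (suc n)))} → Hubbed Δ → Pure₃ Δ
hubbed⇒pure₃ {n} {Δ} H = tame⇒pure₃ tame nbrs₂
  where
  open Hubbed H
  nbrs₂ : ∀ x → ∃₂ λ y z → x ≢ y × x ≢ z × y ≢ z × Δ (pair x y) ≡ true × Δ (pair x z) ≡ true
  nbrs₂ x with hub Fin.≟ x
  ... | yes refl with third x x
  ...   | y , x≢y , _ with third x y
  ...     | z , x≢z , y≢z = y , z , x≢y , x≢z , y≢z , hub-adj x≢y , hub-adj x≢z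
  nbrs₂ x | no hub≢x with third hub x
  ...   | y , hub≢y , x≢y with edge-in-triangle tame hub≢x (hub-adj hub≢x) hub≢y x≢y (hub-adj hub≢y)
  ...     | w , hub≢w , x≢w , e = hub , w , hub≢x ∘ sym , x≢w , hub≢w
            , trans (cong Δ (pair-comm x hub)) (hub-adj hub≢x) , down ∈-there e

ext-hubbed : {Δ L : FaceFamily n} (H : Hubbed Δ) → Attachable Δ L → L ⁅ Hubbed.hub H ⁆ ≡ true → Hubbed (ext Δ L)
ext-hubbed {Δ = Δ} {L} H att Lhub = record
  { tame    = ext-tame tame att
  ; hub     = suc hub
  ; hub-adj = λ { {zero} _ → trans (cong (ext Δ L) (pair-comm (suc hub) zero)) (trans (ext-spoke Δ L hub) Lhub)
                ; {suc y} hub≢y → hub-adj (hub≢y ∘ cong suc) }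
  }
  where open Hubbed H

edge-link : Fin n → Fin n → FaceFamily n
edge-link a b = _⊆ᵇ pair a b

edge-attachable : {Δ : FaceFamily n} → Tame Δ → ∀ {a b} → a ≢ b → Δ (pair a b) ≡ true → Attachable Δ (edge-link a b)
edge-attachable {Δ = Δ} tame {a} {b} a≢b Δab = record
  { empty     = ⊆ᵇ-complete {F = ∅} {pair a b} Sub.⊥⊆
  ; closed    = λ {F} {G} G⊆F e → ⊆ᵇ-complete {F = G} {pair a b} (⊆ᵇ-sound {F = F} {pair a b} e ∘ G⊆F)
  ; inside    = λ {F} e → Tame.down tame (⊆ᵇ-sound {F = F} {pair a b} e) Δab
  ; graph     = λ {F} e → subst (∣ F ∣ ≤_) (∣pair∣ a≢b) (Sub.p⊆q⇒∣p∣≤∣q∣ (⊆ᵇ-sound {F = F} {pair a b} e))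
  ; connected = a , λ {y} e → case end {y} e of λ
      { (inj₁ refl) → ε
      ; (inj₂ refl) → (a≢b ∘ sym , trans (cong (_⊆ᵇ pair a b) (pair-comm b a)) whole) ◅ ε }
  ; anchored  = λ {v} e → inj₁ (case end {v} e of λ
      { (inj₁ refl) → b , a≢b , whole
      ; (inj₂ refl) → a , a≢b ∘ sym , trans (cong (_⊆ᵇ pair a b) (pair-comm b a)) whole })
  }
  where
  whole : (pair a b ⊆ᵇ pair a b) ≡ true
  whole = ⊆ᵇ-complete {F = pair a b} {pair a b} id
  end : ∀ {y} → (⁅ y ⁆ ⊆ᵇ pair a b) ≡ true → y ≡ a ⊎ y ≡ b
  end {y} e = ∈-pair⁻ (⊆ᵇ-sound {F = ⁅ y ⁆} {pair a b} e (Sub.x∈⁅x⁆ y))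

-- A hubbed complex with h₂ = b and h₂ + h₃ = d.
record Realized (n b d : ℕ) : Set where
  field
    Δ      : FaceFamily n
    hubbed : Hubbed Δ
    edges  : cnt Δ 2 + 3 ≡ 2 * n + b
    tris   : cnt Δ 3 + 2 ≡ n + d

ext-realized : ∀ {n b d} x y (R : Realized n b d) {L : FaceFamily n} → Attachable (Realized.Δ R) L →
  L ⁅ Hubbed.hub (Realized.hubbed R) ⁆ ≡ true → cnt L 1 ≡ 2 + x → cnt L 2 ≡ 1 + y → Realized (suc n) (b + x) (d + y)
ext-realized {n} {b} {d} x y R {L} att Lhub verts edgs = record
  { Δ      = ext Δ L
  ; hubbed = ext-hubbed hubbed att Lhub
  ; edges  = trans (cong (λ k → cnt Δ 2 + k + 3) verts) (trans (arith₁ (cnt Δ 2) x) (trans (cong (_+ (2 + x)) edges) (arith₂ n b x)))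
  ; tris   = trans (cong (λ k → cnt Δ 3 + k + 2) edgs) (trans (arith₃ (cnt Δ 3) y) (trans (cong (_+ (1 + y)) tris) (arith₄ n d y)))
  }
  where
  open Realized R
  arith₁ : ∀ (e x : ℕ) → e + (2 + x) + 3 ≡ e + 3 + (2 + x)
  arith₁ = solve-∀
  arith₂ : ∀ (n b x : ℕ) → 2 * n + b + (2 + x) ≡ 2 * (1 + n) + (b + x)
  arith₂ = solve-∀
  arith₃ : ∀ (e y : ℕ) → e + (1 + y) + 2 ≡ e + 2 + (1 + y)
  arith₃ = solve-∀
  arith₄ : ∀ (n d y : ℕ) → n + d + (1 + y) ≡ (1 + n) + (d + y)
  arith₄ = solve-∀

cnt-edge-link : {a b : Fin n} → a ≢ b → ∀ s → cnt (edge-link a b) s ≡ 2 C s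
cnt-edge-link {a = a} {b} a≢b s = trans (cnt-⊆ᵇ (pair a b) s) (cong (_C s) (∣pair∣ a≢b))

cone-realized : ∀ {n b d} (R : Realized n b d) {y} → Hubbed.hub (Realized.hubbed R) ≢ y → Realized (suc n) b d
cone-realized {n} {b} {d} R {y} hub≢y = record
  { Δ      = ext Δ (edge-link hub y)
  ; hubbed = ext-hubbed hubbed (edge-attachable tame hub≢y (hub-adj hub≢y)) (⊆ᵇ-complete {F = ⁅ hub ⁆} {pair hub y} (⁅⁆-⊆ ∈-cons))
  ; edges  = trans (cong (λ k → cnt Δ 2 + k + 3) (cnt-edge-link hub≢y 1)) (trans (arith₁ (cnt Δ 2)) (trans (cong (λ k → 2 + k) edges) (arith₂ n b)))
  ; tris   = trans (cong (λ k → cnt Δ 3 + k + 2) (cnt-edge-link hub≢y 2)) (trans (arith₃ (cnt Δ 3)) (cong suc tris))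
  }
  where
  open Realized R
  open Hubbed hubbed
  arith₁ : ∀ (e : ℕ) → e + 2 + 3 ≡ 2 + (e + 3)
  arith₁ = solve-∀
  arith₂ : ∀ (n b : ℕ) → 2 + (2 * n + b) ≡ 2 * (1 + n) + b
  arith₂ = solve-∀
  arith₃ : ∀ (e : ℕ) → e + 1 + 2 ≡ 1 + (e + 2)
  arith₃ = solve-∀

other : 2 ≤ n → (x : Fin n) → ∃[ y ] x ≢ y
other (s≤s (s≤s _)) zero    = suc zero , λ ()
other (s≤s (s≤s _)) (suc x) = zero , λ ()

enlarge : ∀ {n b d} k → 2 ≤ n → Realized n b d → Realized (k + n) b d
enlarge         zero    2≤n R = R
enlarge {n = n} (suc k) 2≤n R = cone-realized (enlarge k 2≤n R) (proj₂ (other (ℕ.≤-trans 2≤n (ℕ.m≤n+m n k)) _))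

-- Gluing triangles

bool-iff : ∀ {a b} → (a ≡ true → b ≡ true) → (b ≡ true → a ≡ true) → a ≡ b
bool-iff {true}  f g = sym (f refl)
bool-iff {false} {true}  f g = g refl
bool-iff {false} {false} f g = refl

glue : FaceFamily n → Subset n → FaceFamily n
glue Δ T G = Δ G ∨ (G ⊆ᵇ T)

module _ (Δ : FaceFamily n) (T : Subset n) where

  glue-old : ∀ {G} → Δ G ≡ true → glue Δ T G ≡ true
  glue-old e rewrite e = refl

  glue-new : ∀ {G} → G ⊆ T → glue Δ T G ≡ true
  glue-new {G} G⊆T = trans (cong (Δ G ∨_) (⊆ᵇ-complete G⊆T)) (Bool.∨-zeroʳ (Δ G))

  glue-inv : ∀ {G} → glue Δ T G ≡ true → Δ G ≡ true ⊎ G ⊆ T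
  glue-inv {G} e with true∨ {Δ G} e
  ... | inj₁ old = inj₁ old
  ... | inj₂ new = inj₂ (⊆ᵇ-sound new)

  glue-simplicial : IsSimplicialComplex Δ → IsSimplicialComplex (glue Δ T)
  glue-simplicial (v , down) = (λ i → glue-old (v i)) , λ F G G⊆F e → case glue-inv e of λ
    { (inj₁ ΔF) → glue-old (down F G G⊆F ΔF) ; (inj₂ F⊆T) → glue-new (F⊆T ∘ G⊆F) }

  glue-small : ∣ T ∣ ≤ 3 → (∀ {F} → Δ F ≡ true → ∣ F ∣ ≤ 3) → ∀ {F} → glue Δ T F ≡ true → ∣ F ∣ ≤ 3
  glue-small T≤3 small {F} e with glue-inv {F} e
  ... | inj₁ ΔF  = small ΔF
  ... | inj₂ F⊆T = ℕ.≤-trans (Sub.p⊆q⇒∣p∣≤∣q∣ F⊆T) T≤3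

  glue-walk : ∀ {v a b} → Star (Adjacent (link Δ ⁅ v ⁆)) a b → Star (Adjacent (link (glue Δ T) ⁅ v ⁆)) a b
  glue-walk {v} = Star.map λ { {a} {b} (a≢b , e) → a≢b , (case link-pair⁻ Δ {v} {a} {b} e of λ
    { (a≢v , b≢v , t) → link-pair⁺ (glue Δ T) a≢v b≢v (glue-old t) }) }

  glue-step : ∀ {v a b} → v ∈ T → a ∈ T → b ∈ T → a ≢ v → b ≢ v → a ≢ b → Adjacent (link (glue Δ T) ⁅ v ⁆) a b
  glue-step v∈T a∈T b∈T a≢v b≢v a≢b = a≢b , link-pair⁺ (glue Δ T) a≢v b≢v (glue-new (∪-⊆ v∈T (pair-⊆ a∈T b∈T)))

  glue-connected : ∀ {v} → Connected (link Δ ⁅ v ⁆) → (v ∈ T → ∃[ u ] (u ∈ T × v ≢ u × Δ (pair v u) ≡ true)) →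
                   Connected (link (glue Δ T) ⁅ v ⁆)
  glue-connected {v} (r , walk) anchor = r , λ {t} e → case link-vertex⁻ (glue Δ T) e of λ
    { (t≢v , vt) → case glue-inv vt of λ
      { (inj₁ Δvt)  → glue-walk (walk (link-vertex⁺ Δ t≢v Δvt))
      ; (inj₂ vt⊆T) → case anchor (vt⊆T ∈-cons) of λ { (u , u∈T , v≢u , Δvu) → case t Fin.≟ u of λ
        { (yes refl) → glue-walk (walk (link-vertex⁺ Δ t≢v Δvu))
        ; (no t≢u)   → glue-step (vt⊆T ∈-cons) (vt⊆T ∈-pairʳ) u∈T t≢v (v≢u ∘ sym) t≢u
                         ◅ glue-walk (walk (link-vertex⁺ Δ (v≢u ∘ sym) Δvu)) } } } }

SamePair : (a b c d : Fin n) → Set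
SamePair a b c d = (a ≡ c × b ≡ d) ⊎ (a ≡ d × b ≡ c)

same-pair : ∀ {a b c d : Fin n} → SamePair a b c d → pair a b ≡ pair c d
same-pair (inj₁ (refl , refl)) = refl
same-pair {a = a} {b} (inj₂ (refl , refl)) = pair-comm a b

module _ {x y z : Fin n} where

  pairs-of-triple : ∀ {a b} → a ≢ b → pair a b ⊆ triple x y z → SamePair a b x y ⊎ SamePair a b x z ⊎ SamePair a b z y
  pairs-of-triple a≢b ab⊆ with ∈-triple⁻ (ab⊆ ∈-cons) | ∈-triple⁻ (ab⊆ ∈-pairʳ)
  ... | inj₁ refl        | inj₁ refl        = contradiction refl a≢b
  ... | inj₁ refl        | inj₂ (inj₁ refl) = inj₁ (inj₁ (refl , refl))
  ... | inj₁ refl        | inj₂ (inj₂ refl) = inj₂ (inj₁ (inj₁ (refl , refl)))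
  ... | inj₂ (inj₁ refl) | inj₁ refl        = inj₁ (inj₂ (refl , refl))
  ... | inj₂ (inj₁ refl) | inj₂ (inj₁ refl) = contradiction refl a≢b
  ... | inj₂ (inj₁ refl) | inj₂ (inj₂ refl) = inj₂ (inj₂ (inj₂ (refl , refl)))
  ... | inj₂ (inj₂ refl) | inj₁ refl        = inj₂ (inj₁ (inj₂ (refl , refl)))
  ... | inj₂ (inj₂ refl) | inj₂ (inj₁ refl) = inj₂ (inj₂ (inj₁ (refl , refl)))
  ... | inj₂ (inj₂ refl) | inj₂ (inj₂ refl) = contradiction refl a≢b

⊆-size-≡ : {F G : Subset n} → G ⊆ F → ∣ G ∣ ≡ ∣ F ∣ → G ≡ F
⊆-size-≡ {F = F} {G} G⊆F e = Sub.⊆-antisym G⊆F λ {x} x∈F → case x Sub.∈? G of λ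
  { (yes x∈G) → x∈G
  ; (no x∉G)  → contradiction e (ℕ.<⇒≢ (Sub.p⊂q⇒∣p∣<∣q∣ (G⊆F , x , x∈F , x∉G))) }

cnt-add-pair : (Δ : FaceFamily n) {y z : Fin n} → y ≢ z → Δ (pair y z) ≡ false → cnt (add Δ (pair y z)) 2 ≡ suc (cnt Δ 2)
cnt-add-pair Δ {y} {z} y≢z e = subst (λ s → cnt (add Δ (pair y z)) s ≡ suc (cnt Δ s)) (∣pair∣ y≢z) (cnt-add Δ (pair y z) e)

module _ (Δ : FaceFamily n) {x y z : Fin n} (x≢y : x ≢ y) (x≢z : x ≢ z) (y≢z : y ≢ z) where

  private
    T = triple x y z
    yz⊆T : pair y z ⊆ T
    yz⊆T = ∈-there
    xz⊆T : pair x z ⊆ T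
    xz⊆T = pair-⊆ ∈-cons (∈-there ∈-pairʳ)

  cnt-glue₃ : Δ T ≡ false → cnt (glue Δ T) 3 ≡ suc (cnt Δ 3)
  cnt-glue₃ e = trans (cnt-cong-at {Γ = glue Δ T} {add Δ T} 3 (λ F s → bool-iff
      (λ g → case glue-inv Δ T g of λ { (inj₁ o) → add-old Δ T F o
                                      ; (inj₂ F⊆T) → subst (λ G → add Δ T G ≡ true) (sym (⊆-size-≡ F⊆T (trans s (sym size)))) (add-new Δ T) })
      (λ g → case add-inv Δ T F g of λ { (inj₁ o) → glue-old Δ T o ; (inj₂ refl) → glue-new Δ T id })))
    (subst (λ s → cnt (add Δ T) s ≡ suc (cnt Δ s)) size (cnt-add Δ T e))
    where
    size : ∣ T ∣ ≡ 3
    size = ∣triple∣ x≢y x≢z y≢z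

  cnt-glue₂-one : Δ (pair x y) ≡ true → Δ (pair x z) ≡ true → Δ (pair y z) ≡ false → cnt (glue Δ T) 2 ≡ suc (cnt Δ 2)
  cnt-glue₂-one xy xz ¬yz = trans (cnt-cong-at {Γ = glue Δ T} {add Δ (pair y z)} 2 same) (cnt-add-pair Δ y≢z ¬yz)
    where
    same : ∀ F → ∣ F ∣ ≡ 2 → glue Δ T F ≡ add Δ (pair y z) F
    same F s with ∣F∣≡2⇒pair F s
    ... | a , b , a≢b , refl = bool-iff
      (λ g → case glue-inv Δ T g of λ
        { (inj₁ o) → add-old Δ (pair y z) (pair a b) o
        ; (inj₂ ⊆T) → case pairs-of-triple a≢b ⊆T of λ
          { (inj₁ e) → add-old Δ (pair y z) _ (trans (cong Δ (same-pair e)) xy)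
          ; (inj₂ (inj₁ e)) → add-old Δ (pair y z) _ (trans (cong Δ (same-pair e)) xz)
          ; (inj₂ (inj₂ e)) → subst (λ G → add Δ (pair y z) G ≡ true) (sym (trans (same-pair e) (pair-comm z y))) (add-new Δ (pair y z)) } })
      (λ g → case add-inv Δ (pair y z) (pair a b) g of λ
        { (inj₁ o) → glue-old Δ T o
        ; (inj₂ e) → glue-new Δ T (λ {v} v∈ → yz⊆T (subst (v ∈_) e v∈)) })

  cnt-glue₂-two : Δ (pair x y) ≡ true → Δ (pair x z) ≡ false → Δ (pair y z) ≡ false → cnt (glue Δ T) 2 ≡ 2 + cnt Δ 2
  cnt-glue₂-two xy ¬xz ¬yz = trans (cnt-cong-at {Γ = glue Δ T} {Δ′} 2 same)
    (trans (cnt-add-pair Δ₁ y≢z ¬yz₁) (cong suc (cnt-add-pair Δ x≢z ¬xz)))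
    where
    Δ₁ = add Δ (pair x z)
    Δ′ = add Δ₁ (pair y z)
    ¬yz₁ : Δ₁ (pair y z) ≡ false
    ¬yz₁ with true-or-false (Δ₁ (pair y z))
    ... | inj₂ f = f
    ... | inj₁ t with add-inv Δ (pair x z) (pair y z) t
    ...   | inj₁ o = true≢false o ¬yz
    ...   | inj₂ e with ∈-pair⁻ (subst (x ∈_) (sym e) ∈-cons)
    ...     | inj₁ x≡y = contradiction x≡y x≢y
    ...     | inj₂ x≡z = contradiction x≡z x≢z
    same : ∀ F → ∣ F ∣ ≡ 2 → glue Δ T F ≡ Δ′ F
    same F s with ∣F∣≡2⇒pair F s
    ... | a , b , a≢b , refl = bool-iff
      (λ g → case glue-inv Δ T g of λ
        { (inj₁ o) → add-old Δ₁ (pair y z) (pair a b) (add-old Δ (pair x z) (pair a b) o)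
        ; (inj₂ ⊆T) → case pairs-of-triple a≢b ⊆T of λ
          { (inj₁ e) → add-old Δ₁ (pair y z) _ (add-old Δ (pair x z) _ (trans (cong Δ (same-pair e)) xy))
          ; (inj₂ (inj₁ e)) → add-old Δ₁ (pair y z) (pair a b) (subst (λ G → Δ₁ G ≡ true) (sym (same-pair e)) (add-new Δ (pair x z)))
          ; (inj₂ (inj₂ e)) → subst (λ G → Δ′ G ≡ true) (sym (trans (same-pair e) (pair-comm z y))) (add-new Δ₁ (pair y z)) } })
      (λ g → case add-inv Δ₁ (pair y z) (pair a b) g of λ
        { (inj₁ g₁) → case add-inv Δ (pair x z) (pair a b) g₁ of λ
          { (inj₁ o) → glue-old Δ T o
          ; (inj₂ e) → glue-new Δ T (λ {v} v∈ → xz⊆T (subst (v ∈_) e v∈)) }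
        ; (inj₂ e) → glue-new Δ T (λ {v} v∈ → yz⊆T (subst (v ∈_) e v∈)) })

-- The new edge yz is attached through the triangle spanned with the hub.
add-edge : ∀ {n b d} (R : Realized n b d) → cnt (Realized.Δ R) 2 < n C 2 → Realized n (suc b) (suc d)
add-edge {n} {b} {d} R lt with cnt-<-witness {Γ = Realized.Δ R} {λ _ → true} 2 (subst (cnt (Realized.Δ R) 2 <_) (sym (cnt-all n 2)) lt)
... | F , size , _ , ¬ΔF with ∣F∣≡2⇒pair F size
... | y , z , y≢z , refl = record
  { Δ      = glue Δ T
  ; hubbed = record
    { tame = record
      { simplicial = glue-simplicial Δ T simplicial
      ; small      = λ {F} → glue-small Δ T (ℕ.≤-reflexive (∣triple∣ hub≢y hub≢z y≢z)) small {F}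
      ; connected  = λ v → glue-connected Δ T (connected v) (anchor v)
      }
    ; hub     = hub
    ; hub-adj = λ e → glue-old Δ T (hub-adj e)
    }
  ; edges = trans (cong (_+ 3) (cnt-glue₂-one Δ hub≢y hub≢z y≢z (hub-adj hub≢y) (hub-adj hub≢z) ¬ΔF)) (trans (cong suc edges) (sym (ℕ.+-suc (2 * n) b)))
  ; tris  = trans (cong (_+ 2) (cnt-glue₃ Δ hub≢y hub≢z y≢z
              (trans (cong Δ (triple-rot hub y z)) (no-edge⇒no-triangle ¬ΔF)))) (trans (cong suc tris) (sym (ℕ.+-suc n d)))
  }
  where
  open Realized R
  open Hubbed hubbed
  T = triple hub y z
  hub≢y : hub ≢ y
  hub≢y refl = true≢false (hub-adj y≢z) ¬ΔF
  hub≢z : hub ≢ z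
  hub≢z refl = true≢false (trans (cong Δ (pair-comm y hub)) (hub-adj (y≢z ∘ sym))) ¬ΔF
  anchor : ∀ v → v ∈ T → ∃[ u ] (u ∈ T × v ≢ u × Δ (pair v u) ≡ true)
  anchor v v∈T with ∈-triple⁻ v∈T
  ... | inj₁ refl        = y , ∈-there ∈-cons , hub≢y , hub-adj hub≢y
  ... | inj₂ (inj₁ refl) = hub , ∈-cons , (hub≢y ∘ sym) , trans (cong Δ (pair-comm y hub)) (hub-adj hub≢y)
  ... | inj₂ (inj₂ refl) = hub , ∈-cons , (hub≢z ∘ sym) , trans (cong Δ (pair-comm z hub)) (hub-adj hub≢z)

fill : ∀ {a b d} k → b + k ≤ tri a → Realized (3 + a) b d → Realized (3 + a) (k + b) (k + d)
fill zero le R = R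
fill {a} {b} {d} (suc k) le R = add-edge R' (subst (cnt Δ 2 <_) (sym ([1+n]C2≡tri (2 + a))) (ℕ.+-cancelʳ-< 3 _ _ lt))
  where
  R' = fill k (ℕ.≤-trans (ℕ.+-monoʳ-≤ b (ℕ.n≤1+n k)) le) R
  open Realized R'
  arith : ∀ (a t : ℕ) → 2 * (3 + a) + t ≡ (2 + a + (1 + a + t)) + 3
  arith = solve-∀
  lt : cnt Δ 2 + 3 < tri (2 + a) + 3
  lt = subst₂ _<_ (sym edges) (arith a (tri a)) (ℕ.+-monoʳ-< (2 * (3 + a)) (subst (_≤ tri a) (trans (ℕ.+-suc b k) (cong suc (ℕ.+-comm b k))) le))

-- Gluing strips

-- Two triangles xyz and zyw, glued to the edges xy and zw along the path of new edges xz, zy, yw.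
-- Each vertex of the path keeps a connected link, h₂ grows by 3 and h₃ drops by 1.
module Strip {Δ : FaceFamily n} (H : Hubbed Δ) {x y z w : Fin n}
         (x≢y : x ≢ y) (x≢z : x ≢ z) (x≢w : x ≢ w) (y≢z : y ≢ z) (y≢w : y ≢ w) (z≢w : z ≢ w)
         (xy : Δ (pair x y) ≡ true) (zw : Δ (pair z w) ≡ true)
         (¬xz : Δ (pair x z) ≡ false) (¬zy : Δ (pair z y) ≡ false) (¬yw : Δ (pair y w) ≡ false) where

  open Hubbed H

  private
    T₁ = triple x y z
    T₂ = triple z y w
    Δ₁ = glue Δ T₁

  strip : FaceFamily n
  strip = glue Δ₁ T₂

  private
    flip : ∀ (Δ : FaceFamily n) {a b c} → Δ (pair a b) ≡ c → Δ (pair b a) ≡ c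
    flip Δ {a} {b} = trans (cong Δ (pair-comm b a))
    yz₁ : Δ₁ (pair y z) ≡ true
    yz₁ = glue-new Δ T₁ ∈-there
    zw₁ : Δ₁ (pair z w) ≡ true
    zw₁ = glue-old Δ T₁ zw
    w∉T₁ : w ∉ T₁
    w∉T₁ w∈ = case ∈-triple⁻ w∈ of λ
      { (inj₁ w≡x) → x≢w (sym w≡x) ; (inj₂ (inj₁ w≡y)) → y≢w (sym w≡y) ; (inj₂ (inj₂ w≡z)) → z≢w (sym w≡z) }
    ¬yw₁ : Δ₁ (pair y w) ≡ false
    ¬yw₁ with true-or-false (Δ₁ (pair y w))
    ... | inj₂ f = f
    ... | inj₁ t with glue-inv Δ T₁ t
    ...   | inj₁ o  = true≢false o ¬yw
    ...   | inj₂ ⊆T = contradiction (⊆T ∈-pairʳ) w∉T₁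
    new-triangle₁ : Δ T₁ ≡ false
    new-triangle₁ = trans (cong Δ (triple-swap x y z)) (no-edge⇒no-triangle ¬xz)
    Δ₁-down : ∀ {F G} → G ⊆ F → Δ₁ F ≡ true → Δ₁ G ≡ true
    Δ₁-down {F} {G} = proj₂ (glue-simplicial Δ T₁ simplicial) F G
    new-triangle₂ : Δ₁ T₂ ≡ false
    new-triangle₂ with true-or-false (Δ₁ T₂)
    ... | inj₂ f = f
    ... | inj₁ t = true≢false (Δ₁-down ∈-there t) ¬yw₁

  strip-edges : cnt strip 2 ≡ 3 + cnt Δ 2
  strip-edges = trans (cnt-glue₂-one Δ₁ (y≢z ∘ sym) z≢w y≢w (flip Δ₁ yz₁) zw₁ ¬yw₁)
                      (cong suc (cnt-glue₂-two Δ x≢y x≢z y≢z xy ¬xz (flip Δ ¬zy)))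

  strip-tris : cnt strip 3 ≡ 2 + cnt Δ 3
  strip-tris = trans (cnt-glue₃ Δ₁ (y≢z ∘ sym) z≢w y≢w new-triangle₂) (cong suc (cnt-glue₃ Δ x≢y x≢z y≢z new-triangle₁))

  strip-old : ∀ {G} → Δ G ≡ true → strip G ≡ true
  strip-old e = glue-old Δ₁ T₂ (glue-old Δ T₁ e)

  strip-new : ∀ {a b} → SamePair a b x z ⊎ SamePair a b z y ⊎ SamePair a b y w → strip (pair a b) ≡ true
  strip-new (inj₁ e)        = trans (cong strip (same-pair e)) (glue-old Δ₁ T₂ (glue-new Δ T₁ (pair-⊆ ∈-cons (∈-there ∈-pairʳ))))
  strip-new (inj₂ (inj₁ e)) = trans (cong strip (same-pair e)) (glue-new Δ₁ T₂ (pair-⊆ ∈-cons (∈-there ∈-cons)))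
  strip-new (inj₂ (inj₂ e)) = trans (cong strip (same-pair e)) (glue-new Δ₁ T₂ ∈-there)

  strip-inv : ∀ {a b} → a ≢ b → strip (pair a b) ≡ true →
              Δ (pair a b) ≡ true ⊎ SamePair a b x z ⊎ SamePair a b z y ⊎ SamePair a b y w
  strip-inv {a} {b} a≢b e with glue-inv Δ₁ T₂ {pair a b} e
  ... | inj₁ e₁ with glue-inv Δ T₁ {pair a b} e₁
  ...   | inj₁ o  = inj₁ o
  ...   | inj₂ ⊆T with pairs-of-triple a≢b ⊆T
  ...     | inj₁ s = inj₁ (trans (cong Δ (same-pair s)) xy)
  ...     | inj₂ (inj₁ s) = inj₂ (inj₁ s)
  ...     | inj₂ (inj₂ s) = inj₂ (inj₂ (inj₁ s))
  strip-inv {a} {b} a≢b e | inj₂ ⊆T with pairs-of-triple a≢b ⊆T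
  ... | inj₁ s = inj₂ (inj₂ (inj₁ s))
  ... | inj₂ (inj₁ s) = inj₁ (trans (cong Δ (same-pair s)) zw)
  ... | inj₂ (inj₂ (inj₁ (a≡w , b≡y))) = inj₂ (inj₂ (inj₂ (inj₂ (a≡w , b≡y))))
  ... | inj₂ (inj₂ (inj₂ (a≡y , b≡w))) = inj₂ (inj₂ (inj₂ (inj₁ (a≡y , b≡w))))

  strip-hubbed : Hubbed strip
  strip-hubbed = record
    { tame = record
      { simplicial = glue-simplicial Δ₁ T₂ (glue-simplicial Δ T₁ simplicial)
      ; small      = λ {F} → glue-small Δ₁ T₂ (ℕ.≤-reflexive (∣triple∣ (y≢z ∘ sym) z≢w y≢w))
                       (λ {G} → glue-small Δ T₁ (ℕ.≤-reflexive (∣triple∣ x≢y x≢z y≢z)) small {G}) {F}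
      ; connected  = connected′
      }
    ; hub     = hub
    ; hub-adj = λ e → strip-old (hub-adj e)
    }
    where
    connected₁ : ∀ v → v ≢ z → Connected (link Δ₁ ⁅ v ⁆)
    connected₁ v v≢z = glue-connected Δ T₁ (connected v) λ v∈T → case ∈-triple⁻ v∈T of λ
      { (inj₁ refl) → y , ∈-there ∈-cons , x≢y , xy
      ; (inj₂ (inj₁ refl)) → x , ∈-cons , x≢y ∘ sym , flip Δ xy
      ; (inj₂ (inj₂ refl)) → contradiction refl v≢z }
    connected′ : ∀ v → Connected (link strip ⁅ v ⁆)
    connected′ v with v Fin.≟ z
    ... | no v≢z = glue-connected Δ₁ T₂ (connected₁ v v≢z) λ v∈T → case ∈-triple⁻ v∈T of λ
      { (inj₁ refl) → contradiction refl v≢z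
      ; (inj₂ (inj₁ refl)) → z , ∈-cons , y≢z , yz₁
      ; (inj₂ (inj₂ refl)) → z , ∈-cons , z≢w ∘ sym , flip Δ₁ zw₁ }
    ... | yes refl with connected z
    ...   | r , walk = r , λ {t} e → case link-vertex⁻ strip {z} {t} e of λ { (t≢z , zt) →
              case strip-inv (t≢z ∘ sym) zt of λ
              { (inj₁ o) → lifted (walk (link-vertex⁺ Δ t≢z o))
              ; (inj₂ (inj₁ (inj₁ (z≡x , _)))) → contradiction (sym z≡x) x≢z
              ; (inj₂ (inj₁ (inj₂ (_ , refl)))) → from-x
              ; (inj₂ (inj₂ (inj₁ (inj₁ (_ , refl))))) → from-y
              ; (inj₂ (inj₂ (inj₁ (inj₂ (z≡y , _))))) → contradiction (sym z≡y) y≢z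
              ; (inj₂ (inj₂ (inj₂ (inj₁ (z≡y , _))))) → contradiction (sym z≡y) y≢z
              ; (inj₂ (inj₂ (inj₂ (inj₂ (z≡w , _))))) → contradiction z≡w z≢w } }
      where
      lifted : ∀ {a b} → Star (Adjacent (link Δ ⁅ z ⁆)) a b → Star (Adjacent (link strip ⁅ z ⁆)) a b
      lifted walk = glue-walk Δ₁ T₂ {z} (glue-walk Δ T₁ {z} walk)
      from-y : Star (Adjacent (link strip ⁅ z ⁆)) y r
      from-y = glue-step Δ₁ T₂ {z} ∈-cons (∈-there ∈-cons) (∈-there ∈-pairʳ) y≢z (z≢w ∘ sym) y≢w
               ◅ lifted (walk (link-vertex⁺ Δ (z≢w ∘ sym) zw))
      from-x : Star (Adjacent (link strip ⁅ z ⁆)) x r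
      from-x = glue-walk Δ₁ T₂ {z} (glue-step Δ T₁ {z} (∈-there ∈-pairʳ) ∈-cons (∈-there ∈-cons) x≢z y≢z x≢y ◅ ε) ◅◅ from-y

-- Sequences of strips are checked on a table of the edges between finitely many named vertices.
Table : ℕ → Set
Table k = Fin k → Fin k → Bool

record Move (k : ℕ) : Set where
  constructor move
  field v₁ v₂ v₃ v₄ : Fin k

_==_ : Fin k → Fin k → Bool
i == j = does (i Fin.≟ j)

==-sound : {i j : Fin k} → (i == j) ≡ true → i ≡ j
==-sound {i = i} {j} e with i Fin.≟ j
... | yes i≡j = i≡j

==-refl : (i : Fin k) → (i == i) ≡ true
==-refl i with i Fin.≟ i
... | yes _  = refl
... | no i≢i = contradiction refl i≢i

not-== : {i j : Fin k} → not (i == j) ≡ true → i ≢ j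
not-== {i = i} e refl = true≢false e (cong not (==-refl i))

samePairᵇ : (a b c d : Fin k) → Bool
samePairᵇ a b c d = ((a == c) ∧ (b == d)) ∨ ((a == d) ∧ (b == c))

samePairᵇ-sound : ∀ {a b c d : Fin k} → samePairᵇ a b c d ≡ true → SamePair a b c d
samePairᵇ-sound {a = a} {b} {c} {d} e with true∨ {(a == c) ∧ (b == d)} e
... | inj₁ p = inj₁ (==-sound (proj₁ (true∧ p)) , ==-sound (proj₂ (true∧ {a == c} p)))
... | inj₂ p = inj₂ (==-sound (proj₁ (true∧ p)) , ==-sound (proj₂ (true∧ {a == d} p)))

samePairᵇ-complete : ∀ {a b c d : Fin k} → SamePair a b c d → samePairᵇ a b c d ≡ true
samePairᵇ-complete {a = a} {b} (inj₁ (refl , refl)) rewrite ==-refl a | ==-refl b = refl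
samePairᵇ-complete {a = a} {b} (inj₂ (refl , refl)) rewrite ==-refl a | ==-refl b = Bool.∨-zeroʳ _

newEdge : Move k → Table k
newEdge (move x y z w) i j = samePairᵇ i j x z ∨ (samePairᵇ i j z y ∨ samePairᵇ i j y w)

legal : Table k → Move k → Bool
legal adj (move x y z w) =
  not (x == y) ∧ not (x == z) ∧ not (x == w) ∧ not (y == z) ∧ not (y == w) ∧ not (z == w) ∧
  adj x y ∧ adj z w ∧ not (adj x z) ∧ not (adj z y) ∧ not (adj y w)

after : Table k → List (Move k) → Table k
after adj []       = adj
after adj (m ∷ ms) = after (λ i j → adj i j ∨ newEdge m i j) ms

legals : Table k → List (Move k) → Bool
legals adj []       = true
legals adj (m ∷ ms) = legal adj m ∧ legals (λ i j → adj i j ∨ newEdge m i j) ms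

legals-take : (adj : Table k) (ms : List (Move k)) (q : ℕ) → legals adj ms ≡ true → legals adj (take q ms) ≡ true
legals-take adj ms       zero    e = refl
legals-take adj []       (suc q) e = refl
legals-take adj (m ∷ ms) (suc q) e with true∧ {legal adj m} e
... | p , p' = ∧true p (legals-take _ ms q p')

Matches : FaceFamily n → (Fin k → Fin n) → Table k → Set
Matches Δ φ adj = ∀ {i j} → i ≢ j → Δ (pair (φ i) (φ j)) ≡ adj i j

record Strips {n b d} (R : Realized n b d) (Touched : Fin n → Set) (q : ℕ) : Set where
  field
    R′ : Realized n (q * 3 + b) (q * 2 + d)
  open Realized R′ using () renaming (Δ to Δ′; hubbed to hubbed′)
  open Realized R
  field
    hub≡ : Hubbed.hub hubbed′ ≡ Hubbed.hub hubbed
    old  : ∀ {G} → Δ G ≡ true → Δ′ G ≡ true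
    new  : ∀ {x y} → x ≢ y → Δ′ (pair x y) ≡ true → Δ (pair x y) ≡ true ⊎ (Touched x × Touched y)

no-strips : ∀ {n b d} (R : Realized n b d) {Touched : Fin n → Set} → Strips R Touched 0
no-strips R = record { R′ = R ; hub≡ = refl ; old = id ; new = λ _ → inj₁ }

more-strips : ∀ {n b d p q} {R : Realized n b d} {T T′ : Fin n → Set} (S : Strips R T p) → Strips (Strips.R′ S) T′ q →
              Strips R (λ x → T x ⊎ T′ x) (p + q)
more-strips {n} {b} {d} {p} {q} S S′ = record
  { R′   = record { Δ = Δ ; hubbed = hubbed ; edges = trans edges (cong (λ k → 2 * n + k) (arith p q b 3))
                                            ; tris = trans tris (cong (λ k → n + k) (arith p q d 2)) }
  ; hub≡ = trans (Strips.hub≡ S′) (Strips.hub≡ S)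
  ; old  = Strips.old S′ ∘ Strips.old S
  ; new  = λ x≢y e → case Strips.new S′ x≢y e of λ
      { (inj₁ e₁) → case Strips.new S x≢y e₁ of λ { (inj₁ o) → inj₁ o ; (inj₂ (tx , ty)) → inj₂ (inj₁ tx , inj₁ ty) }
      ; (inj₂ (tx , ty)) → inj₂ (inj₂ tx , inj₂ ty) }
  }
  where
  open Realized (Strips.R′ S′)
  arith : ∀ (p q b c : ℕ) → q * c + (p * c + b) ≡ (p + q) * c + b
  arith = solve-∀

weaken-strips : ∀ {n b d q} {R : Realized n b d} {T T′ : Fin n → Set} → (∀ {x} → T x → T′ x) → Strips R T q → Strips R T′ q
weaken-strips T⊆T′ S = record { R′ = R′ ; hub≡ = hub≡ ; old = old
  ; new = λ x≢y e → case new x≢y e of λ { (inj₁ o) → inj₁ o ; (inj₂ (tx , ty)) → inj₂ (T⊆T′ tx , T⊆T′ ty) } }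
  where open Strips S

Named : (Fin k → Fin n) → Fin n → Set
Named φ x = ∃[ i ] φ i ≡ x

Matched : ∀ {n b d} (R : Realized n b d) → (Fin k → Fin n) → Table k → ℕ → Set
Matched R φ adj q = Σ (Strips R (Named φ) q) λ S → Matches (Realized.Δ (Strips.R′ S)) φ adj

one-strip : ∀ {n b d} (R : Realized n b d) (φ : Fin k → Fin n) → (∀ {i j} → φ i ≡ φ j → i ≡ j) →
  (adj : Table k) → Matches (Realized.Δ R) φ adj → (m : Move k) → legal adj m ≡ true →
  Matched R φ (λ i j → adj i j ∨ newEdge m i j) 1
one-strip {k} {n} {b} {d} R φ injective adj matches (move x y z w) e
  with true∧ {not (x == y)} e
... | xy≢ , e₁ with true∧ {not (x == z)} e₁
... | xz≢ , e₂ with true∧ {not (x == w)} e₂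
... | xw≢ , e₃ with true∧ {not (y == z)} e₃
... | yz≢ , e₄ with true∧ {not (y == w)} e₄
... | yw≢ , e₅ with true∧ {not (z == w)} e₅
... | zw≢ , e₆ with true∧ {adj x y} e₆
... | xy , e₇ with true∧ {adj z w} e₇
... | zw , e₈ with true∧ {not (adj x z)} e₈
... | xz , e₉ with true∧ {not (adj z y)} e₉
... | zy , yw = record
  { R′ = record
    { Δ      = strip
    ; hubbed = strip-hubbed
    ; edges  = trans (cong (_+ 3) strip-edges)
                 (trans (cong (λ k → 3 + k) edges) (arith 3 (2 * n) b))
    ; tris   = trans (cong (_+ 2) strip-tris)
                 (trans (cong (λ k → 2 + k) tris) (arith 2 n d))
    }
  ; hub≡ = refl
  ; old  = strip-old
  ; new  = λ {u} {v} u≢v uv → case strip-inv u≢v uv of λ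
      { (inj₁ o) → inj₁ o
      ; (inj₂ (inj₁ s)) → inj₂ (named s)
      ; (inj₂ (inj₂ (inj₁ s))) → inj₂ (named s)
      ; (inj₂ (inj₂ (inj₂ s))) → inj₂ (named s) }
  } , λ {i} {j} i≢j → bool-iff
      (λ t → case strip-inv (i≢j ∘ injective) t of λ
        { (inj₁ o) → cong (_∨ newEdge (move x y z w) i j) (trans (sym (matches i≢j)) o)
        ; (inj₂ s) → trans (cong (adj i j ∨_) (complete (pull s))) (Bool.∨-zeroʳ (adj i j)) })
      (λ t → case true∨ {adj i j} t of λ
        { (inj₁ o) → strip-old (trans (matches i≢j) o)
        ; (inj₂ s) → strip-new (push (sound s)) })
  where
  open Realized R
  arith : ∀ (c n b : ℕ) → c + (n + b) ≡ n + (1 * c + b)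
  arith = solve-∀
  dist : ∀ {i j} → not (i == j) ≡ true → φ i ≢ φ j
  dist ne = not-== ne ∘ injective
  not-true : ∀ {c} → not c ≡ true → c ≡ false
  not-true {false} _ = refl
  Δxy : Δ (pair (φ x) (φ y)) ≡ true
  Δxy = trans (matches (not-== xy≢)) xy
  Δzw : Δ (pair (φ z) (φ w)) ≡ true
  Δzw = trans (matches (not-== zw≢)) zw
  ¬Δxz : Δ (pair (φ x) (φ z)) ≡ false
  ¬Δxz = trans (matches (not-== xz≢)) (not-true xz)
  ¬Δzy : Δ (pair (φ z) (φ y)) ≡ false
  ¬Δzy = trans (matches (not-== yz≢ ∘ sym)) (not-true zy)
  ¬Δyw : Δ (pair (φ y) (φ w)) ≡ false
  ¬Δyw = trans (matches (not-== yw≢)) (not-true yw)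
  open Strip hubbed (dist xy≢) (dist xz≢) (dist xw≢) (dist yz≢) (dist yw≢) (dist zw≢) Δxy Δzw ¬Δxz ¬Δzy ¬Δyw
  named : ∀ {u v i j} → SamePair u v (φ i) (φ j) → Named φ u × Named φ v
  named (inj₁ (refl , refl)) = (_ , refl) , (_ , refl)
  named (inj₂ (refl , refl)) = (_ , refl) , (_ , refl)
  pull₁ : ∀ {i j a b} → SamePair (φ i) (φ j) (φ a) (φ b) → SamePair i j a b
  pull₁ (inj₁ (p , q)) = inj₁ (injective p , injective q)
  pull₁ (inj₂ (p , q)) = inj₂ (injective p , injective q)
  push₁ : ∀ {i j a b} → SamePair i j a b → SamePair (φ i) (φ j) (φ a) (φ b)
  push₁ (inj₁ (p , q)) = inj₁ (cong φ p , cong φ q)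
  push₁ (inj₂ (p , q)) = inj₂ (cong φ p , cong φ q)
  New : (i j : Fin k) → Set
  New i j = SamePair i j x z ⊎ SamePair i j z y ⊎ SamePair i j y w
  New′ : (u v : Fin n) → Set
  New′ u v = SamePair u v (φ x) (φ z) ⊎ SamePair u v (φ z) (φ y) ⊎ SamePair u v (φ y) (φ w)
  pull : ∀ {i j} → New′ (φ i) (φ j) → New i j
  pull (inj₁ s)        = inj₁ (pull₁ s)
  pull (inj₂ (inj₁ s)) = inj₂ (inj₁ (pull₁ s))
  pull (inj₂ (inj₂ s)) = inj₂ (inj₂ (pull₁ s))
  push : ∀ {i j} → New i j → New′ (φ i) (φ j)
  push (inj₁ s)        = inj₁ (push₁ s)
  push (inj₂ (inj₁ s)) = inj₂ (inj₁ (push₁ s))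
  push (inj₂ (inj₂ s)) = inj₂ (inj₂ (push₁ s))
  complete : ∀ {i j} → New i j → newEdge (move x y z w) i j ≡ true
  complete (inj₁ s) rewrite samePairᵇ-complete s = refl
  complete {i} {j} (inj₂ (inj₁ s)) rewrite samePairᵇ-complete s = Bool.∨-zeroʳ _
  complete {i} {j} (inj₂ (inj₂ s)) rewrite samePairᵇ-complete s | Bool.∨-zeroʳ (samePairᵇ i j z y) = Bool.∨-zeroʳ _
  sound : ∀ {i j} → newEdge (move x y z w) i j ≡ true → New i j
  sound {i} {j} t with true∨ {samePairᵇ i j x z} t
  ... | inj₁ p = inj₁ (samePairᵇ-sound p)
  ... | inj₂ p with true∨ {samePairᵇ i j z y} p
  ...   | inj₁ p' = inj₂ (inj₁ (samePairᵇ-sound p'))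
  ...   | inj₂ p' = inj₂ (inj₂ (samePairᵇ-sound p'))

-- Abstract, so that the glued complexes are never unfolded.
abstract
  strips : ∀ {n b d} (R : Realized n b d) (φ : Fin k → Fin n) → (∀ {i j} → φ i ≡ φ j → i ≡ j) →
    (adj : Table k) → Matches (Realized.Δ R) φ adj → (ms : List (Move k)) → legals adj ms ≡ true →
    Matched R φ (after adj ms) (length ms)
  strips R φ injective adj matches []       e = no-strips R , matches
  strips R φ injective adj matches (m ∷ ms) e with true∧ {legal adj m} e
  ... | p , p' with one-strip R φ injective adj matches m p
  ... | S , matches₁ with strips (Strips.R′ S) φ injective _ matches₁ ms p'
  ... | S′ , matches₂ = weaken-strips (λ { (inj₁ t) → t ; (inj₂ t) → t }) (more-strips S S′) , matches₂

-- Many strips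

recast : ∀ {n b b′ d d′} → b ≡ b′ → d ≡ d′ → Realized n b d → Realized n b′ d′
recast {n} b≡ d≡ R = record { Δ = Δ ; hubbed = hubbed
  ; edges = trans edges (cong (λ k → 2 * n + k) b≡) ; tris = trans tris (cong (λ k → n + k) d≡) }
  where open Realized R

hubOf : ∀ {n b d} → Realized n b d → Fin n
hubOf R = Hubbed.hub (Realized.hubbed R)

complete : ∀ n → FaceFamily n
complete n F = ∣ F ∣ ≤ᵇ 3

complete-hubbed : 2 ≤ n → Hubbed (complete n)
complete-hubbed {suc n} 2≤n = record
  { tame = record
    { simplicial = (λ i → small-face ⁅ i ⁆ (ℕ.≤-trans (ℕ.≤-reflexive (Sub.∣⁅x⁆∣≡1 i)) (s≤s z≤n)))
                 , λ F G G⊆F e → small-face G (ℕ.≤-trans (Sub.p⊆q⇒∣p∣≤∣q∣ G⊆F) (true-≤ᵇ e))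
    ; small      = true-≤ᵇ
    ; connected  = λ v → case other 2≤n v of λ { (r , v≢r) → r , λ {y} e → walk v≢r (proj₁ (link-vertex⁻ (complete (suc n)) {v} {y} e)) }
    }
  ; hub     = zero
  ; hub-adj = λ {y} 0≢y → small-face (pair zero y) (ℕ.≤-trans (ℕ.≤-reflexive (∣pair∣ 0≢y)) (s≤s (s≤s z≤n)))
  }
  where
  small-face : ∀ F → ∣ F ∣ ≤ 3 → complete (suc n) F ≡ true
  small-face F = ≤ᵇ-true
  walk : ∀ {v r y} → v ≢ r → y ≢ v → Star (Adjacent (link (complete (suc n)) ⁅ v ⁆)) y r
  walk {v} {r} {y} v≢r y≢v with y Fin.≟ r
  ... | yes refl = ε
  ... | no y≢r = (y≢r , link-pair⁺ (complete (suc n)) y≢v (v≢r ∘ sym)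
                    (small-face (triple v y r) (ℕ.≤-reflexive (∣triple∣ (y≢v ∘ sym) v≢r y≢r)))) ◅ ε

cnt-complete : ∀ n {s} → s ≤ 3 → cnt (complete n) s ≡ n C s
cnt-complete n {s} s≤3 = trans (cnt-cong-at {Γ = complete n} {λ _ → true} s (λ F e → ≤ᵇ-true (subst (_≤ 3) (sym e) s≤3))) (cnt-all n s)

edge-realized : Realized 2 0 0
edge-realized = record { Δ = complete 2 ; hubbed = complete-hubbed ℕ.≤-refl ; edges = refl ; tris = refl }

complete-realized : ∀ μ → Realized (3 + μ) (tri μ) (tri μ + tet μ)
complete-realized μ = record
  { Δ      = complete (3 + μ)
  ; hubbed = complete-hubbed (s≤s (s≤s z≤n))
  ; edges  = trans (cong (_+ 3) (trans (cnt-complete (3 + μ) (s≤s (s≤s z≤n))) ([1+n]C2≡tri (2 + μ)))) (arith₁ μ (tri μ))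
  ; tris   = trans (cong (_+ 2) (trans (cnt-complete (3 + μ) ℕ.≤-refl) ([2+n]C3≡tet (1 + μ)))) (arith₂ μ (tri μ) (tet μ))
  }
  where
  arith₁ : ∀ (μ t : ℕ) → (2 + μ + (1 + μ + t)) + 3 ≡ 2 * (3 + μ) + t
  arith₁ = solve-∀
  arith₂ : ∀ (μ t u : ℕ) → (1 + μ + t + u) + 2 ≡ (3 + μ) + (t + u)
  arith₂ = solve-∀

consF : (Fin k → Fin n) → Fin (suc k) → Fin (suc n)
consF g zero    = zero
consF g (suc i) = suc (g i)

consF-injective : {g : Fin k → Fin n} → (∀ {i j} → g i ≡ g j → i ≡ j) → ∀ {i j} → consF g i ≡ consF g j → i ≡ j
consF-injective inj {zero}  {zero}  _ = refl
consF-injective inj {suc i} {suc j} e = cong suc (inj (Fin.suc-injective e))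

path : Table k
path i j = (suc (toℕ i) ≡ᵇ toℕ j) ∨ (suc (toℕ j) ≡ᵇ toℕ i)

matches-suc : {Δ : FaceFamily n} {φ : Fin (suc k) → Fin n} {adj : Table (suc k)} →
  (∀ j → Δ (pair (φ zero) (φ (suc j))) ≡ adj zero (suc j)) → (∀ j → adj (suc j) zero ≡ adj zero (suc j)) →
  Matches Δ (φ ∘ suc) (λ i j → adj (suc i) (suc j)) → Matches Δ φ adj
matches-suc row symm rest {zero}  {zero}  i≢j = contradiction refl i≢j
matches-suc row symm rest {zero}  {suc j} i≢j = row j
matches-suc {Δ = Δ} {φ} row symm rest {suc i} {zero} i≢j =
  trans (cong Δ (pair-comm (φ (suc i)) (φ zero))) (trans (row i) (sym (symm i)))
matches-suc row symm rest {suc i} {suc j} i≢j = rest (i≢j ∘ cong suc)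

module Cone {n b d} (R : Realized n b d) {y : Fin n} (hub≢y : hubOf R ≢ y) where

  open Realized R using (Δ)

  R⁺ : Realized (suc n) b d
  R⁺ = cone-realized R hub≢y

  spoke : ∀ a → Realized.Δ R⁺ (pair zero (suc a)) ≡ (⁅ a ⁆ ⊆ᵇ pair (hubOf R) y)
  spoke = ext-spoke Δ (edge-link (hubOf R) y)

  spoke-tip : Realized.Δ R⁺ (pair zero (suc y)) ≡ true
  spoke-tip = trans (spoke y) (⊆ᵇ-complete {F = ⁅ y ⁆} {pair (hubOf R) y} (⁅⁆-⊆ ∈-pairʳ))

  spoke-none : ∀ {a} → hubOf R ≢ a → a ≢ y → Realized.Δ R⁺ (pair zero (suc a)) ≡ false
  spoke-none {a} hub≢a a≢y with true-or-false (⁅ a ⁆ ⊆ᵇ pair (hubOf R) y)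
  ... | inj₂ f = trans (spoke a) f
  ... | inj₁ t with ∈-pair⁻ (⊆ᵇ-sound {F = ⁅ a ⁆} {pair (hubOf R) y} t (Sub.x∈⁅x⁆ a))
  ...   | inj₁ a≡hub = contradiction (sym a≡hub) hub≢a
  ...   | inj₂ a≡y   = contradiction a≡y a≢y

record PathIn {n b d} (R : Realized n b d) (k : ℕ) : Set where
  field
    vertexAt  : Fin (suc k) → Fin n
    injective : ∀ {i j} → vertexAt i ≡ vertexAt j → i ≡ j
    off-hub   : ∀ i → hubOf R ≢ vertexAt i
    matches   : Matches (Realized.Δ R) vertexAt path

module _ {n b d} (R : Realized n b d) (P : PathIn R k) where

  open PathIn P
  open Cone R (off-hub zero)

  extend-path : PathIn R⁺ (suc k)
  extend-path = record
    { vertexAt  = consF vertexAt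
    ; injective = consF-injective injective
    ; off-hub   = λ { zero () ; (suc i) e → off-hub i (Fin.suc-injective e) }
    ; matches   = matches-suc {Δ = Realized.Δ R⁺} {consF vertexAt} {path} row (λ j → sym (Bool.∨-identityʳ (0 ≡ᵇ toℕ j))) matches
    }
    where
    row : ∀ j → Realized.Δ R⁺ (pair zero (suc (vertexAt j))) ≡ path {suc (suc k)} zero (suc j)
    row zero    = spoke-tip
    row (suc j) = spoke-none (off-hub (suc j)) (λ e → case injective e of λ ())

↑ : Fin n → Fin (3 + n)
↑ i = suc (suc (suc i))

↑-injective : {i j : Fin n} → ↑ i ≡ ↑ j → i ≡ j
↑-injective refl = refl

newest : Fin 3 → Fin (3 + n)
newest zero             = zero
newest (suc zero)       = suc zero
newest (suc (suc zero)) = suc (suc zero)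

newest-injective : ∀ {i j} → newest {n} i ≡ newest j → i ≡ j
newest-injective {i = zero}           {zero}           _ = refl
newest-injective {i = zero}           {suc zero}       ()
newest-injective {i = zero}           {suc (suc zero)} ()
newest-injective {i = suc zero}       {zero}           ()
newest-injective {i = suc zero}       {suc zero}       _ = refl
newest-injective {i = suc zero}       {suc (suc zero)} ()
newest-injective {i = suc (suc zero)} {zero}           ()
newest-injective {i = suc (suc zero)} {suc zero}       ()
newest-injective {i = suc (suc zero)} {suc (suc zero)} _ = refl

newest≢↑ : ∀ i {a : Fin n} → newest i ≢ ↑ a
newest≢↑ zero             ()
newest≢↑ (suc zero)       ()
newest≢↑ (suc (suc zero)) ()

cons₃ : (Fin k → Fin n) → Fin (3 + k) → Fin (3 + n)
cons₃ g = consF (consF (consF g))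

cons₃-injective : {g : Fin k → Fin n} → (∀ {i j} → g i ≡ g j → i ≡ j) → ∀ {i j} → cons₃ g i ≡ cons₃ g j → i ≡ j
cons₃-injective inj = consF-injective (consF-injective (consF-injective inj))

cons₃-newest : (g : Fin k → Fin n) (i : Fin 3) → cons₃ g (newest i) ≡ newest i
cons₃-newest g zero             = refl
cons₃-newest g (suc zero)       = refl
cons₃-newest g (suc (suc zero)) = refl

named-cons₃ : (g : Fin k → Fin n) {x : Fin (3 + n)} → Named (cons₃ g) x → Named newest x ⊎ Named (↑ ∘ g) x
named-cons₃ g (zero , e)               = inj₁ (zero , e)
named-cons₃ g (suc zero , e)           = inj₁ (suc zero , e)
named-cons₃ g (suc (suc zero) , e)     = inj₁ (suc (suc zero) , e)
named-cons₃ g (suc (suc (suc i)) , e)  = inj₂ (i , e)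

Triple : ℕ → Set
Triple n = Fin 3 → Fin n

Apart : (Fin k → Fin n) → Triple n → Set
Apart f g = ∀ i j → f i ≢ g j

Complete : FaceFamily n → Triple n → Set
Complete Δ g = ∀ {i j} → i ≢ j → Δ (pair (g i) (g j)) ≡ true

two-triangles : Table 6
two-triangles i j = if toℕ i <ᵇ 3 then toℕ j <ᵇ 3 else not (toℕ j <ᵇ 3)

-- Three strips that join all nine pairs between two triangles.
join-moves : List (Move 6)
join-moves = move u v p r ∷ move v t q p ∷ move t u r q ∷ []
  where
  r q p u v t : Fin 6
  r = zero
  q = suc zero
  p = suc (suc zero)
  u = ↑ zero
  v = ↑ (suc zero)
  t = ↑ (suc (suc zero))

-- g is an old triple that is still to be joined to the newest one.
record Ready {n b d} (R : Realized (3 + n) b d) (g : Triple n) : Set where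
  field
    injective : ∀ {i j} → g i ≡ g j → i ≡ j
    triangle  : Complete (Realized.Δ R) (↑ ∘ g)
    unjoined  : ∀ i j → Realized.Δ R (pair (newest i) (↑ (g j))) ≡ false

module _ {n b d} (R : Realized (3 + n) b d) (top : Complete (Realized.Δ R) newest) {g : Triple n} (ready : Ready R g) where

  open Ready ready
  open Realized R using (Δ)

  ready-table : Matches Δ (cons₃ g) two-triangles
  ready-table =
    matches-suc {Δ = Δ} {cons₃ g} {two-triangles}
      (λ { zero → top {zero} {suc zero} λ () ; (suc zero) → top {zero} {suc (suc zero)} λ () ; (suc (suc j)) → unjoined zero j })
      (λ { zero → refl ; (suc zero) → refl ; (suc (suc j)) → refl })
    (matches-suc {Δ = Δ} {λ (i : Fin 5) → cons₃ g (suc i)} {λ i j → two-triangles (suc i) (suc j)}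
      (λ { zero → top {suc zero} {suc (suc zero)} λ () ; (suc j) → unjoined (suc zero) j })
      (λ { zero → refl ; (suc j) → refl })
    (matches-suc {Δ = Δ} {λ (i : Fin 4) → cons₃ g (suc (suc i))} {λ i j → two-triangles (suc (suc i)) (suc (suc j))}
      (unjoined (suc (suc zero))) (λ _ → refl) triangle))

  join : ∀ q → Strips R (Named (cons₃ g)) (length (take q join-moves))
  join q = proj₁ (strips R (cons₃ g) (cons₃-injective injective) two-triangles ready-table
                         (take q join-moves) (legals-take two-triangles join-moves q refl))

ready-after : ∀ {n b d q} {R : Realized (3 + n) b d} {T : Fin (3 + n) → Set} (S : Strips R T q) {g : Triple n} →
              (∀ j → ¬ T (↑ (g j))) → Ready R g → Ready (Strips.R′ S) g
ready-after {R = R} S {g} untouched ready = record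
  { injective = injective
  ; triangle  = λ i≢j → Strips.old S (triangle i≢j)
  ; unjoined  = λ i j → case true-or-false (Realized.Δ (Strips.R′ S) (pair (newest i) (↑ (g j)))) of λ
      { (inj₂ f) → f
      ; (inj₁ t) → case Strips.new S (newest≢↑ i) t of λ
        { (inj₁ o) → true≢false o (unjoined i j) ; (inj₂ (_ , touched)) → contradiction touched (untouched j) } }
  }
  where open Ready ready

module _ {n : ℕ} where

  open import Data.List.Relation.Unary.All using (All; []; _∷_)
  import Data.List.Relation.Unary.All as All
  open import Data.List.Relation.Unary.AllPairs using (AllPairs; []; _∷_)
  open import Data.List.Relation.Unary.Any using (Any)

  Touches : List (Triple n) → Fin (3 + n) → Set
  Touches gs x = Named newest x ⊎ Any (λ g → Named (↑ ∘ g) x) gs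

  private
    untouched : {g g′ : Triple n} → Apart g g′ → ∀ j → ¬ Named (cons₃ g) (↑ (g′ j))
    untouched {g} apart j named with named-cons₃ g named
    ... | inj₁ (i , e) = newest≢↑ i e
    ... | inj₂ (i , e) = apart i j (↑-injective e)

  join-all : ∀ {b d} (R : Realized (3 + n) b d) → Complete (Realized.Δ R) newest → (gs : List (Triple n)) →
             All (Ready R) gs → AllPairs Apart gs → Strips R (Touches gs) (length gs * 3)
  join-all R top []       []               []              = no-strips R
  join-all R top (g ∷ gs) (ready ∷ readys) (apart ∷ aparts) = weaken-strips
      (λ { (inj₁ named) → case named-cons₃ g named of λ { (inj₁ t) → inj₁ t ; (inj₂ t) → inj₂ (here t) }
         ; (inj₂ (inj₁ t)) → inj₁ t ; (inj₂ (inj₂ t)) → inj₂ (there t) })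
      (more-strips S (join-all (Strips.R′ S) (λ i≢j → Strips.old S (top i≢j)) gs
        (All.zipWith (λ { (ap , re) → ready-after S (untouched ap) re }) (apart , readys)) aparts))
    where
    S = join R top ready 3

  join-some : ∀ {b d} (R : Realized (3 + n) b d) → Complete (Realized.Δ R) newest → (gs : List (Triple n)) →
              All (Ready R) gs → AllPairs Apart gs → ∀ q → q ≤ length gs * 3 → Realized (3 + n) (q * 3 + b) (q * 2 + d)
  join-some R top gs readys aparts 0 le = R
  join-some R top (g ∷ gs) (ready ∷ readys) (apart ∷ aparts) 1 le = Strips.R′ (join R top ready 1)
  join-some R top (g ∷ gs) (ready ∷ readys) (apart ∷ aparts) 2 le = Strips.R′ (join R top ready 2)
  join-some {b} {d} R top (g ∷ gs) (ready ∷ readys) (apart ∷ aparts) (suc (suc (suc q))) (s≤s (s≤s (s≤s le))) =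
    recast (arith q b 3) (arith q d 2)
      (join-some (Strips.R′ S) (λ i≢j → Strips.old S (top i≢j)) gs
        (All.zipWith (λ { (ap , re) → ready-after S (untouched ap) re }) (apart , readys)) aparts q le)
    where
    S = join R top ready 3
    arith : ∀ (q b c : ℕ) → q * c + (3 * c + b) ≡ (3 + q) * c + b
    arith = solve-∀

-- Strips joining a new path r q p to the base path u v … (attached by the edge pu) until r, q, p form a triangle.
record BasePattern (k : ℕ) : Set where
  field
    moves    : List (Move (4 + k))
    count    : length moves ≡ suc k
    ok       : legals path moves ≡ true
    closes : ∀ i j → i ≢ j → after path moves (newest i) (newest j) ≡ true
    keeps     : ∀ i j → i ≢ j → after path moves (↑ i) (↑ j) ≡ path i j

pattern₁ : BasePattern 0
pattern₁ = record
  { moves    = move p u r q ∷ []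
  ; count    = refl
  ; ok       = refl
  ; closes = from-yes (Fin.all? λ i → Fin.all? λ j → ¬? (i Fin.≟ j) →-dec (after path (move p u r q ∷ []) (newest i) (newest j) Bool.≟ true))
  ; keeps     = from-yes (Fin.all? λ i → Fin.all? λ j → ¬? (i Fin.≟ j) →-dec (after path (move p u r q ∷ []) (↑ i) (↑ j) Bool.≟ path i j))
  }
  where
  r q p u : Fin 4
  r = zero
  q = suc zero
  p = suc (suc zero)
  u = ↑ zero

pattern₂ : BasePattern 1
pattern₂ = record
  { moves    = ms
  ; count    = refl
  ; ok       = refl
  ; closes = from-yes (Fin.all? λ i → Fin.all? λ j → ¬? (i Fin.≟ j) →-dec (after path ms (newest i) (newest j) Bool.≟ true))
  ; keeps     = from-yes (Fin.all? λ i → Fin.all? λ j → ¬? (i Fin.≟ j) →-dec (after path ms (↑ i) (↑ j) Bool.≟ path i j))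
  }
  where
  r q p u v : Fin 5
  r = zero
  q = suc zero
  p = suc (suc zero)
  u = ↑ zero
  v = ↑ (suc zero)
  ms : List (Move 5)
  ms = move q r u v ∷ move q p v r ∷ []

pattern₃ : BasePattern 2
pattern₃ = record
  { moves    = ms
  ; count    = refl
  ; ok       = refl
  ; closes = from-yes (Fin.all? λ i → Fin.all? λ j → ¬? (i Fin.≟ j) →-dec (after path ms (newest i) (newest j) Bool.≟ true))
  ; keeps     = from-yes (Fin.all? λ i → Fin.all? λ j → ¬? (i Fin.≟ j) →-dec (after path ms (↑ i) (↑ j) Bool.≟ path i j))
  }
  where
  r q p u v t : Fin 6
  r = zero
  q = suc zero
  p = suc (suc zero)
  u = ↑ zero
  v = ↑ (suc zero)
  t = ↑ (suc (suc zero))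
  ms : List (Move 6)
  ms = move p q v u ∷ move q r t v ∷ move u p r t ∷ []

module Stages {k : ℕ} (pattern′ : BasePattern k) where

  open import Data.List.Relation.Unary.All using (All; []; _∷_)
  import Data.List.Relation.Unary.All as All
  import Data.List.Relation.Unary.All.Properties as All
  open import Data.List.Relation.Unary.AllPairs using (AllPairs; []; _∷_)
  import Data.List.Relation.Unary.AllPairs as AllPairs
  import Data.List.Relation.Unary.AllPairs.Properties as AllPairs
  open import Data.List.Relation.Unary.Any using (Any)
  open BasePattern pattern′

  record Block₃ {n b d} (R : Realized n b d) (base : Fin (suc k) → Fin n) (g : Triple n) : Set where
    field
      injective : ∀ {i j} → g i ≡ g j → i ≡ j
      off-hub   : ∀ i → hubOf R ≢ g i
      off-base  : Apart base g
      triangle  : Complete (Realized.Δ R) g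

  -- The vertices other than the hub: the base path and m complete triples.
  record Stage (n m b d : ℕ) : Set where
    field
      R      : Realized n b d
      base   : PathIn R k
      blocks : List (Triple n)
      count₃ : length blocks ≡ m
      good   : All (Block₃ R (PathIn.vertexAt base)) blocks
      apart  : AllPairs Apart blocks

  module Next {n m b d} (S : Stage n m b d) where

    open Stage S

    private
      base₁ = extend-path R base
      base₂ = extend-path _ base₁
      base₃ = extend-path _ base₂
      module C₁ = Cone R (PathIn.off-hub base zero)
      module C₂ = Cone C₁.R⁺ (PathIn.off-hub base₁ zero)
      module C₃ = Cone C₂.R⁺ (PathIn.off-hub base₂ zero)

    R₃ : Realized (3 + n) b d
    R₃ = C₃.R⁺

    open PathIn base using (vertexAt)

    strips-on-base : (q : ℕ) → Strips R₃ (Named (cons₃ vertexAt)) (length (take q moves))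
    strips-on-base q = proj₁ (strips R₃ (cons₃ vertexAt) (PathIn.injective base₃) path (PathIn.matches base₃)
                                     (take q moves) (legals-take path moves q ok))

    all-strips : Matched R₃ (cons₃ vertexAt) (after path moves) (length moves)
    all-strips = strips R₃ (cons₃ vertexAt) (PathIn.injective base₃) path (PathIn.matches base₃) moves ok

    private
      S₀ = proj₁ all-strips
      R₀ = Strips.R′ S₀
      Δ₀ = Realized.Δ R₀

    top : Complete Δ₀ newest
    top {i} {j} i≢j = trans (cong₂ (λ a b → Δ₀ (pair a b)) (sym (cons₃-newest vertexAt i)) (sym (cons₃-newest vertexAt j)))
      (trans (proj₂ all-strips (λ e → i≢j (newest-injective e))) (closes i j i≢j))

    readys : All (Ready R₀) blocks
    readys = All.map ready good
      where
      ready : ∀ {g} → Block₃ R vertexAt g → Ready R₀ g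
      ready {g} B = ready-after S₀ (λ j named → case named-cons₃ vertexAt named of λ
            { (inj₁ (i , e)) → newest≢↑ i e ; (inj₂ (i , e)) → off-base i j (↑-injective e) })
          (record { injective = injective ; triangle = triangle′ ; unjoined = unjoined })
        where
        open Block₃ B renaming (triangle to triangle′)
        unjoined : ∀ i j → Realized.Δ R₃ (pair (newest i) (↑ (g j))) ≡ false
        unjoined zero             j = C₃.spoke-none (λ e → off-hub j (Fin.suc-injective (Fin.suc-injective e))) λ ()
        unjoined (suc zero)       j = C₂.spoke-none (λ e → off-hub j (Fin.suc-injective e)) λ ()
        unjoined (suc (suc zero)) j = C₁.spoke-none (off-hub j) (λ e → off-base zero j (sym e))

    partially : ∀ q → q ≤ suc k + m * 3 → Realized (3 + n) (q * 3 + b) (q * 2 + d)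
    partially q q≤ with ℕ.≤-total q (suc k)
    ... | inj₁ q≤k = subst (λ q → Realized (3 + n) (q * 3 + b) (q * 2 + d)) length-q (Strips.R′ (strips-on-base q))
      where
      length-q : length (take q moves) ≡ q
      length-q = trans (length-take q moves) (trans (cong (q ⊓_) count) (ℕ.m≤n⇒m⊓n≡m q≤k))
    ... | inj₂ k<q with ≤-diff k<q
    ...   | q′ , refl = recast (arith q′ b 3) (arith q′ d 2)
            (join-some R₀ top blocks readys apart q′ (subst (λ l → q′ ≤ l * 3) (sym count₃) (ℕ.+-cancelˡ-≤ (suc k) _ _ q≤)))
      where
      arith′ : ∀ (q b c l : ℕ) → q * c + (l * c + b) ≡ (l + q) * c + b
      arith′ = solve-∀
      arith : ∀ (q b c : ℕ) → q * c + (length moves * c + b) ≡ (suc k + q) * c + b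
      arith q b c = trans (arith′ q b c (length moves)) (cong (λ l → (l + q) * c + b) count)

    private
      Sₘ = join-all R₀ top blocks readys apart
      total = more-strips S₀ Sₘ
      R′ = Strips.R′ total
      Δ′ = Realized.Δ R′

      untouched : ∀ i → ¬ Touches blocks (↑ (vertexAt i))
      untouched i (inj₁ (j , e)) = newest≢↑ j e
      untouched i (inj₂ touched) = absurd good touched
        where
        absurd : ∀ {gs} → All (Block₃ R vertexAt) gs → ¬ Any (λ g → Named (↑ ∘ g) (↑ (vertexAt i))) gs
        absurd (B ∷ Bs) (here (j , e))  = Block₃.off-base B i j (sym (↑-injective e))
        absurd (B ∷ Bs) (there touched) = absurd Bs touched

      base′ : PathIn R′ k
      base′ = record
        { vertexAt  = ↑ ∘ vertexAt
        ; injective = λ e → PathIn.injective base (↑-injective e)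
        ; off-hub   = λ i e → PathIn.off-hub base₃ (↑ i) (trans (sym (Strips.hub≡ total)) e)
        ; matches   = λ {i} {j} i≢j → trans (same i≢j) (trans (proj₂ all-strips (λ e → i≢j (↑-injective e))) (keeps i j i≢j))
        }
        where
        same : ∀ {i j} → i ≢ j → Δ′ (pair (↑ (vertexAt i)) (↑ (vertexAt j))) ≡ Δ₀ (pair (↑ (vertexAt i)) (↑ (vertexAt j)))
        same {i} {j} i≢j = bool-iff
          (λ t → case Strips.new Sₘ (λ e → i≢j (PathIn.injective base (↑-injective e))) t of λ
            { (inj₁ o) → o ; (inj₂ (touched , _)) → contradiction touched (untouched i) })
          (Strips.old Sₘ)

    next : Stage (3 + n) (suc m) ((suc k + m * 3) * 3 + b) ((suc k + m * 3) * 2 + d)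
    next = record
      { R      = recast (arith b 3) (arith d 2) R′
      ; base   = record { PathIn base′ }
      ; blocks = newest ∷ map (↑ ∘_) blocks
      ; count₃ = cong suc (trans (length-map (↑ ∘_) blocks) count₃)
      ; good   = record
          { injective = newest-injective
          ; off-hub   = λ i e → newest≢↑ i (sym (trans (sym (Strips.hub≡ total)) e))
          ; off-base  = λ i j e → newest≢↑ j (sym e)
          ; triangle  = λ i≢j → Strips.old Sₘ (top i≢j) }
          ∷ All.map⁺ (All.map lift-block good)
      ; apart  = All.map⁺ (All.universal (λ g i j → newest≢↑ i) blocks)
          ∷ AllPairs.map⁺ (AllPairs.map (λ ap i j e → ap i j (↑-injective e)) apart)
      }
      where
      arith : ∀ b c → (length moves + length blocks * 3) * c + b ≡ (suc k + m * 3) * c + b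
      arith b c = cong₂ (λ l m → (l + m * 3) * c + b) count count₃
      lift-block : ∀ {g} → Block₃ R vertexAt g → Block₃ (recast (arith b 3) (arith d 2) R′) (↑ ∘ vertexAt) (↑ ∘ g)
      lift-block B = record
        { injective = λ e → injective (↑-injective e)
        ; off-hub   = λ i e → off-hub i (↑-injective (trans (sym (Strips.hub≡ total)) e))
        ; off-base  = λ i j e → off-base i j (↑-injective e)
        ; triangle  = λ i≢j → Strips.old total (Block₃.triangle B i≢j) }
        where open Block₃ B

  nodes : ℕ → ℕ
  nodes zero    = 2 + k
  nodes (suc m) = 3 + nodes m

  steps : ℕ → ℕ
  steps zero    = 0
  steps (suc m) = (suc k + m * 3) + steps m

  stage-zero : Stage (2 + k) 0 0 0
  stage-zero = record { R = proj₁ (initial k) ; base = proj₂ (initial k) ; blocks = [] ; count₃ = refl ; good = [] ; apart = [] }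
    where
    initial : ∀ k → Σ (Realized (2 + k) 0 0) (λ R → PathIn R k)
    initial zero = edge-realized , record
      { vertexAt = λ _ → suc zero ; injective = λ { {zero} {zero} _ → refl } ; off-hub = λ _ () ; matches = λ { {zero} {zero} i≢j → contradiction refl i≢j } }
    initial (suc k) = _ , extend-path (proj₁ (initial k)) (proj₂ (initial k))

  stage : ∀ m → Stage (nodes m) m (steps m * 3) (steps m * 2)
  stage zero    = stage-zero
  stage (suc m) = subst₂ (Stage (nodes (suc m)) (suc m)) (sym (ℕ.*-distribʳ-+ 3 (suc k + m * 3) (steps m)))
                         (sym (ℕ.*-distribʳ-+ 2 (suc k + m * 3) (steps m))) (Next.next (stage m))

  negative : ∀ m q → q ≤ steps m → Realized (nodes m) (q * 3) (q * 2)
  negative zero    zero le = Stage.R stage-zero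
  negative (suc m) q le with ℕ.≤-total q (steps m)
  ... | inj₁ q≤ = enlarge 3 (2≤nodes m) (negative m q q≤)
    where
    2≤nodes : ∀ m → 2 ≤ nodes m
    2≤nodes zero    = s≤s (s≤s z≤n)
    2≤nodes (suc m) = ℕ.≤-trans (2≤nodes m) (ℕ.m≤n+m (nodes m) 3)
  ... | inj₂ ≤q with ≤-diff ≤q
  ...   | q′ , refl = recast (arith q′ (steps m) 3) (arith q′ (steps m) 2)
          (Next.partially (stage m) q′ (ℕ.+-cancelʳ-≤ (steps m) q′ _ (subst (_≤ steps (suc m)) (ℕ.+-comm (steps m) q′) le)))
    where
    arith : ∀ (q t c : ℕ) → q * c + t * c ≡ (t + q) * c
    arith = solve-∀

-- Realizing all vectors

tri-cancel-< : ∀ {a b} → tri a < tri b → a < b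
tri-cancel-< {a} {b} lt with ℕ.<-≤-connex a b
... | inj₁ a<b = a<b
... | inj₂ b≤a = contradiction lt (ℕ.≤⇒≯ (tri-mono b≤a))

tri-cancel-≤ : ∀ {a b} → tri a ≤ tri b → a ≤ b
tri-cancel-≤ {a} {b} le = ℕ.≤-pred (tri-cancel-< (ℕ.≤-<-trans le (s≤s (ℕ.m≤n+m (tri b) b))))

subset-of-size : ∀ {r N} → r ≤ N → ∃[ U ] (∣_∣ {N} U ≡ r)
subset-of-size {N = N} z≤n = ∅ , Sub.∣⊥∣≡0 N
subset-of-size (s≤s r≤N) with subset-of-size r≤N
... | U , e = true ∷ U , cong suc e

-- A connected graph on 2 + r vertices: all edges at the first vertex and y others.
module Fan {r y N} (r<N : 1 + r ≤ N) (y≤ : y ≤ tri r) where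

  private
    U : Subset N
    U = proj₁ (subset-of-size r<N)
    ∣U∣ : ∣ U ∣ ≡ 1 + r
    ∣U∣ = proj₂ (subset-of-size r<N)
    truncated = truncate (_⊆ᵇ U) 2 y (subst (y ≤_) (sym (trans (cnt-⊆ᵇ U 2) (trans (cong (_C 2) ∣U∣) ([1+n]C2≡tri r)))) y≤)
    Ψ : FaceFamily N
    Ψ = proj₁ truncated
    Ψ⁻ : ∀ F → Ψ F ≡ true → (F ⊆ᵇ U) ≡ true × ∣ F ∣ ≡ 2
    Ψ⁻ = proj₁ (proj₂ truncated)
    points : FaceFamily N
    points F = (∣ F ∣ ≤ᵇ 1) ∧ (F ⊆ᵇ U)
    rim : FaceFamily N
    rim F = points F ∨ Ψ F
    points⁻ : ∀ {F} → points F ≡ true → ∣ F ∣ ≤ 1 × F ⊆ U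
    points⁻ {F} e with true∧ {∣ F ∣ ≤ᵇ 1} e
    ... | p , q = true-≤ᵇ p , ⊆ᵇ-sound {F = F} {U} q
    points⁺ : ∀ {F} → ∣ F ∣ ≤ 1 → F ⊆ U → points F ≡ true
    points⁺ {F} p q = ∧true (≤ᵇ-true p) (⊆ᵇ-complete {F = F} {U} q)
    rim⁻ : ∀ {F} → rim F ≡ true → ∣ F ∣ ≤ 2 × F ⊆ U
    rim⁻ {F} e with true∨ {points F} e
    ... | inj₁ p = ℕ.≤-trans (proj₁ (points⁻ {F} p)) (s≤s z≤n) , proj₂ (points⁻ {F} p)
    ... | inj₂ q = ℕ.≤-reflexive (proj₂ (Ψ⁻ F q)) , ⊆ᵇ-sound {F = F} {U} (proj₁ (Ψ⁻ F q))
    points⇒rim : ∀ {F} → points F ≡ true → rim F ≡ true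
    points⇒rim e rewrite e = refl
    rim-closed : ∀ {F G} → G ⊆ F → rim F ≡ true → rim G ≡ true
    rim-closed {F} {G} G⊆F e with ℕ.≤-<-connex ∣ G ∣ 1
    ... | inj₁ G≤1 = points⇒rim {G} (points⁺ {G} G≤1 (proj₂ (rim⁻ {F} e) ∘ G⊆F))
    ... | inj₂ 2≤G = subst (λ H → rim H ≡ true) (sym (⊆-size-≡ G⊆F (ℕ.≤-antisym (Sub.p⊆q⇒∣p∣≤∣q∣ G⊆F)
                       (ℕ.≤-trans (proj₁ (rim⁻ {F} e)) 2≤G)))) e

  fan : FaceFamily (suc N)
  fan = ext rim points

  private
    spoke : ∀ {u} → u ∈ U → fan (pair zero (suc u)) ≡ true
    spoke {u} u∈U = trans (ext-spoke rim points u) (points⁺ {⁅ u ⁆} (ℕ.≤-reflexive (Sub.∣⁅x⁆∣≡1 u)) (⁅⁆-⊆ u∈U))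
    spoke′ : ∀ {u} → u ∈ U → fan (pair (suc u) zero) ≡ true
    spoke′ {u} u∈U = trans (cong fan (pair-comm (suc u) zero)) (spoke u∈U)
    rim-vertex : ∀ {u} → rim ⁅ u ⁆ ≡ true → u ∈ U
    rim-vertex {u} e = proj₂ (rim⁻ {⁅ u ⁆} e) (Sub.x∈⁅x⁆ u)
    inhabited : ∃[ u ] u ∈ U
    inhabited with uncons U ∣U∣
    ... | u , G , e , _ , _ = u , subst (u ∈_) (sym e) ∈-cons
    fan-size : ∀ F → fan F ≡ true → ∣ F ∣ ≤ 2
    fan-size (false ∷ F) e = proj₁ (rim⁻ {F} e)
    fan-size (true ∷ F)  e = s≤s (proj₁ (points⁻ {F} e))
    fan-closed : ∀ F G → G ⊆ F → fan F ≡ true → fan G ≡ true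
    fan-closed (false ∷ F) (false ∷ G) G⊆F e = rim-closed {F} {G} (Sub.drop-∷-⊆ G⊆F) e
    fan-closed (false ∷ F) (true ∷ G)  G⊆F e = case G⊆F Vec.here of λ ()
    fan-closed (true ∷ F)  (false ∷ G) G⊆F e = rim-closed {F} {G} (Sub.drop-∷-⊆ G⊆F) (points⇒rim {F} e)
    fan-closed (true ∷ F)  (true ∷ G)  G⊆F e with points⁻ {F} e
    ... | F≤1 , F⊆U = points⁺ {G} (ℕ.≤-trans (Sub.p⊆q⇒∣p∣≤∣q∣ (Sub.drop-∷-⊆ G⊆F)) F≤1) (F⊆U ∘ Sub.drop-∷-⊆ G⊆F)

  fan-empty : ∀ {F} → ∣ F ∣ ≡ 0 → points F ≡ true
  fan-empty {F} e = points⁺ {F} (subst (_≤ 1) (sym e) z≤n)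
    (subst (_⊆ U) (sym (∣F∣≡0⇒∅ F e)) Sub.⊥⊆)

  fan-hub : fan ⁅ zero ⁆ ≡ true
  fan-hub = fan-empty {∅} (Sub.∣⊥∣≡0 N)

  fan-attachable : Attachable (complete (suc N)) fan
  fan-attachable = record
    { empty     = points⇒rim {∅} (fan-empty {∅} (Sub.∣⊥∣≡0 N))
    ; closed    = λ {F} {G} → fan-closed F G
    ; inside    = λ {F} e → ≤ᵇ-true (ℕ.≤-trans (fan-size F e) (s≤s (s≤s z≤n)))
    ; graph     = λ {F} → fan-size F
    ; connected = zero , λ { {zero} e → ε ; {suc u} e → ((λ ()) , spoke′ (rim-vertex e)) ◅ ε }
    ; anchored  = λ { {zero} e → inj₁ (suc (proj₁ inhabited) , (λ ()) , spoke (proj₂ inhabited))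
                    ; {suc u} e → inj₁ (zero , (λ ()) , spoke′ (rim-vertex e)) }
    }

  private
    cnt-points : ∀ {s} → s ≤ 1 → cnt points s ≡ (1 + r) C s
    cnt-points {s} s≤1 = trans (cnt-cong-at {Γ = points} {_⊆ᵇ U} s (λ F e → cong (_∧ (F ⊆ᵇ U)) (≤ᵇ-true (subst (_≤ 1) (sym e) s≤1))))
                               (trans (cnt-⊆ᵇ U s) (cong (_C s) ∣U∣))
    Ψ-size : ∀ F → ∣ F ∣ ≢ 2 → Ψ F ≡ false
    Ψ-size F ≢2 with true-or-false (Ψ F)
    ... | inj₁ t = contradiction (proj₂ (Ψ⁻ F t)) ≢2
    ... | inj₂ f = f

  fan-vertices : cnt fan 1 ≡ 2 + r
  fan-vertices = trans (cong₂ _+_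
    (trans (cnt-cong-at {Γ = rim} {points} 1 (λ F e → trans (cong (points F ∨_) (Ψ-size F (λ e₂ → case trans (sym e) e₂ of λ ()))) (Bool.∨-identityʳ _)))
           (trans (cnt-points ℕ.≤-refl) (nC1≡n (1 + r))))
    (cnt-points z≤n)) (ℕ.+-comm (1 + r) 1)

  fan-edges : cnt fan 2 ≡ 1 + (r + y)
  fan-edges = trans (cong₂ _+_
    (trans (cnt-cong-at {Γ = rim} {Ψ} 2 (λ F e → cong (_∨ Ψ F) (too-big F e))) (proj₂ (proj₂ truncated)))
    (trans (cnt-points ℕ.≤-refl) (nC1≡n (1 + r)))) (ℕ.+-comm y (1 + r))
    where
    too-big : ∀ F → ∣ F ∣ ≡ 2 → points F ≡ false
    too-big F e with true-or-false (points F)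
    ... | inj₂ f = f
    ... | inj₁ t = contradiction (subst (_≤ 1) e (proj₁ (points⁻ {F} t))) λ { (s≤s ()) }

descend : ∀ c μ r → r ≤ suc μ → c ≤ tet μ + tri r →
          ∃[ μ′ ] ∃[ r′ ] ∃[ y ] (r′ ≤ suc μ′ × c ≡ tet μ′ + y × y ≤ tri r′ × tri μ′ + r′ ≤ tri μ + r)
descend c μ r r≤ c≤ with ℕ.≤-<-connex (tet μ) c
... | inj₁ tet≤c with ≤-diff tet≤c
...   | y , refl = μ , r , y , r≤ , refl , ℕ.+-cancelˡ-≤ (tet μ) y (tri r) c≤ , ℕ.≤-refl
descend c (suc μ) r r≤ c≤ | inj₂ c< with descend c μ (suc μ) ℕ.≤-refl (ℕ.<⇒≤ (subst (c <_) (ℕ.+-comm (tri (suc μ)) (tet μ)) c<))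
... | μ′ , r′ , y , r′≤ , c≡ , y≤ , le = μ′ , r′ , y , r′≤ , c≡ , y≤
      , ℕ.≤-trans le (ℕ.≤-trans (ℕ.≤-reflexive (ℕ.+-comm (tri μ) (suc μ))) (ℕ.m≤m+n (tri (suc μ)) r))

nonnegative : ∀ a b c → b ≤ tri a → c ≤ b ^⟨ 2 ⟩ → Realized (3 + a) b (b + c)
nonnegative a b c b≤ c≤ with toBlock b
... | block m r r≤m refl with descend c m r (ℕ.≤-trans r≤m (ℕ.n≤1+n m)) (subst (c ≤_) (^⟨2⟩-block m r r≤m) c≤)
... | μ , zero , zero , _ , refl , _ , b₀≤ = filled
  where
  μ≤a : μ ≤ a
  μ≤a = tri-cancel-≤ (ℕ.≤-trans (ℕ.m≤m+n (tri μ) 0) (ℕ.≤-trans b₀≤ b≤))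
  filled : Realized (3 + a) (tri m + r) (tri m + r + (tet μ + 0))
  filled with ≤-diff μ≤a | ≤-diff b₀≤
  ... | j , refl | i , e = recast (trans (arith₁ i (tri μ)) e) (trans (arith₂ i (tri μ) (tet μ)) (cong (_+ (tet μ + 0)) e))
    (fill i (subst (_≤ tri (μ + j)) (sym (trans (cong (_+ i) (sym (ℕ.+-identityʳ (tri μ)))) e)) b≤)
      (subst (λ n → Realized n (tri μ) (tri μ + tet μ)) (arith₃ j μ) (enlarge j (s≤s (s≤s z≤n)) (complete-realized μ))))
    where
    arith₁ : ∀ (i t : ℕ) → i + t ≡ t + 0 + i
    arith₁ = solve-∀
    arith₂ : ∀ (i t u : ℕ) → i + (t + u) ≡ t + 0 + i + (u + 0)
    arith₂ = solve-∀
    arith₃ : ∀ (j μ : ℕ) → j + (3 + μ) ≡ 3 + (μ + j)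
    arith₃ = solve-∀
... | μ , suc r′ , y , r′≤ , refl , y≤ , b₀≤ = filled
  where
  open Fan {suc r′} {y} {2 + μ} (s≤s r′≤) y≤
  μ<a : μ < a
  μ<a = tri-cancel-< (ℕ.≤-trans (ℕ.≤-trans (s≤s (ℕ.m≤m+n (tri μ) r′)) (ℕ.≤-reflexive (sym (ℕ.+-suc (tri μ) r′)))) (ℕ.≤-trans b₀≤ b≤))
  attached : Realized (4 + μ) (tri μ + suc r′) (tri μ + tet μ + (suc r′ + y))
  attached = ext-realized (suc r′) (suc r′ + y) (complete-realized μ) fan-attachable fan-hub fan-vertices fan-edges
  filled : Realized (3 + a) (tri m + r) (tri m + r + (tet μ + y))
  filled with ≤-diff μ<a | ≤-diff b₀≤
  ... | j , refl | i , e = recast (trans (ℕ.+-comm i (tri μ + suc r′)) e)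
        (trans (arith₁ i (tri μ) (tet μ) (suc r′) y) (cong (_+ (tet μ + y)) e))
    (fill i (subst (_≤ tri (suc μ + j)) (sym e) b≤)
      (subst (λ n → Realized n (tri μ + suc r′) (tri μ + tet μ + (suc r′ + y))) (arith₂ j μ)
        (enlarge j (s≤s (s≤s z≤n)) attached)))
    where
    arith₁ : ∀ (i t u r y : ℕ) → i + (t + u + (r + y)) ≡ t + r + i + (u + y)
    arith₁ = solve-∀
    arith₂ : ∀ (j μ : ℕ) → j + (4 + μ) ≡ 3 + ((1 + μ) + j)
    arith₂ = solve-∀

third-cancel : ∀ {q t δ} → δ ≤ 2 → q * 3 ≤ t * 3 + δ → q ≤ t
third-cancel {q} {t} {δ} δ≤2 le = ℕ.≤-pred (ℕ.*-cancelʳ-< 3 q (suc t)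
  (ℕ.≤-<-trans le (subst (t * 3 + δ <_) (ℕ.+-comm (t * 3) 3) (ℕ.+-monoʳ-< (t * 3) (s≤s δ≤2)))))

negative-exists : ∀ a q → q * 3 ≤ tri a → Realized (3 + a) (q * 3) (q * 2)
negative-exists a q le with thirds a
  where
  thirds : ∀ a → ∃[ m ] (a ≡ m * 3 ⊎ a ≡ 1 + m * 3 ⊎ a ≡ 2 + m * 3)
  thirds 0 = 0 , inj₁ refl
  thirds 1 = 0 , inj₂ (inj₁ refl)
  thirds 2 = 0 , inj₂ (inj₂ refl)
  thirds (suc (suc (suc a))) with thirds a
  ... | m , inj₁ refl        = suc m , inj₁ refl
  ... | m , inj₂ (inj₁ refl) = suc m , inj₂ (inj₁ refl)
  ... | m , inj₂ (inj₂ refl) = suc m , inj₂ (inj₂ refl)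
... | m , inj₁ refl = subst (λ n → Realized n (q * 3) (q * 2)) (size m)
    (negative m q (third-cancel z≤n (subst (q * 3 ≤_) (total m) le)))
  where
  open Stages pattern₂
  size : ∀ m → nodes m ≡ 3 + m * 3
  size zero    = refl
  size (suc m) = cong (λ k → 3 + k) (size m)
  total : ∀ m → tri (m * 3) ≡ steps m * 3 + 0
  total zero    = refl
  total (suc m) rewrite total m = arith m (steps m)
    where
    arith : ∀ (m t : ℕ) → 3 + m * 3 + (2 + m * 3 + (1 + m * 3 + (t * 3 + 0))) ≡ (2 + m * 3 + t) * 3 + 0
    arith = solve-∀
... | m , inj₂ (inj₁ refl) = subst (λ n → Realized n (q * 3) (q * 2)) (size m)
    (negative m q (third-cancel (s≤s z≤n) (subst (q * 3 ≤_) (total m) le)))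
  where
  open Stages pattern₃
  size : ∀ m → nodes m ≡ 3 + (1 + m * 3)
  size zero    = refl
  size (suc m) = cong (λ k → 3 + k) (size m)
  total : ∀ m → tri (1 + m * 3) ≡ steps m * 3 + 1
  total zero    = refl
  total (suc m) rewrite total m = arith m (steps m)
    where
    arith : ∀ (m t : ℕ) → 4 + m * 3 + (3 + m * 3 + (2 + m * 3 + (t * 3 + 1))) ≡ (3 + m * 3 + t) * 3 + 1
    arith = solve-∀
... | m , inj₂ (inj₂ refl) = subst (λ n → Realized n (q * 3) (q * 2)) (size m)
    (negative (suc m) q (third-cancel z≤n (subst (q * 3 ≤_) (total m) le)))
  where
  open Stages pattern₁
  size : ∀ m → nodes (suc m) ≡ 3 + (2 + m * 3)
  size zero    = refl
  size (suc m) = cong (λ k → 3 + k) (size m)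
  total : ∀ m → tri (2 + m * 3) ≡ steps (suc m) * 3 + 0
  total zero    = refl
  total (suc m) rewrite total m = arith m (steps (suc m))
    where
    arith : ∀ (m t : ℕ) → 5 + m * 3 + (4 + m * 3 + (3 + m * 3 + (t * 3 + 0))) ≡ (1 + (3 + m * 3) + t) * 3 + 0
    arith = solve-∀

nonpositive : ∀ a b q → b ≤ tri a → q * 3 ≤ b → ∃[ d ] (d + q ≡ b × Realized (3 + a) b d)
nonpositive a b q b≤ 3q≤b with ≤-diff 3q≤b
... | i , refl = i + q * 2 , arith i q , recast (ℕ.+-comm i (q * 3)) refl (fill i b≤ (negative-exists a q (ℕ.≤-trans 3q≤b b≤)))
  where
  arith : ∀ (i q : ℕ) → i + q * 2 + q ≡ q * 3 + i
  arith = solve-∀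

record Surface (n e t : ℕ) : Set where
  field
    Δ         : FaceFamily n
    pure₃     : Pure₃ Δ
    connected : ∀ v → Connected (link Δ ⁅ v ⁆)
    edges     : cnt Δ 2 ≡ e
    tris      : cnt Δ 3 ≡ t

realized⇒surface : ∀ {a b d} → Realized (3 + a) b d → Surface (3 + a) (3 + 2 * a + b) (1 + a + d)
realized⇒surface {a} {b} {d} R = record
  { Δ = Δ ; pure₃ = hubbed⇒pure₃ hubbed ; connected = Hubbed.connected hubbed
  ; edges = ℕ.+-cancelʳ-≡ 3 _ _ (trans edges (arith₁ a b)) ; tris = ℕ.+-cancelʳ-≡ 2 _ _ (trans tris (arith₂ a d)) }
  where
  open Realized R
  arith₁ : ∀ (a b : ℕ) → 2 * (3 + a) + b ≡ (3 + 2 * a + b) + 3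
  arith₁ = solve-∀
  arith₂ : ∀ (a d : ℕ) → (3 + a) + d ≡ (1 + a + d) + 2
  arith₂ = solve-∀

isolated-attachable : {Δ : FaceFamily n} → Tame Δ → {U : Subset n} → Δ U ≡ true → ∣ U ∣ ≤ 1 → (r : Fin n) → (∀ {y} → y ∈ U → y ≡ r) →
  (∀ {v y} → v ∈ U → v ≢ y → Δ (pair v y) ≡ false) → Attachable Δ (_⊆ᵇ U)
isolated-attachable {n} {Δ} tame {U} ΔU U≤1 r only isolated = record
  { empty     = ⊆ᵇ-complete {F = ∅} {U} Sub.⊥⊆
  ; closed    = λ {F} {G} G⊆F e → ⊆ᵇ-complete {F = G} {U} (⊆ᵇ-sound {F = F} {U} e ∘ G⊆F)
  ; inside    = λ {F} e → Tame.down tame (⊆ᵇ-sound {F = F} {U} e) ΔU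
  ; graph     = λ {F} e → ℕ.≤-trans (Sub.p⊆q⇒∣p∣≤∣q∣ (⊆ᵇ-sound {F = F} {U} e)) (ℕ.≤-trans U≤1 (s≤s z≤n))
  ; connected = r , λ {y} e → case only (member y e) of λ { refl → ε }
  ; anchored  = λ {v} e → inj₂ (λ {y} → isolated (member v e))
  }
  where
  member : ∀ y → (⁅ y ⁆ ⊆ᵇ U) ≡ true → y ∈ U
  member y e = ⊆ᵇ-sound {F = ⁅ y ⁆} {U} e (Sub.x∈⁅x⁆ y)

module Disjoint {n e t} (S : Surface (suc n) e t) where

  open Surface S
  open Pure₃ pure₃

  private
    tame₀ : Tame Δ
    tame₀ = record { simplicial = simplicial ; small = small ; connected = connected }

    Δ₁ = ext Δ (_⊆ᵇ ∅)

    tame₁ : Tame Δ₁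
    tame₁ = ext-tame tame₀ (isolated-attachable tame₀ (Tame.empty-face tame₀ zero) (subst (_≤ 1) (sym (Sub.∣⊥∣≡0 (suc n))) z≤n)
      zero (λ y∈∅ → contradiction y∈∅ Sub.∉⊥) (λ y∈∅ → contradiction y∈∅ Sub.∉⊥))

    Δ₂ = ext Δ₁ (_⊆ᵇ ⁅ zero ⁆)

    tame₂ : Tame Δ₂
    tame₂ = ext-tame tame₁ (isolated-attachable tame₁ (proj₁ (Tame.simplicial tame₁) zero) (ℕ.≤-reflexive (Sub.∣⁅x⁆∣≡1 {suc (suc n)} zero))
      zero (Sub.x∈⁅y⁆⇒x≡y zero) isolated)
      where
      isolated : ∀ {v y} → v ∈ ⁅ zero ⁆ → v ≢ y → Δ₁ (pair v y) ≡ false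
      isolated {v} {y} v∈ v≢y with Sub.x∈⁅y⁆⇒x≡y zero v∈
      isolated {_} {zero}  v∈ v≢y | refl = contradiction refl v≢y
      isolated {_} {suc y} v∈ v≢y | refl with true-or-false (Δ₁ (pair zero (suc y)))
      ... | inj₂ f  = f
      ... | inj₁ tr = contradiction (⊆ᵇ-sound {F = ⁅ y ⁆} {∅} (trans (sym (ext-spoke Δ (_⊆ᵇ ∅) y)) tr) (Sub.x∈⁅x⁆ y)) Sub.∉⊥

    e₀₁ : Δ₂ (pair zero (suc zero)) ≡ true
    e₀₁ = trans (ext-spoke Δ₁ (_⊆ᵇ ⁅ zero ⁆) zero) (⊆ᵇ-complete {F = ⁅ zero {suc n} ⁆} {⁅ zero ⁆} id)

    L = edge-link {suc (suc (suc n))} zero (suc zero)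

  with-triangle : FaceFamily (3 + suc n)
  with-triangle = ext Δ₂ L

  private
    tame₃ : Tame with-triangle
    tame₃ = ext-tame tame₂ (edge-attachable tame₂ {zero} {suc zero} (λ ()) e₀₁)

    spoke : ∀ y → y ∈ pair zero (suc zero) → with-triangle (pair zero (suc y)) ≡ true
    spoke y y∈ = trans (ext-spoke Δ₂ L y) (⊆ᵇ-complete {F = ⁅ y ⁆} {pair zero (suc zero)} (⁅⁆-⊆ y∈))

    p₀₁ : with-triangle (pair zero (suc zero)) ≡ true
    p₀₁ = spoke zero (∈-cons {x = zero} {G = ⁅ suc zero ⁆})
    p₀₂ : with-triangle (pair zero (suc (suc zero))) ≡ true
    p₀₂ = spoke (suc zero) (∈-pairʳ {y = suc zero} {x = zero})

    flip : ∀ x y → with-triangle (pair x y) ≡ true → with-triangle (pair y x) ≡ true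
    flip x y = trans (cong with-triangle (pair-comm y x))

    nbrs₂ : ∀ x → ∃₂ λ y z → x ≢ y × x ≢ z × y ≢ z × with-triangle (pair x y) ≡ true × with-triangle (pair x z) ≡ true
    nbrs₂ zero             = suc zero , suc (suc zero) , (λ ()) , (λ ()) , (λ ()) , p₀₁ , p₀₂
    nbrs₂ (suc zero)       = zero , suc (suc zero) , (λ ()) , (λ ()) , (λ ()) , flip zero (suc zero) p₀₁ , e₀₁
    nbrs₂ (suc (suc zero)) = zero , suc zero , (λ ()) , (λ ()) , (λ ()) , flip zero (suc (suc zero)) p₀₂ , flip (suc zero) (suc (suc zero)) e₀₁
    nbrs₂ (suc (suc (suc x))) with vertex-triangle x
    ... | y , z , x≢y , x≢z , y≢z , xyz = ↑ y , ↑ z , x≢y ∘ ↑-injective , x≢z ∘ ↑-injective , y≢z ∘ ↑-injective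
        , down (pair-⊆ ∈-cons (∈-there ∈-cons)) xyz , down (pair-⊆ ∈-cons (∈-there ∈-pairʳ)) xyz

  surface : Surface (3 + suc n) (3 + e) (1 + t)
  surface = record
    { Δ = with-triangle ; pure₃ = tame⇒pure₃ tame₃ nbrs₂ ; connected = Tame.connected tame₃
    ; edges = trans (cong₂ _+_ (cong₂ _+_ (cong₂ _+_ edges (count {suc n} ∅ 1 (Sub.∣⊥∣≡0 (suc n)))) (count {suc (suc n)} ⁅ zero ⁆ 1 (Sub.∣⁅x⁆∣≡1 {suc (suc n)} zero)))
                               (cnt-edge-link {suc (suc (suc n))} {zero} {suc zero} (λ ()) 1)) (arith e)
    ; tris  = trans (cong₂ _+_ (cong₂ _+_ (cong₂ _+_ tris (count {suc n} ∅ 2 (Sub.∣⊥∣≡0 (suc n)))) (count {suc (suc n)} ⁅ zero ⁆ 2 (Sub.∣⁅x⁆∣≡1 {suc (suc n)} zero)))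
                               (cnt-edge-link {suc (suc (suc n))} {zero} {suc zero} (λ ()) 2)) (arith′ t)
    }
    where
    count : ∀ {N} (U : Subset N) s {u} → ∣ U ∣ ≡ u → cnt (_⊆ᵇ U) s ≡ u C s
    count U s e = trans (cnt-⊆ᵇ U s) (cong (_C s) e)
    arith : ∀ (e : ℕ) → e + 0 + 1 + 2 ≡ 3 + e
    arith = solve-∀
    arith′ : ∀ (t : ℕ) → t + 0 + 0 + 1 ≡ 1 + t
    arith′ = solve-∀

disjoint-triangles : ∀ {n e t} k → Surface (suc n) e t → Surface (suc (k * 3 + n)) (k * 3 + e) (k + t)
disjoint-triangles zero    S = S
disjoint-triangles (suc k) S = Disjoint.surface (disjoint-triangles k S)

-- The h-vector

private
  hv : (ℕ → ℕ) → ℕ → ℤ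
  hv f k = foldr _+ℤ_ (+ 0) (map (λ i → signℤ (k ∸ i) (+ (((3 ∸ i) C (k ∸ i)) * f i))) (upTo (suc k)))

module _ {Δ : FaceFamily n} (simplicial : IsSimplicialComplex Δ) (v : Fin n) (dim : dimPlusOne Δ ≡ 3) where

  private
    f : ℕ → ℕ
    f = fcount Δ

    hvec≡ : ∀ k → hvec Δ k ≡ hv f k
    hvec≡ k = cong (λ d → foldr _+ℤ_ (+ 0) (map (λ i → signℤ (k ∸ i) (+ (((d ∸ i) C (k ∸ i)) * f i))) (upTo (suc k)))) dim

    f₀ : f 0 ≡ 1
    f₀ = trans (fcount≡cnt Δ 0) (trans (cnt₀ Δ)
      (cong (λ b → if b then 1 else 0) (proj₂ simplicial ⁅ v ⁆ ∅ Sub.⊥⊆ (proj₁ simplicial v))))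

    f₁ : f 1 ≡ n
    f₁ = trans (fcount≡cnt Δ 1) (cnt₁ Δ (proj₁ simplicial))

  hvec₀ : hvec Δ 0 ≡ + 1
  hvec₀ = trans (hvec≡ 0) (cong (λ a → + (1 * a) +ℤ + 0) f₀)

  hvec₁ : hvec Δ 1 ≡ + n -ℤ + 3
  hvec₁ = trans (hvec≡ 1) (trans (cong₂ (λ a b → - (+ (3 * a)) +ℤ (+ (1 * b) +ℤ + 0)) f₀ f₁)
    (trans (cong (λ z → - (+ 3) +ℤ (z +ℤ + 0)) (ℤ.pos-* 1 n)) (arith (+ n))))
    where
    arith : ∀ (N : ℤ) → - (+ 3) +ℤ (+ 1 *ℤ N +ℤ + 0) ≡ N -ℤ + 3
    arith = ℤ-Solver.solve-∀

  hvec₂ : hvec Δ 2 ≡ + cnt Δ 2 -ℤ + 2 *ℤ + n +ℤ + 3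
  hvec₂ = trans (hvec≡ 2) (trans (cong₂ (λ a b → + (3 * a) +ℤ (- (+ (2 * b)) +ℤ (+ (1 * f 2) +ℤ + 0))) f₀ f₁)
    (trans (cong₂ (λ y z → + 3 +ℤ (- y +ℤ (z +ℤ + 0))) (ℤ.pos-* 2 n) (trans (ℤ.pos-* 1 (f 2)) (cong (λ e → + 1 *ℤ + e) (fcount≡cnt Δ 2))))
      (arith (+ n) (+ cnt Δ 2))))
    where
    arith : ∀ (N E : ℤ) → + 3 +ℤ (- (+ 2 *ℤ N) +ℤ (+ 1 *ℤ E +ℤ + 0)) ≡ E -ℤ + 2 *ℤ N +ℤ + 3
    arith = ℤ-Solver.solve-∀

  hvec₃ : hvec Δ 3 ≡ + cnt Δ 3 -ℤ + cnt Δ 2 +ℤ + n -ℤ + 1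
  hvec₃ = trans (hvec≡ 3) (trans (cong₂ (λ a b → - (+ (1 * a)) +ℤ (+ (1 * b) +ℤ (- (+ (1 * f 2)) +ℤ (+ (1 * f 3) +ℤ + 0)))) f₀ f₁)
    (trans (cong₂ (λ x yz → - (+ 1) +ℤ (x +ℤ yz)) (ℤ.pos-* 1 n) (cong₂ (λ y z → - y +ℤ (z +ℤ + 0))
        (trans (ℤ.pos-* 1 (f 2)) (cong (λ e → + 1 *ℤ + e) (fcount≡cnt Δ 2)))
        (trans (ℤ.pos-* 1 (f 3)) (cong (λ e → + 1 *ℤ + e) (fcount≡cnt Δ 3)))))
      (arith (+ n) (+ cnt Δ 2) (+ cnt Δ 3))))
    where
    arith : ∀ (N E F : ℤ) → - (+ 1) +ℤ (+ 1 *ℤ N +ℤ (- (+ 1 *ℤ E) +ℤ (+ 1 *ℤ F +ℤ + 0))) ≡ F -ℤ E +ℤ N -ℤ + 1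
    arith = ℤ-Solver.solve-∀

IsBuchsbaumVector : ∀ {c ℓ} → Field c ℓ → ℤ → ℤ → ℤ → Set ℓ
IsBuchsbaumVector K h₁ h₂ h₃ = ∃[ n ] ∃[ Δ ] (IsSimplicialComplex {n} Δ × dimPlusOne Δ ≡ 3 ×
  LinAlg.IsBuchsbaum K Δ × hvec Δ 0 ≡ + 1 × hvec Δ 1 ≡ h₁ × hvec Δ 2 ≡ h₂ × hvec Δ 3 ≡ h₃)

IsMuraiVector : ℤ → ℤ → ℤ → Set
IsMuraiVector h₁ h₂ h₃ = ∃[ h₁' ] ∃[ h₂' ] ∃[ h₃' ] ∃[ k ]
  (h₂' ≤ (h₁' + 1) C 2 × - (+ h₂') ≤ℤ + 3 *ℤ h₃' × h₃' ≤ℤ + (h₂' ^⟨ 2 ⟩) ×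
   h₁ ≡ + h₁' +ℤ + 3 *ℤ + k × h₂ ≡ + h₂' -ℤ + 3 *ℤ + k × h₃ ≡ h₃' +ℤ + k)

[n+1]C2≡tri : ∀ n → (n + 1) C 2 ≡ tri n
[n+1]C2≡tri n = trans (cong (_C 2) (ℕ.+-comm n 1)) ([1+n]C2≡tri n)

necessity : ∀ {c ℓ} (K : Field c ℓ) {h₁ h₂ h₃ : ℤ} → IsBuchsbaumVector K h₁ h₂ h₃ → IsMuraiVector h₁ h₂ h₃
necessity K (zero , Δ , _ , dim , _) =
  contradiction (subst (_≤ 0) dim (dim-least Δ (λ { {[]} _ → z≤n }))) λ ()
necessity K {h₁} {h₂} {h₃} (suc n′ , Δ , simplicial , dim , B , _ , refl , refl , refl) =
  m , s , + T -ℤ + ω , extra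
  , subst (s ≤_) (sym ([n+1]C2≡tri m)) bound
  , lower , upper , first , second , thrd
  where
  N = suc n′
  P = buchsbaum⇒pure₃ K simplicial dim B
  crossing : ∀ v (S : Fin N → Bool) {y z} → link Δ ⁅ v ⁆ ⁅ y ⁆ ≡ true → S y ≡ true → link Δ ⁅ v ⁆ ⁅ z ⁆ ≡ true → S z ≡ false →
             ∃₂ λ a b → Adjacent (link Δ ⁅ v ⁆) a b × S a ≡ true × S b ≡ false
  crossing = link-crossing K simplicial dim B
  open Decomposition (decompose Δ P crossing zero) renaming (h₁ to m; h₂ to s)
  T = cnt Δ 3
  ω = suc extra + m + s
  +ω : + ω ≡ (+ 1 +ℤ + extra) +ℤ + m +ℤ + s
  +ω = trans (ℤ.pos-+ (suc extra + m) s) (cong (_+ℤ + s) (ℤ.pos-+ (suc extra) m))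
  +n : + N ≡ + 3 *ℤ (+ 1 +ℤ + extra) +ℤ + m
  +n = trans (cong +_ size) (trans (ℤ.pos-+ (3 * suc extra) m) (cong (_+ℤ + m) (ℤ.pos-* 3 (suc extra))))
  +e : + cnt Δ 2 ≡ + 3 *ℤ (+ 1 +ℤ + extra) +ℤ + 2 *ℤ + m +ℤ + s
  +e = trans (cong +_ edges) (trans (ℤ.pos-+ (3 * suc extra + 2 * m) s) (cong (_+ℤ + s)
         (trans (ℤ.pos-+ (3 * suc extra) (2 * m)) (cong₂ _+ℤ_ (ℤ.pos-* 3 (suc extra)) (ℤ.pos-* 2 m)))))
  first : hvec Δ 1 ≡ + m +ℤ + 3 *ℤ + extra
  first = trans (hvec₁ simplicial zero dim) (trans (cong (_-ℤ + 3) +n) (arith (+ extra) (+ m)))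
    where
    arith : ∀ (K M : ℤ) → + 3 *ℤ (+ 1 +ℤ K) +ℤ M -ℤ + 3 ≡ M +ℤ + 3 *ℤ K
    arith = ℤ-Solver.solve-∀
  second : hvec Δ 2 ≡ + s -ℤ + 3 *ℤ + extra
  second = trans (hvec₂ simplicial zero dim) (trans (cong₂ (λ e N → e -ℤ + 2 *ℤ N +ℤ + 3) +e +n) (arith (+ extra) (+ m) (+ s)))
    where
    arith : ∀ (K M S : ℤ) → + 3 *ℤ (+ 1 +ℤ K) +ℤ + 2 *ℤ M +ℤ S -ℤ + 2 *ℤ (+ 3 *ℤ (+ 1 +ℤ K) +ℤ M) +ℤ + 3 ≡ S -ℤ + 3 *ℤ K
    arith = ℤ-Solver.solve-∀
  thrd : hvec Δ 3 ≡ + T -ℤ + ω +ℤ + extra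
  thrd = trans (hvec₃ simplicial zero dim) (trans (cong₂ (λ e N → + T -ℤ e +ℤ N -ℤ + 1) +e +n)
           (trans (arith (+ extra) (+ m) (+ s) (+ T)) (cong (λ ω → + T -ℤ ω +ℤ + extra) (sym +ω))))
    where
    arith : ∀ (K M S F : ℤ) → F -ℤ (+ 3 *ℤ (+ 1 +ℤ K) +ℤ + 2 *ℤ M +ℤ S) +ℤ (+ 3 *ℤ (+ 1 +ℤ K) +ℤ M) -ℤ + 1 ≡ F -ℤ ((+ 1 +ℤ K) +ℤ M +ℤ S) +ℤ K
    arith = ℤ-Solver.solve-∀
  weight : 3 * ω ≤ 3 * T + s
  weight = ℕ.+-cancelʳ-≤ N (3 * ω) (3 * T + s) (begin
    3 * ω + N                        ≡⟨ cong (λ N → 3 * ω + N) size ⟩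
    3 * ω + (3 * suc extra + m)          ≡⟨ arith₁ (suc extra) m s ⟩
    2 * (3 * suc extra + 2 * m + s) + s  ≡⟨ cong (λ e → 2 * e + s) edges ⟨
    2 * cnt Δ 2 + s                  ≤⟨ ℕ.+-monoˡ-≤ s (euler-bound Δ P crossing) ⟩
    3 * T + N + s                    ≡⟨ arith₂ (3 * T) N s ⟩
    3 * T + s + N                    ∎)
    where
    open ℕ.≤-Reasoning
    arith₁ : ∀ (k m s : ℕ) → 3 * (k + m + s) + (3 * k + m) ≡ 2 * (3 * k + 2 * m + s) + s
    arith₁ = solve-∀
    arith₂ : ∀ (a b c : ℕ) → a + b + c ≡ a + c + b
    arith₂ = solve-∀
  lower : - (+ s) ≤ℤ + 3 *ℤ (+ T -ℤ + ω)
  lower = subst₂ _≤ℤ_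
    (trans (cong (_-ℤ (+ 3 *ℤ + ω +ℤ + s)) (ℤ.pos-* 3 ω)) (arith₁ (+ ω) (+ s)))
    (trans (cong (_-ℤ (+ 3 *ℤ + ω +ℤ + s)) (trans (ℤ.pos-+ (3 * T) s) (cong (_+ℤ + s) (ℤ.pos-* 3 T)))) (arith₂ (+ T) (+ ω) (+ s)))
    (ℤ.+-monoˡ-≤ (- (+ 3 *ℤ + ω +ℤ + s)) (_≤ℤ_.+≤+ weight))
    where
    arith₁ : ∀ (W S : ℤ) → + 3 *ℤ W -ℤ (+ 3 *ℤ W +ℤ S) ≡ - S
    arith₁ = ℤ-Solver.solve-∀
    arith₂ : ∀ (F W S : ℤ) → + 3 *ℤ F +ℤ S -ℤ (+ 3 *ℤ W +ℤ S) ≡ + 3 *ℤ (F -ℤ W)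
    arith₂ = ℤ-Solver.solve-∀
  upper : + T -ℤ + ω ≤ℤ + (s ^⟨ 2 ⟩)
  upper = subst (+ T -ℤ + ω ≤ℤ_)
    (trans (cong (_-ℤ + ω) (ℤ.pos-+ ω (s ^⟨ 2 ⟩))) (arith (+ ω) (+ (s ^⟨ 2 ⟩))))
    (ℤ.+-monoˡ-≤ (- (+ ω)) (_≤ℤ_.+≤+ tris))
    where
    arith : ∀ (W G : ℤ) → W +ℤ G -ℤ W ≡ G
    arith = ℤ-Solver.solve-∀

realize : ∀ a b (h₃ : ℤ) → b ≤ (a + 1) C 2 → - (+ b) ≤ℤ + 3 *ℤ h₃ → h₃ ≤ℤ + (b ^⟨ 2 ⟩) →
          ∃[ d ] (+ d ≡ + b +ℤ h₃ × Realized (3 + a) b d)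
realize a b (+ c) b≤ _ c≤ = b + c , ℤ.pos-+ b c , nonnegative a b c (subst (b ≤_) ([n+1]C2≡tri a) b≤) (ℤ.drop‿+≤+ c≤)
realize a b h₃@(-[1+ q′ ]) b≤ ≤h₃ _ with nonpositive a b (suc q′) (subst (b ≤_) ([n+1]C2≡tri a) b≤) 3q≤b
  where
  3q≤b : suc q′ * 3 ≤ b
  3q≤b = subst (_≤ b) (ℕ.*-comm 3 (suc q′)) (ℤ.drop‿+≤+ (ℤ.neg-cancel-≤ (subst (- (+ b) ≤ℤ_)
           (trans (sym (ℤ.neg-distribʳ-* (+ 3) (+ suc q′))) (cong -_ (sym (ℤ.pos-* 3 (suc q′))))) ≤h₃)))
... | d , refl , R = d , sym (trans (cong (_+ℤ h₃) (ℤ.pos-+ d (suc q′))) (arith (+ d) (+ suc q′))) , R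
  where
  arith : ∀ (D Q : ℤ) → D +ℤ Q +ℤ - Q ≡ D
  arith = ℤ-Solver.solve-∀

sufficiency : ∀ {c ℓ} (K : Field c ℓ) {h₁ h₂ h₃ : ℤ} → IsMuraiVector h₁ h₂ h₃ → IsBuchsbaumVector K h₁ h₂ h₃
sufficiency K (a , b , h₃ , k , b≤ , ≤h₃ , h₃≤ , refl , refl , refl) with realize a b h₃ b≤ ≤h₃ h₃≤
... | d , +d , R = suc (k * 3 + (2 + a)) , Δ , simplicial , dim
  , buchsbaum K pure₃ connected zero , hvec₀ simplicial zero dim , first , second , thrd
  where
  open Surface (disjoint-triangles k (realized⇒surface R))
  open Pure₃ pure₃ using (simplicial)
  dim : dimPlusOne Δ ≡ 3
  dim = dim≡3 K pure₃ zero
  +n : + suc (k * 3 + (2 + a)) ≡ + 1 +ℤ (+ k *ℤ + 3 +ℤ (+ 2 +ℤ + a))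
  +n = cong (+ 1 +ℤ_) (trans (ℤ.pos-+ (k * 3) (2 + a)) (cong (_+ℤ + (2 + a)) (ℤ.pos-* k 3)))
  +e : + cnt Δ 2 ≡ + k *ℤ + 3 +ℤ (+ 3 +ℤ + 2 *ℤ + a +ℤ + b)
  +e = trans (cong +_ edges) (trans (ℤ.pos-+ (k * 3) (3 + 2 * a + b)) (cong₂ _+ℤ_ (ℤ.pos-* k 3)
         (trans (ℤ.pos-+ (3 + 2 * a) b) (cong (_+ℤ + b) (trans (ℤ.pos-+ 3 (2 * a)) (cong (+ 3 +ℤ_) (ℤ.pos-* 2 a)))))))
  +t : + cnt Δ 3 ≡ + k +ℤ (+ 1 +ℤ + a +ℤ (+ b +ℤ h₃))
  +t = trans (cong +_ tris) (trans (ℤ.pos-+ k (1 + a + d)) (cong (+ k +ℤ_) (trans (ℤ.pos-+ (1 + a) d) (cong (+ (1 + a) +ℤ_) +d))))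
  first : hvec Δ 1 ≡ + a +ℤ + 3 *ℤ + k
  first = trans (hvec₁ simplicial zero dim) (trans (cong (_-ℤ + 3) +n) (arith (+ k) (+ a)))
    where
    arith : ∀ (K A : ℤ) → + 1 +ℤ (K *ℤ + 3 +ℤ (+ 2 +ℤ A)) -ℤ + 3 ≡ A +ℤ + 3 *ℤ K
    arith = ℤ-Solver.solve-∀
  second : hvec Δ 2 ≡ + b -ℤ + 3 *ℤ + k
  second = trans (hvec₂ simplicial zero dim) (trans (cong₂ (λ e n → e -ℤ + 2 *ℤ n +ℤ + 3) +e +n) (arith (+ k) (+ a) (+ b)))
    where
    arith : ∀ (K A B : ℤ) → K *ℤ + 3 +ℤ (+ 3 +ℤ + 2 *ℤ A +ℤ B) -ℤ + 2 *ℤ (+ 1 +ℤ (K *ℤ + 3 +ℤ (+ 2 +ℤ A))) +ℤ + 3 ≡ B -ℤ + 3 *ℤ K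
    arith = ℤ-Solver.solve-∀
  thrd : hvec Δ 3 ≡ h₃ +ℤ + k
  thrd = trans (hvec₃ simplicial zero dim) (trans (cong₂ (λ t en → t -ℤ proj₁ en +ℤ proj₂ en -ℤ + 1) +t (cong₂ _,_ +e +n))
           (arith (+ k) (+ a) (+ b) h₃))
    where
    arith : ∀ (K A B C : ℤ) → K +ℤ (+ 1 +ℤ A +ℤ (B +ℤ C)) -ℤ (K *ℤ + 3 +ℤ (+ 3 +ℤ + 2 *ℤ A +ℤ B))
              +ℤ (+ 1 +ℤ (K *ℤ + 3 +ℤ (+ 2 +ℤ A))) -ℤ + 1 ≡ C +ℤ K
    arith = ℤ-Solver.solve-∀

theorem1p2 : ∀ {c ℓ} (K : Field c ℓ) (h₁ h₂ h₃ : ℤ) →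
    (∃[ n ] ∃[ Δ ] (IsSimplicialComplex {n} Δ × dimPlusOne Δ ≡ 3 ×
    LinAlg.IsBuchsbaum K Δ ×
    hvec Δ 0 ≡ + 1 × hvec Δ 1 ≡ h₁ × hvec Δ 2 ≡ h₂ × hvec Δ 3 ≡ h₃))
    ⇔
    (∃[ h₁' ] ∃[ h₂' ] ∃[ h₃' ] ∃[ k ]
    (h₂' ≤ (h₁' + 1) C 2 ×
    - (+ h₂') ≤ℤ + 3 *ℤ h₃' ×
    h₃' ≤ℤ + (h₂' ^⟨ 2 ⟩) ×
    h₁ ≡ + h₁' +ℤ + 3 *ℤ + k ×
    h₂ ≡ + h₂' -ℤ + 3 *ℤ + k ×
    h₃ ≡ h₃' +ℤ + k))
theorem1p2 K h₁ h₂ h₃ = mk⇔ (necessity K) (sufficiency K)
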